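{- Let $F$ be a fixed graph which is not vertex-balanced. For every $\delta>0$ there exist constants $K_1,K_2>0$ such that, for $n$ restricted to multiples of $v(F)$, if $K_1n^{2-1/d^*(F)}\leq t\leq n^{2-\delta}$, then there exists a successful $\big(t,\,K_2t^{1-d^*(F)}n^{2d^*(F)-1}\big)$-strategy for an $F$-factor.
   Context: Budget-constrained random graph process: let $M=\binom{n}{2}$. The edges of $K_n$ on vertex set $[n]$ are put in a uniformly random order $e_1,e_2,\ldots,e_M$. Builder is presented $e_1,\ldots,e_t$ one by one and, as each edge is presented and without knowledge of future edges, must irrevocably decide (possibly using additional randomness) whether to purchase it; she may purchase at most $b$ edges in total. A $(t,b)$-strategy is a rule for these decisions; $B_t$ denotes the graph of purchased edges after time $t$. A strategy is successful for a property if $B_t$ satisfies it with probability tending to $1$ as $n\to\infty$. An $F$-factor in an $n$-vertex graph is a collection of $n/v(F)$ vertex-disjoint copies of $F$. For $F$ with at least two vertices, $d(F)=e(F)/(v(F)-1)$, $d^*(F)=\max\{d(F'):F'\subseteq F,\ v(F')\geq 2\}$, and for $v\in V(F)$, $d^*(v,F)=\max\{d(F'):F'\subseteq F,\ v(F')\geq 2,\ v\in V(F')\}$. $F$ is vertex-balanced if $d^*(v,F)=d^*(F)$ for every $v\in V(F)$. -}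

module Defs where

open import Data.Nat using (ℕ; zero; suc; _+_; _*_; _∸_; _^_; _≤_; _<_; _≥_; _<?_)
open import Data.Nat.Divisibility using (_∣_)
open import Data.Bool using (Bool; true; false; _∧_; if_then_else_)
open import Data.Fin using (Fin; toℕ)
open import Data.Fin.Subset as Sub using (Subset; ∣_∣)
open import Data.List using (List; []; _∷_; length; take; filter; concatMap; map; cartesianProduct; allFin; sum)
open import Data.List.Membership.Propositional using (_∈_)
open import Data.List.Relation.Unary.All using (All)
open import Data.List.Relation.Unary.Unique.Propositional using (Unique)
open import Data.List.Relation.Binary.Sublist.Propositional using (_⊆_)
open import Data.Product using (Σ; ∃; _×_; _,_; proj₁; proj₂)
open import Data.Sum using (_⊎_)
open import Relation.Binary.PropositionalEquality using (_≡_)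
open import Relation.Nullary using (¬_; does)

record Graph : Set where
  field
    k       : ℕ
    E       : List (Fin k × Fin k)
    ordered : All (λ e → toℕ (proj₁ e) < toℕ (proj₂ e)) E
    unique  : Unique E
open Graph public

record SubG (F : Graph) : Set where
  field
    S   : Subset (k F)
    E'  : List (Fin (k F) × Fin (k F))
    sub : E' ⊆ E F
    ends : All (λ e → (proj₁ e Sub.∈ S) × (proj₂ e Sub.∈ S)) E'
open SubG public

-- Densities d(F') = e(F')/(v(F')-1) are compared with the rational D = p/q
-- (q ≥ 1) by cross multiplication.
densEq : {F : Graph} → SubG F → ℕ → ℕ → Set
densEq H p q = length (E' H) * q ≡ p * (∣ S H ∣ ∸ 1)

densLe : {F : Graph} → SubG F → ℕ → ℕ → Set
densLe H p q = length (E' H) * q ≤ p * (∣ S H ∣ ∸ 1)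

IsDStar : Graph → ℕ → ℕ → Set
IsDStar F p q =
  (Σ (SubG F) λ H → (2 ≤ ∣ S H ∣) × densEq H p q) ×
  ((H : SubG F) → 2 ≤ ∣ S H ∣ → densLe H p q)

IsDStarAt : (F : Graph) → Fin (k F) → ℕ → ℕ → Set
IsDStarAt F v p q =
  (Σ (SubG F) λ H → (2 ≤ ∣ S H ∣) × (v Sub.∈ S H) × densEq H p q) ×
  ((H : SubG F) → 2 ≤ ∣ S H ∣ → v Sub.∈ S H → densLe H p q)

VertexBalanced : Graph → Set
VertexBalanced F =
  (p q : ℕ) → 1 ≤ q → IsDStar F p q → (v : Fin (k F)) → IsDStarAt F v p q

Edge : ℕ → Set
Edge n = Fin n × Fin n

allEdges : (n : ℕ) → List (Edge n)
allEdges n = filter (λ e → toℕ (proj₁ e) <? toℕ (proj₂ e))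
                    (cartesianProduct (allFin n) (allFin n))

insertions : {A : Set} → A → List A → List (List A)
insertions x [] = (x ∷ []) ∷ []
insertions x (y ∷ ys) = (x ∷ y ∷ ys) ∷ map (y ∷_) (insertions x ys)

perms : {A : Set} → List A → List (List A)
perms [] = [] ∷ []
perms (x ∷ xs) = concatMap (insertions x) (perms xs)

orderings : (n : ℕ) → List (List (Edge n))
orderings n = perms (allEdges n)

-- A deterministic builder strategy: given the previously presented edges
-- (most recent first) and the currently presented edge, decide whether to buy.
Strategy : ℕ → Set
Strategy n = List (Edge n) → Edge n → Bool

runFrom : {n : ℕ} → Strategy n → ℕ → List (Edge n) → ℕ → List (Edge n) → List (Edge n)
runFrom s b hist bought [] = []
runFrom s b hist bought (e ∷ es) =
  if s hist e ∧ does (bought <? b)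
  then e ∷ runFrom s b (e ∷ hist) (suc bought) es
  else runFrom s b (e ∷ hist) bought es

Bt : {n : ℕ} → Strategy n → (t b : ℕ) → List (Edge n) → List (Edge n)
Bt s t b ord = runFrom s b [] 0 (take t ord)

Adj : {n : ℕ} → List (Edge n) → Fin n → Fin n → Set
Adj B x y = ((x , y) ∈ B) ⊎ ((y , x) ∈ B)

HasFactor : (F : Graph) → (n : ℕ) → List (Edge n) → Set
HasFactor F n B =
  Σ ℕ λ m → (m * k F ≡ n) ×
  (Σ (Fin m → Fin (k F) → Fin n) λ ψ →
     ((i i' : Fin m) (j j' : Fin (k F)) → ψ i j ≡ ψ i' j' → (i ≡ i') × (j ≡ j')) ×
     ((i : Fin m) → All (λ e → Adj B (ψ i (proj₁ e)) (ψ i (proj₂ e))) (E F)))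

AtLeast : {A : Set} → (A → Set) → ℕ → List A → Set
AtLeast {A} P r xs = Σ (List A) λ ys → (ys ⊆ xs) × (r ≤ length ys) × All P ys

-- A randomized strategy is a nonempty list of deterministic strategies, one
-- chosen uniformly at random (independently of the ordering).
-- SuccProb≥ F n t b L m :  Pr[ B_t has an F-factor ] ≥ 1 - 1/m,
-- i.e. #failures * m ≤ #total, where outcomes are (strategy, ordering) pairs.
SuccProbAtLeast : (F : Graph) (n t b : ℕ) → List (Strategy n) → ℕ → Set
SuccProbAtLeast F n t b L m =
  let outcomes = cartesianProduct L (orderings n)
      total    = length outcomes
  in Σ ℕ λ r → AtLeast (λ o → HasFactor F n (Bt (proj₁ o) t b (proj₂ o))) r outcomes
             × ((total ∸ r) * m ≤ total)

{-# OPTIONS --safe #-}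

{- Cut the vertices into chunks of size about (n² / t)^(d*) and buy every presented edge inside a chunk; this costs about
   t^(1 − d*) n^(2 d* − 1) edges, and each chunk sees a random graph whose density is a large constant times |chunk|^(−1/d*).

   Inside a chunk, first merge the vertices of F into maximal tight classes, the subgraphs of density d*.  Since F is not
   vertex-balanced, some vertex u is a class of its own, so packing the classes may waste a small proportion of the vertices.
   After contracting the classes every subgraph has density strictly below d*, which leaves polynomial slack for the rest of F.

   Both steps rest on minimal fragments (Park and Pham): for a spread family H, a random S in H and a random set W of density
   1 / D, let T be the smallest set S′ ∖ W with S′ in H and S′ ⊆ S ∪ W.  Then T lies in S and in a set determined by W ∪ T,
   so there are few choices of T and it is usually small.  One application at constant density covers all but a small
   proportion of some packing; with polynomial slack, boundedly many applications leave nothing uncovered, and independent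
   repetitions make the failure probability small enough for a union bound over the chunks.

   The spread of the family of transversal copies of a template on s classes of m vertices is a count of permutations: a set
   of template edges determines the locations of its vertices up to one free choice per connected component. -}

module Submission where

open import Data.Nat using (ℕ; NonZero; >-nonZero; >-nonZero⁻¹; zero; suc; _+_; _*_; _∸_; _^_; _≤_; _<_; z≤n; s≤s; _≤?_; _<?_; _≟_; pred; _!; _⊓_; _≥_)
open import Data.Nat.Properties
open import Data.Nat.Divisibility using (_∣_; quotient)
open import Data.Nat.DivMod using (_/_; m≡m%n+[m/n]*n; m%n<n; m/n*n≤m; m/n≤m; m<n*o⇒m/o<n)
open import Data.Nat.Tactic.RingSolver using (solve-∀)
open import Data.Bool as Bool using (Bool; true; false; _∨_; if_then_else_)
open import Data.Bool.Properties using (∧-zeroʳ; T?)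
open import Data.Fin as Fin using (Fin; zero; suc)
open import Data.Fin.Subset using (Subset; inside; outside; _∈_; _∉_; _⊆_; _⊂_; _∪_; _∩_; _─_; ∣_∣; ⊥; ⊤; Empty; Nonempty; ⁅_⁆)
open import Data.Fin.Subset.Properties
open import Data.List using (List; []; _∷_; _++_; map; length; filter; concatMap; cartesianProduct; take; drop; concat; filterᵇ; downFrom; lookup; allFin)
open import Data.List.Properties using (length-++; length-map; map-tabulate; length-tabulate; length-drop; length-take; take++drop≡id; length-filter; ++-identityʳ; filter-all; filter-notAll)
open import Data.List.Relation.Binary.Permutation.Propositional as Perm using (_↭_; ↭-refl; ↭-trans; ↭-prep; ↭-swap; ↭-sym)
open import Data.List.Relation.Binary.Permutation.Propositional.Properties using (∈-resp-↭; All-resp-↭)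
import Data.List.Membership.Propositional as L
open import Data.List.Membership.Propositional.Properties using (∈-++⁺ˡ; ∈-++⁺ʳ; ∈-map⁺; ∈-map⁻; ∈-filter⁺; ∈-filter⁻; ∈-concatMap⁻; ∈-concatMap⁺; ∈-allFin; ∈-cartesianProduct⁺; ∈-cartesianProduct⁻; ∈-lookup)
open import Data.List.Relation.Unary.All as AllP using (All; []; _∷_)
open import Data.List.Relation.Unary.AllPairs using ([]; _∷_)
open import Data.List.Relation.Unary.Unique.Propositional using (Unique)
import Data.List.Relation.Unary.Unique.Propositional.Properties as UniqueP
import Data.Fin.Properties as FinP
open import Data.List.Relation.Unary.Any as Any using (Any; here; there; any?)
open import Data.List.Relation.Unary.Any.Properties using (lookup-index)
open import Data.List.Relation.Unary.All.Properties using (all-filter)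
import Data.List.Relation.Binary.Sublist.Propositional as Sublist
open import Data.List.Relation.Binary.Sublist.Propositional.Properties using (filter-⊆; Any-resp-⊆)
open import Data.Vec as Vec using (Vec; []; _∷_; here; there)
open import Data.Vec.Properties using (lookup∘tabulate; lookup⇒[]=; []=⇒lookup; tabulate-cong)
open import Data.Product using (Σ; ∃; _×_; _,_; proj₁; proj₂)
open import Data.Product.Properties using (≡-dec)
open import Data.Sum using (_⊎_; inj₁; inj₂)
import Data.Empty
open import Data.Empty using (⊥-elim)
open import Relation.Nullary using (¬_; Dec; yes; no; does)
open import Relation.Nullary.Decidable using (_×-dec_; _→-dec_; ¬?; does-⇔; dec-true; dec-false)
open import Relation.Binary.Definitions using (tri<; tri≈; tri>)
open import Relation.Binary.PropositionalEquality using (_≡_; _≢_; refl; sym; trans; cong; cong₂; subst; module ≡-Reasoning)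
open import Function using (_∘_; id)
open import Function.Bundles using (mk⇔)
open import Defs hiding (sub)

-- Finite sums and the product measure

-- The inner and the outer edges need different treatment because of where the density stands. For a
-- tight class the density of a chunk exceeds the threshold only by a constant factor, where a
-- perfect packing would in general need a further logarithmic factor; so only a near packing is
-- sought there. The bound `t ≤ n^(2 − δ)` makes every chunk polynomially large in `n`. This keeps
-- the number of rounds constant and pushes the failure probability of a chunk below `1/n`.
--
-- Everything is stated in ℕ. A probability bound is an inequality between weighted counts with
-- denominators cleared, and `d* = p/q` enters only through `p`-th and `q`-th powers.
--
-- The random set is a union of a constant number of independent rounds of density `1/D`: one round
-- for the inner packing, the others for repeated attempts at the outer edges. An ordering is
-- compared with this union through its prefixes. It is enough that the union has at most `t` edges
-- and at most `b` inside chunks, both of which follow from exponential tails.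

∑ : {A : Set} → List A → (A → ℕ) → ℕ
∑ [] f = 0
∑ (x ∷ xs) f = f x + ∑ xs f

module _ {A : Set} where

  ∑-mono-∈ : (xs : List A) {f g : A → ℕ} → (∀ {x} → x L.∈ xs → f x ≤ g x) → ∑ xs f ≤ ∑ xs g
  ∑-mono-∈ [] h = z≤n
  ∑-mono-∈ (x ∷ xs) h = +-mono-≤ (h (here refl)) (∑-mono-∈ xs (h ∘ there))

  ∑-mono : (xs : List A) {f g : A → ℕ} → (∀ x → f x ≤ g x) → ∑ xs f ≤ ∑ xs g
  ∑-mono xs h = ∑-mono-∈ xs (λ {x} _ → h x)

  ∑-cong-∈ : (xs : List A) {f g : A → ℕ} → (∀ {x} → x L.∈ xs → f x ≡ g x) → ∑ xs f ≡ ∑ xs g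
  ∑-cong-∈ [] h = refl
  ∑-cong-∈ (x ∷ xs) h = cong₂ _+_ (h (here refl)) (∑-cong-∈ xs (h ∘ there))

  ∑-cong : (xs : List A) {f g : A → ℕ} → (∀ x → f x ≡ g x) → ∑ xs f ≡ ∑ xs g
  ∑-cong xs h = ∑-cong-∈ xs (λ {x} _ → h x)

  ∑-+ : (xs : List A) (f g : A → ℕ) → ∑ xs (λ x → f x + g x) ≡ ∑ xs f + ∑ xs g
  ∑-+ [] f g = refl
  ∑-+ (x ∷ xs) f g rewrite ∑-+ xs f g = lem (f x) (g x) (∑ xs f) (∑ xs g)
    where
    lem : ∀ a b c d → (a + b) + (c + d) ≡ (a + c) + (b + d)
    lem = solve-∀

  ∑-*ˡ : (xs : List A) (c : ℕ) (f : A → ℕ) → ∑ xs (λ x → c * f x) ≡ c * ∑ xs f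
  ∑-*ˡ [] c f = sym (*-zeroʳ c)
  ∑-*ˡ (x ∷ xs) c f rewrite ∑-*ˡ xs c f = sym (*-distribˡ-+ c (f x) (∑ xs f))

  ∑-*ʳ : (xs : List A) (c : ℕ) (f : A → ℕ) → ∑ xs (λ x → f x * c) ≡ ∑ xs f * c
  ∑-*ʳ xs c f = trans (∑-cong xs λ x → *-comm (f x) c) (trans (∑-*ˡ xs c f) (*-comm c (∑ xs f)))

  ∑-const : (xs : List A) (c : ℕ) → ∑ xs (λ _ → c) ≡ length xs * c
  ∑-const [] c = refl
  ∑-const (x ∷ xs) c = cong (c +_) (∑-const xs c)

  ∑-zero : (xs : List A) → ∑ xs (λ _ → 0) ≡ 0
  ∑-zero xs = trans (∑-const xs 0) (*-zeroʳ (length xs))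

  ∑-++ : (xs ys : List A) (f : A → ℕ) → ∑ (xs ++ ys) f ≡ ∑ xs f + ∑ ys f
  ∑-++ [] ys f = refl
  ∑-++ (x ∷ xs) ys f rewrite ∑-++ xs ys f = sym (+-assoc (f x) (∑ xs f) (∑ ys f))

  ∑-term : (xs : List A) (f : A → ℕ) {x : A} → x L.∈ xs → f x ≤ ∑ xs f
  ∑-term (x ∷ xs) f (here refl) = m≤m+n _ _
  ∑-term (x ∷ xs) f (there p) = ≤-trans (∑-term xs f p) (m≤n+m _ _)

module _ {A B : Set} where

  ∑-map : (g : A → B) (xs : List A) (f : B → ℕ) → ∑ (map g xs) f ≡ ∑ xs (f ∘ g)
  ∑-map g [] f = refl
  ∑-map g (x ∷ xs) f = cong (f (g x) +_) (∑-map g xs f)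

  ∑-concatMap : (g : A → List B) (xs : List A) (f : B → ℕ) → ∑ (concatMap g xs) f ≡ ∑ xs (λ x → ∑ (g x) f)
  ∑-concatMap g [] f = refl
  ∑-concatMap g (x ∷ xs) f = trans (∑-++ (g x) _ f) (cong (∑ (g x) f +_) (∑-concatMap g xs f))

  ∑-swap : (xs : List A) (ys : List B) (f : A → B → ℕ) →
    ∑ xs (λ x → ∑ ys (f x)) ≡ ∑ ys (λ y → ∑ xs (λ x → f x y))
  ∑-swap [] ys f = sym (∑-zero ys)
  ∑-swap (x ∷ xs) ys f = trans (cong (∑ ys (f x) +_) (∑-swap xs ys f)) (sym (∑-+ ys (f x) _))

bit : Bool → ℕ
bit true = 1
bit false = 0

𝟙 : {P : Set} → Dec P → ℕ
𝟙 d = bit (does d)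

module _ {P : Set} where

  𝟙≤1 : (d : Dec P) → 𝟙 d ≤ 1
  𝟙≤1 (yes _) = ≤-refl
  𝟙≤1 (no _) = z≤n

  𝟙-yes : (d : Dec P) → P → 𝟙 d ≡ 1
  𝟙-yes (yes _) p = refl
  𝟙-yes (no ¬p) p = ⊥-elim (¬p p)

  𝟙-no : (d : Dec P) → ¬ P → 𝟙 d ≡ 0
  𝟙-no (yes p) ¬p = ⊥-elim (¬p p)
  𝟙-no (no _) ¬p = refl

  𝟙-elim : (d : Dec P) {n : ℕ} → (P → 1 ≤ n) → 𝟙 d ≤ n
  𝟙-elim (yes p) h = h p
  𝟙-elim (no _) h = z≤n

  𝟙-*-elim : (d : Dec P) {m n : ℕ} → (P → m ≤ n) → 𝟙 d * m ≤ n
  𝟙-*-elim (yes p) {m} h = ≤-trans (≤-reflexive (+-identityʳ m)) (h p)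
  𝟙-*-elim (no _) h = z≤n

  𝟙-cases : (f : ℕ → ℕ) (d : Dec P) {n : ℕ} → (P → f 1 ≤ n) → f 0 ≤ n → f (𝟙 d) ≤ n
  𝟙-cases f (yes p) h h₀ = h p
  𝟙-cases f (no _) h h₀ = h₀

  𝟙-¬ : (d : Dec P) → 𝟙 d + 𝟙 (¬? d) ≡ 1
  𝟙-¬ (yes _) = refl
  𝟙-¬ (no _) = refl

𝟙¬≡0 : {P : Set} (d : Dec P) → 𝟙 (¬? d) ≡ 0 → P
𝟙¬≡0 (yes p) _ = p

𝟙-mono : {P Q : Set} (d : Dec P) (d′ : Dec Q) → (P → Q) → 𝟙 d ≤ 𝟙 d′
𝟙-mono d d′ h = 𝟙-elim d (λ p → ≤-reflexive (sym (𝟙-yes d′ (h p))))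

𝟙-cong : {P Q : Set} (d : Dec P) (d′ : Dec Q) → (P → Q) → (Q → P) → 𝟙 d ≡ 𝟙 d′
𝟙-cong d d′ h h′ = ≤-antisym (𝟙-mono d d′ h) (𝟙-mono d′ d h′)

subsets : (N : ℕ) → List (Subset N)
subsets zero = [] ∷ []
subsets (suc N) = map (inside ∷_) (subsets N) ++ map (outside ∷_) (subsets N)

∈-subsets : {N : ℕ} (W : Subset N) → W L.∈ subsets N
∈-subsets [] = here refl
∈-subsets (inside ∷ W) = ∈-++⁺ˡ (∈-map⁺ _ (∈-subsets W))
∈-subsets {suc N} (outside ∷ W) = ∈-++⁺ʳ (map (inside ∷_) (subsets N)) (∈-map⁺ _ (∈-subsets W))

∑-subsets-suc : (N : ℕ) (f : Subset (suc N) → ℕ) →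
  ∑ (subsets (suc N)) f ≡ ∑ (subsets N) (f ∘ (inside ∷_)) + ∑ (subsets N) (f ∘ (outside ∷_))
∑-subsets-suc N f = trans (∑-++ (map (inside ∷_) (subsets N)) _ f)
  (cong₂ _+_ (∑-map _ (subsets N) f) (∑-map _ (subsets N) f))

wt : (h g : ℕ) {N : ℕ} → Subset N → ℕ
wt h g [] = 1
wt h g (inside ∷ W) = h * wt h g W
wt h g (outside ∷ W) = g * wt h g W

opaque

  -- (h + g)^N times the expectation under the product measure with density h / (h + g).
  𝔼 : (h g : ℕ) {N : ℕ} → (Subset N → ℕ) → ℕ
  𝔼 h g {N} φ = ∑ (subsets N) (λ W → wt h g W * φ W)

  𝔼-suc : (h g : ℕ) {N : ℕ} (φ : Subset (suc N) → ℕ) →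
    𝔼 h g φ ≡ h * 𝔼 h g (φ ∘ (inside ∷_)) + g * 𝔼 h g (φ ∘ (outside ∷_))
  𝔼-suc h g {N} φ = trans (∑-subsets-suc N _) (cong₂ _+_ (pull h (inside ∷_) λ _ → refl) (pull g (outside ∷_) λ _ → refl))
    where
    pull : (c : ℕ) (e : Subset N → Subset (suc N)) → (∀ W → wt h g (e W) ≡ c * wt h g W) →
      ∑ (subsets N) (λ W → wt h g (e W) * φ (e W)) ≡ c * 𝔼 h g (φ ∘ e)
    pull c e eq = trans (∑-cong (subsets N) λ W → trans (cong (_* φ (e W)) (eq W)) (*-assoc c _ _)) (∑-*ˡ (subsets N) c _)

  𝔼-mono : (h g : ℕ) {N : ℕ} {φ ψ : Subset N → ℕ} → (∀ W → φ W ≤ ψ W) → 𝔼 h g φ ≤ 𝔼 h g ψ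
  𝔼-mono h g {N} le = ∑-mono (subsets N) λ W → *-monoʳ-≤ (wt h g W) (le W)

  𝔼-cong : (h g : ℕ) {N : ℕ} {φ ψ : Subset N → ℕ} → (∀ W → φ W ≡ ψ W) → 𝔼 h g φ ≡ 𝔼 h g ψ
  𝔼-cong h g {N} le = ∑-cong (subsets N) λ W → cong (wt h g W *_) (le W)

  𝔼-+ : (h g : ℕ) {N : ℕ} (φ ψ : Subset N → ℕ) → 𝔼 h g (λ W → φ W + ψ W) ≡ 𝔼 h g φ + 𝔼 h g ψ
  𝔼-+ h g {N} φ ψ = trans (∑-cong (subsets N) λ W → *-distribˡ-+ (wt h g W) _ _) (∑-+ (subsets N) _ _)

  𝔼-*ˡ : (h g : ℕ) {N : ℕ} (c : ℕ) (φ : Subset N → ℕ) → 𝔼 h g (λ W → c * φ W) ≡ c * 𝔼 h g φ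
  𝔼-*ˡ h g {N} c φ = trans (∑-cong (subsets N) λ W → lem (wt h g W) c (φ W)) (∑-*ˡ (subsets N) c _)
    where
    lem : ∀ a b c → a * (b * c) ≡ b * (a * c)
    lem = solve-∀

  𝔼-∑ : (h g : ℕ) {N : ℕ} {A : Set} (xs : List A) (φ : A → Subset N → ℕ) →
    𝔼 h g (λ W → ∑ xs (λ x → φ x W)) ≡ ∑ xs (λ x → 𝔼 h g (φ x))
  𝔼-∑ h g {N} xs φ = trans (∑-cong (subsets N) λ W → sym (∑-*ˡ xs (wt h g W) _)) (∑-swap (subsets N) xs _)

  𝔼-const : (h g : ℕ) {N : ℕ} (c : ℕ) → 𝔼 h g {N} (λ _ → c) ≡ (h + g) ^ N * c
  𝔼-const h g {zero} c = cong (_+ 0) (+-identityʳ c)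
  𝔼-const h g {suc N} c = trans (𝔼-suc h g {N} (λ _ → c)) (trans (cong (λ z → h * z + g * z) (𝔼-const h g {N} c)) (lem h g ((h + g) ^ N) c))
    where
    lem : ∀ h g z c → h * (z * c) + g * (z * c) ≡ (h + g) * z * c
    lem = solve-∀

  𝔼-zero : (h g : ℕ) (φ : Subset 0 → ℕ) → 𝔼 h g φ ≡ φ []
  𝔼-zero h g φ = trans (+-identityʳ _) (+-identityʳ _)

  𝔼-unfold : (h g : ℕ) {N : ℕ} (φ : Subset N → ℕ) → 𝔼 h g φ ≡ ∑ (subsets N) (λ W → wt h g W * φ W)
  𝔼-unfold h g φ = refl

-- Change of variables `Z = W ∪ T`: it is injective on the sets `W` disjoint from `T`, and there `W`
-- weighs `g ^ ∣ T ∣` times as much as `Z`. In the encoding of bad pairs this pays for forgetting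
-- which elements of `W ∪ T` came from `T`.
𝔼-absorb : (g : ℕ) {N : ℕ} (T : Subset N) (d : ∀ W → Dec (Empty (T ∩ W))) (c : Subset N → ℕ) →
  𝔼 1 g (λ W → 𝟙 (d W) * c (W ∪ T)) ≤ suc g ^ ∣ T ∣ * 𝔼 1 g c
𝔼-absorb g [] d c = ≤-trans (≤-reflexive (𝔼-zero 1 g _)) (𝟙-*-elim (d []) λ _ → ≤-reflexive (trans (sym (𝔼-zero 1 g c)) (sym (*-identityˡ _))))
𝔼-absorb g {suc N} (inside ∷ T) d c = begin
  𝔼 1 g (λ W → 𝟙 (d W) * c (W ∪ (inside ∷ T)))
    ≡⟨ 𝔼-suc 1 g {N} _ ⟩
  1 * 𝔼 1 g (λ W → 𝟙 (d (inside ∷ W)) * c (inside ∷ (W ∪ T))) + g * 𝔼 1 g (λ W → 𝟙 (d (outside ∷ W)) * c (inside ∷ (W ∪ T)))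
    ≤⟨ +-mono-≤ (*-monoʳ-≤ 1 (𝔼-mono 1 g λ W → ≤-reflexive (cong (_* c (inside ∷ (W ∪ T))) (𝟙-no (d (inside ∷ W)) λ em → em (zero , here)))))
         (*-monoʳ-≤ g (𝔼-mono 1 g λ W → *-monoˡ-≤ (c (inside ∷ (W ∪ T))) (𝟙-mono (d (outside ∷ W)) (d′ W) λ em (x , x∈) → em (suc x , there x∈)))) ⟩
  1 * 𝔼 1 g {N} (λ W → 0) + g * 𝔼 1 g (λ W → 𝟙 (d′ W) * c (inside ∷ (W ∪ T)))
    ≤⟨ +-mono-≤ (≤-reflexive (trans (cong (1 *_) (𝔼-const 1 g {N} 0)) (lem0 (suc g ^ N)))) (*-monoʳ-≤ g (𝔼-absorb g T d′ (c ∘ (inside ∷_)))) ⟩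
  0 + g * (suc g ^ ∣ T ∣ * 𝔼 1 g (c ∘ (inside ∷_)))
    ≤⟨ m≤n+m _ (suc g ^ ∣ T ∣ * 𝔼 1 g (c ∘ (inside ∷_))) ⟩
  suc g * (suc g ^ ∣ T ∣ * 𝔼 1 g (c ∘ (inside ∷_)))
    ≡⟨ *-assoc (suc g) (suc g ^ ∣ T ∣) _ ⟨
  suc g ^ suc ∣ T ∣ * 𝔼 1 g (c ∘ (inside ∷_))
    ≤⟨ *-monoʳ-≤ (suc g ^ suc ∣ T ∣) (≤-trans (≤-reflexive (sym (*-identityˡ _))) (≤-trans (m≤m+n _ _) (≤-reflexive (sym (𝔼-suc 1 g c))))) ⟩
  suc g ^ suc ∣ T ∣ * 𝔼 1 g c ∎
  where
  open ≤-Reasoning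
  d′ : ∀ W → Dec (Empty (T ∩ W))
  d′ W = ¬? (nonempty? (T ∩ W))
  lem0 : ∀ x → 1 * (x * 0) ≡ 0
  lem0 = solve-∀
𝔼-absorb g {suc N} (outside ∷ T) d c = begin
  𝔼 1 g (λ W → 𝟙 (d W) * c (W ∪ (outside ∷ T)))
    ≡⟨ 𝔼-suc 1 g {N} _ ⟩
  1 * 𝔼 1 g (λ W → 𝟙 (d (inside ∷ W)) * c (inside ∷ (W ∪ T))) + g * 𝔼 1 g (λ W → 𝟙 (d (outside ∷ W)) * c (outside ∷ (W ∪ T)))
    ≤⟨ +-mono-≤ (*-monoʳ-≤ 1 (𝔼-mono 1 g λ W → *-monoˡ-≤ (c (inside ∷ (W ∪ T))) (𝟙-mono (d (inside ∷ W)) (d′ W) λ em (x , x∈) → em (suc x , there x∈))))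
         (*-monoʳ-≤ g (𝔼-mono 1 g λ W → *-monoˡ-≤ (c (outside ∷ (W ∪ T))) (𝟙-mono (d (outside ∷ W)) (d′ W) λ em (x , x∈) → em (suc x , there x∈)))) ⟩
  1 * 𝔼 1 g (λ W → 𝟙 (d′ W) * c (inside ∷ (W ∪ T))) + g * 𝔼 1 g (λ W → 𝟙 (d′ W) * c (outside ∷ (W ∪ T)))
    ≤⟨ +-mono-≤ (*-monoʳ-≤ 1 (𝔼-absorb g T d′ (c ∘ (inside ∷_)))) (*-monoʳ-≤ g (𝔼-absorb g T d′ (c ∘ (outside ∷_)))) ⟩
  1 * (suc g ^ ∣ T ∣ * 𝔼 1 g (c ∘ (inside ∷_))) + g * (suc g ^ ∣ T ∣ * 𝔼 1 g (c ∘ (outside ∷_)))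
    ≡⟨ lem (suc g ^ ∣ T ∣) g (𝔼 1 g (c ∘ (inside ∷_))) (𝔼 1 g (c ∘ (outside ∷_))) ⟩
  suc g ^ ∣ T ∣ * (1 * 𝔼 1 g (c ∘ (inside ∷_)) + g * 𝔼 1 g (c ∘ (outside ∷_)))
    ≡⟨ cong (suc g ^ ∣ T ∣ *_) (𝔼-suc 1 g c) ⟨
  suc g ^ ∣ T ∣ * 𝔼 1 g c ∎
  where
  open ≤-Reasoning
  d′ : ∀ W → Dec (Empty (T ∩ W))
  d′ W = ¬? (nonempty? (T ∩ W))
  lem : ∀ a g x y → 1 * (a * x) + g * (a * y) ≡ a * (1 * x + g * y)
  lem = solve-∀

-- By the binomial theorem the sum is `ν ^ (ℓ ∸ ∣ A ∣) * suc ν ^ ∣ A ∣`. The set `A` will be the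
-- small set known to contain the fragment.
∑-⊆-pow : (ν : ℕ) → 1 ≤ ν → {N : ℕ} (A : Subset N) (ℓ : ℕ) → ∣ A ∣ ≤ ℓ →
  ∑ (subsets N) (λ T → 𝟙 (T ⊆? A) * ν ^ (ℓ ∸ ∣ T ∣)) ≤ suc ν ^ ℓ
∑-⊆-pow ν pos [] ℓ le = begin
  1 * ν ^ ℓ + 0 ≡⟨ trans (+-identityʳ _) (*-identityˡ (ν ^ ℓ)) ⟩
  ν ^ ℓ ≤⟨ ^-monoˡ-≤ ℓ (n≤1+n ν) ⟩
  suc ν ^ ℓ ∎
  where open ≤-Reasoning
∑-⊆-pow ν pos {suc N} (inside ∷ A) (suc ℓ) (s≤s le) = begin
  ∑ (subsets (suc N)) (λ T → 𝟙 (T ⊆? (inside ∷ A)) * ν ^ (suc ℓ ∸ ∣ T ∣))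
    ≡⟨ ∑-subsets-suc N _ ⟩
  ∑ (subsets N) (λ T → 𝟙 ((inside ∷ T) ⊆? (inside ∷ A)) * ν ^ (ℓ ∸ ∣ T ∣))
   + ∑ (subsets N) (λ T → 𝟙 ((outside ∷ T) ⊆? (inside ∷ A)) * ν ^ (suc ℓ ∸ ∣ T ∣))
    ≤⟨ +-mono-≤ (∑-mono (subsets N) λ T → *-monoˡ-≤ _ (𝟙-mono ((inside ∷ T) ⊆? (inside ∷ A)) (T ⊆? A) drop-∷-⊆))
                (∑-mono (subsets N) λ T → step T) ⟩
  ∑ (subsets N) (λ T → 𝟙 (T ⊆? A) * ν ^ (ℓ ∸ ∣ T ∣)) + ∑ (subsets N) (λ T → ν * (𝟙 (T ⊆? A) * ν ^ (ℓ ∸ ∣ T ∣)))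
    ≡⟨ cong (∑ (subsets N) (λ T → 𝟙 (T ⊆? A) * ν ^ (ℓ ∸ ∣ T ∣)) +_) (∑-*ˡ (subsets N) ν _) ⟩
  suc ν * ∑ (subsets N) (λ T → 𝟙 (T ⊆? A) * ν ^ (ℓ ∸ ∣ T ∣))
    ≤⟨ *-monoʳ-≤ (suc ν) (∑-⊆-pow ν pos A ℓ le) ⟩
  suc ν ^ suc ℓ ∎
  where
  open ≤-Reasoning
  lem : ∀ a b c → a * (b * c) ≡ b * (a * c)
  lem = solve-∀
  step : ∀ T → 𝟙 ((outside ∷ T) ⊆? (inside ∷ A)) * ν ^ (suc ℓ ∸ ∣ T ∣) ≤ ν * (𝟙 (T ⊆? A) * ν ^ (ℓ ∸ ∣ T ∣))
  step T = 𝟙-*-elim ((outside ∷ T) ⊆? (inside ∷ A)) λ sub → ≤-reflexive (begin-equality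
    ν ^ (suc ℓ ∸ ∣ T ∣) ≡⟨ cong (ν ^_) (+-∸-assoc 1 (≤-trans (p⊆q⇒∣p∣≤∣q∣ (drop-∷-⊆ sub)) le)) ⟩
    ν * ν ^ (ℓ ∸ ∣ T ∣) ≡⟨ cong (ν *_) (trans (sym (*-identityˡ _)) (cong (_* ν ^ (ℓ ∸ ∣ T ∣)) (sym (𝟙-yes (T ⊆? A) (drop-∷-⊆ sub))))) ⟩
    ν * (𝟙 (T ⊆? A) * ν ^ (ℓ ∸ ∣ T ∣)) ∎)
∑-⊆-pow ν pos {suc N} (outside ∷ A) ℓ le = begin
  ∑ (subsets (suc N)) (λ T → 𝟙 (T ⊆? (outside ∷ A)) * ν ^ (ℓ ∸ ∣ T ∣))
    ≡⟨ ∑-subsets-suc N _ ⟩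
  ∑ (subsets N) (λ T → 𝟙 ((inside ∷ T) ⊆? (outside ∷ A)) * ν ^ (ℓ ∸ suc ∣ T ∣))
   + ∑ (subsets N) (λ T → 𝟙 ((outside ∷ T) ⊆? (outside ∷ A)) * ν ^ (ℓ ∸ ∣ T ∣))
    ≤⟨ +-mono-≤ (∑-mono (subsets N) λ T → z≤n)
                (∑-mono (subsets N) λ T → *-monoˡ-≤ _ (𝟙-mono ((outside ∷ T) ⊆? (outside ∷ A)) (T ⊆? A) drop-∷-⊆)) ⟩
  ∑ (subsets N) (λ T → 0) + ∑ (subsets N) (λ T → 𝟙 (T ⊆? A) * ν ^ (ℓ ∸ ∣ T ∣))
    ≤⟨ +-mono-≤ (≤-reflexive (∑-zero (subsets N))) (∑-⊆-pow ν pos A ℓ le) ⟩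
  suc ν ^ ℓ ∎
  where
  open ≤-Reasoning

-- Fragments of spread families

^-distribʳ-* : ∀ n a b → (a * b) ^ n ≡ a ^ n * b ^ n
^-distribʳ-* zero a b = refl
^-distribʳ-* (suc n) a b rewrite ^-distribʳ-* n a b = lem a b (a ^ n) (b ^ n)
  where
  lem : ∀ a b x y → a * b * (x * y) ≡ a * x * (b * y)
  lem = solve-∀

∈-─⁻ : {N : ℕ} (p q : Subset N) {x : Fin N} → x ∈ p ─ q → x ∉ q
∈-─⁻ (s ∷ p) (outside ∷ q) {suc x} (there x∈) (there x∈q) = ∈-─⁻ p q x∈ x∈q
∈-─⁻ (s ∷ p) (inside ∷ q) {suc x} (there x∈) (there x∈q) = ∈-─⁻ p q x∈ x∈q

⊆-card-≥ : {N : ℕ} {p q : Subset N} → p ⊆ q → ∣ q ∣ ≤ ∣ p ∣ → q ⊆ p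
⊆-card-≥ {p = p} p⊆q le {x} x∈q with x ∈? p
... | yes x∈p = x∈p
... | no x∉p = ⊥-elim (<-irrefl refl (<-≤-trans (p⊂q⇒∣p∣<∣q∣ (p⊆q , x , x∈q , x∉p)) le))

argmin : {A : Set} (f : A → ℕ) (xs : List A) {x : A} → x L.∈ xs →
  ∃ λ y → y L.∈ xs × (∀ {z} → z L.∈ xs → f y ≤ f z)
argmin f (x ∷ []) _ = x , here refl , λ { (here refl) → ≤-refl }
argmin f (x ∷ x′ ∷ xs) _ with argmin f (x′ ∷ xs) (here refl)
... | y , y∈ , least with f x ≤? f y
...   | yes le = x , here refl , λ { (here refl) → ≤-refl ; (there z∈) → ≤-trans le (least z∈) }
...   | no nle = y , there y∈ , λ { (here refl) → <⇒≤ (≰⇒> nle) ; (there z∈) → least z∈ }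

-- With `x = j / D`, at most 1, this is `(1 + 1/D)^j ≤ 1 + x + x²` with denominators cleared; the
-- quadratic form survives the induction on `j`.
[1+D]^j : (D j : ℕ) → j ≤ D → D * D * suc D ^ j ≤ D ^ j * (D * D + j * D + j * j)
[1+D]^j D zero le = ≤-reflexive (lem D)
  where
  lem : ∀ D → D * D * 1 ≡ 1 * (D * D + 0 * D + 0 * 0)
  lem = solve-∀
[1+D]^j D (suc j) le = begin
  D * D * (suc D * suc D ^ j) ≡⟨ lem₁ D (suc D ^ j) ⟩
  suc D * (D * D * suc D ^ j) ≤⟨ *-monoʳ-≤ (suc D) ([1+D]^j D j (<⇒≤ le)) ⟩
  suc D * (D ^ j * (D * D + j * D + j * j)) ≡⟨ lem₂ D (D ^ j) j ⟩
  D ^ j * (D * D * D + j * D * D + j * j * D + D * D + j * D + j * j)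
    ≤⟨ *-monoʳ-≤ (D ^ j) (+-monoʳ-≤ (D * D * D + j * D * D + j * j * D + D * D + j * D) (≤-trans (*-monoʳ-≤ j (<⇒≤ le)) (m≤m+n _ D))) ⟩
  D ^ j * (D * D * D + j * D * D + j * j * D + D * D + j * D + (j * D + D)) ≡⟨ lem₃ D (D ^ j) j ⟩
  D * D ^ j * (D * D + suc j * D + suc j * suc j) ∎
  where
  open ≤-Reasoning
  lem₁ : ∀ D x → D * D * (suc D * x) ≡ suc D * (D * D * x)
  lem₁ = solve-∀
  lem₂ : ∀ D x j → suc D * (x * (D * D + j * D + j * j)) ≡ x * (D * D * D + j * D * D + j * j * D + D * D + j * D + j * j)
  lem₂ = solve-∀
  lem₃ : ∀ D x j → x * (D * D * D + j * D * D + j * j * D + D * D + j * D + (j * D + D)) ≡ D * x * (D * D + suc j * D + suc j * suc j)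
  lem₃ = solve-∀

[1+D]^D : (D : ℕ) → suc (suc D) ^ suc D ≤ 4 * suc D ^ suc D
[1+D]^D d = *-cancelˡ-≤ (suc d * suc d) (begin
  suc d * suc d * suc (suc d) ^ suc d ≤⟨ [1+D]^j (suc d) (suc d) ≤-refl ⟩
  suc d ^ suc d * (suc d * suc d + suc d * suc d + suc d * suc d) ≡⟨ lem₁ (suc d) (suc d ^ suc d) ⟩
  3 * (suc d * suc d * suc d ^ suc d) ≤⟨ *-monoˡ-≤ (suc d * suc d * suc d ^ suc d) (n≤1+n 3) ⟩
  4 * (suc d * suc d * suc d ^ suc d) ≡⟨ lem₂ (suc d) (suc d ^ suc d) ⟩
  suc d * suc d * (4 * suc d ^ suc d) ∎)
  where
  open ≤-Reasoning
  lem₁ : ∀ D x → x * (D * D + D * D + D * D) ≡ 3 * (D * D * x)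
  lem₁ = solve-∀
  lem₂ : ∀ D x → 4 * (D * D * x) ≡ D * D * (4 * x)
  lem₂ = solve-∀

-- The exponent `N` is padded by `r` to the multiple `y * D`, where `[1+D]^D` bounds each full block
-- by 4; the padding `D ^ r` is cancelled at the end.
pow-exp-bound : (g N y : ℕ) → N ≤ y * suc g → suc (suc g) ^ N ≤ 4 ^ y * suc g ^ N
pow-exp-bound g N y le = *-cancelʳ-≤ _ _ (D ^ r) ⦃ m^n≢0 D r ⦄ (begin
  suc D ^ N * D ^ r ≤⟨ *-monoʳ-≤ (suc D ^ N) (^-monoˡ-≤ r (n≤1+n D)) ⟩
  suc D ^ N * suc D ^ r ≡⟨ ^-distribˡ-+-* (suc D) N r ⟨
  suc D ^ (N + r) ≡⟨ cong (suc D ^_) N+r ⟩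
  suc D ^ (D * y) ≡⟨ ^-*-assoc (suc D) D y ⟨
  (suc D ^ D) ^ y ≤⟨ ^-monoˡ-≤ y ([1+D]^D g) ⟩
  (4 * D ^ D) ^ y ≡⟨ ^-distribʳ-* y 4 (D ^ D) ⟩
  4 ^ y * (D ^ D) ^ y ≡⟨ cong (4 ^ y *_) (^-*-assoc D D y) ⟩
  4 ^ y * D ^ (D * y) ≡⟨ cong (λ z → 4 ^ y * D ^ z) N+r ⟨
  4 ^ y * D ^ (N + r) ≡⟨ cong (4 ^ y *_) (^-distribˡ-+-* D N r) ⟩
  4 ^ y * (D ^ N * D ^ r) ≡⟨ *-assoc (4 ^ y) _ _ ⟨
  4 ^ y * D ^ N * D ^ r ∎)
  where
  open ≤-Reasoning
  D = suc g
  r = y * D ∸ N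
  N+r : N + r ≡ D * y
  N+r = trans (m+[n∸m]≡n le) (*-comm y D)

module Fragments {N : ℕ} (H : List (Subset N)) where

  -- The witness `S′` need not be `S`: it may exploit any element of `U`, and only its part outside
  -- `U` counts. Being good for ever smaller `ℓ` measures the progress of `S` while `U` grows.
  Good : (U S : Subset N) (ℓ : ℕ) → Set
  Good U S ℓ = Any (λ S′ → S′ ⊆ S ∪ U × ∣ S′ ─ U ∣ ≤ ℓ) H

  Good? : ∀ U S ℓ → Dec (Good U S ℓ)
  Good? U S ℓ = any? (λ S′ → (S′ ⊆? S ∪ U) ×-dec (∣ S′ ─ U ∣ ≤? ℓ)) H

  Hit : (U : Subset N) → Set
  Hit U = Any (λ S → S ⊆ U) H

  Hit? : ∀ U → Dec (Hit U)
  Hit? U = any? (λ S → S ⊆? U) H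

  Within : (U : Subset N) (ℓ : ℕ) (Z S : Subset N) → Set
  Within U ℓ Z S = S ⊆ U ∪ Z × ∣ S ─ U ∣ ≤ ℓ

  within? : ∀ U ℓ Z S → Dec (Within U ℓ Z S)
  within? U ℓ Z S = (S ⊆? U ∪ Z) ×-dec (∣ S ─ U ∣ ≤? ℓ)

  -- The choice sees `Z` but not `S`: the small set to which fragments are confined has to be
  -- computable from `W ∪ T` alone. The value `⊥` when no member qualifies is junk.
  pick : (U : Subset N) (ℓ : ℕ) → Subset N → Subset N
  pick U ℓ Z with any? (within? U ℓ Z) H
  ... | yes a = proj₁ (L.find a) ─ U
  ... | no _ = ⊥

  ∣pick∣≤ : ∀ U ℓ Z → ∣ pick U ℓ Z ∣ ≤ ℓ
  ∣pick∣≤ U ℓ Z with any? (within? U ℓ Z) H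
  ... | yes a = proj₂ (proj₂ (proj₂ (L.find a)))
  ... | no _ = ≤-trans (≤-reflexive (∣⊥∣≡0 N)) z≤n

  pick-spec : ∀ U ℓ Z {S} → S L.∈ H → Within U ℓ Z S →
    ∃ λ S′ → S′ L.∈ H × Within U ℓ Z S′ × pick U ℓ Z ≡ S′ ─ U
  pick-spec U ℓ Z S∈ w with any? (within? U ℓ Z) H
  ... | yes a = proj₁ (L.find a) , proj₁ (proj₂ (L.find a)) , proj₂ (proj₂ (L.find a)) , refl
  ... | no none = ⊥-elim (none (L.lose S∈ w))

  -- A minimal fragment T of a bad pair is disjoint from W and is contained in a small set that is determined by W ∪ T alone.
  minimal-fragment : ∀ U W S ℓ ℓ′ → Good U S ℓ → ¬ Good (U ∪ W) S ℓ′ →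
    ∃ λ T → T ⊆ S × Empty (T ∩ W) × suc ℓ′ ≤ ∣ T ∣ × T ⊆ pick U ℓ (W ∪ T)
  minimal-fragment U W S ℓ ℓ′ good bad = T , T⊆S , disj , big , T⊆pick
    where
    cand? : ∀ S′ → Dec (S′ ⊆ S ∪ (U ∪ W) × ∣ S′ ─ U ∣ ≤ ℓ)
    cand? S′ = (S′ ⊆? S ∪ (U ∪ W)) ×-dec (∣ S′ ─ U ∣ ≤? ℓ)
    Cs : List (Subset N)
    Cs = filter cand? H
    g₀ = L.find good
    widen : ∀ {S′} → S′ ⊆ S ∪ U → S′ ⊆ S ∪ (U ∪ W)
    widen sub x∈ with x∈p∪q⁻ S U (sub x∈)
    ... | inj₁ x∈S = p⊆p∪q (U ∪ W) x∈S
    ... | inj₂ x∈U = q⊆p∪q S (U ∪ W) (p⊆p∪q W x∈U)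
    least = argmin (λ S′ → ∣ S′ ─ (U ∪ W) ∣) Cs
      (∈-filter⁺ cand? (proj₁ (proj₂ g₀)) ((λ {x} → widen {proj₁ g₀} (proj₁ (proj₂ (proj₂ g₀))) {x}) , proj₂ (proj₂ (proj₂ g₀))))
    S′ = proj₁ least
    S′∈H : S′ L.∈ H
    S′∈H = proj₁ (∈-filter⁻ cand? (proj₁ (proj₂ least)))
    S′⊆ : S′ ⊆ S ∪ (U ∪ W)
    S′⊆ = proj₁ (proj₂ (∈-filter⁻ cand? {xs = H} (proj₁ (proj₂ least))))
    S′small : ∣ S′ ─ U ∣ ≤ ℓ
    S′small = proj₂ (proj₂ (∈-filter⁻ cand? {xs = H} (proj₁ (proj₂ least))))
    T = S′ ─ (U ∪ W)
    T⊆S : T ⊆ S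
    T⊆S x∈ with x∈p∪q⁻ S (U ∪ W) (S′⊆ (p─q⊆p S′ (U ∪ W) x∈))
    ... | inj₁ x∈S = x∈S
    ... | inj₂ x∈UW = ⊥-elim (∈-─⁻ S′ (U ∪ W) x∈ x∈UW)
    disj : Empty (T ∩ W)
    disj (x , x∈) with x∈p∩q⁻ T W x∈
    ... | x∈T , x∈W = ∈-─⁻ S′ (U ∪ W) x∈T (q⊆p∪q U W x∈W)
    big : suc ℓ′ ≤ ∣ T ∣
    big = ≰⇒> λ le → bad (L.lose S′∈H ((λ {x} → S′⊆ {x}) , le))
    within : Within U ℓ (W ∪ T) S′
    within = sub , S′small
      where
      sub : S′ ⊆ U ∪ (W ∪ T)
      sub {x} x∈ with x ∈? U ∪ W
      ... | no x∉ = q⊆p∪q U (W ∪ T) (q⊆p∪q W T (x∈p∧x∉q⇒x∈p─q x∈ x∉))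
      ... | yes x∈UW with x∈p∪q⁻ U W x∈UW
      ...   | inj₁ x∈U = p⊆p∪q (W ∪ T) x∈U
      ...   | inj₂ x∈W = q⊆p∪q U (W ∪ T) (p⊆p∪q T x∈W)
    p₀ = pick-spec U ℓ (W ∪ T) S′∈H within
    S″ = proj₁ p₀
    S″⊆ : S″ ⊆ U ∪ (W ∪ T)
    S″⊆ = proj₁ (proj₁ (proj₂ (proj₂ p₀)))
    S″cand : S″ L.∈ Cs
    S″cand = ∈-filter⁺ cand? (proj₁ (proj₂ p₀)) (sub , proj₂ (proj₁ (proj₂ (proj₂ p₀))))
      where
      sub : S″ ⊆ S ∪ (U ∪ W)
      sub x∈ with x∈p∪q⁻ U (W ∪ T) (S″⊆ x∈)
      ... | inj₁ x∈U = q⊆p∪q S (U ∪ W) (p⊆p∪q W x∈U)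
      ... | inj₂ x∈WT with x∈p∪q⁻ W T x∈WT
      ...   | inj₁ x∈W = q⊆p∪q S (U ∪ W) (q⊆p∪q U W x∈W)
      ...   | inj₂ x∈T = p⊆p∪q (U ∪ W) (T⊆S x∈T)
    rest⊆T : S″ ─ (U ∪ W) ⊆ T
    rest⊆T x∈ with x∈p∪q⁻ U (W ∪ T) (S″⊆ (p─q⊆p S″ (U ∪ W) x∈))
    ... | inj₁ x∈U = ⊥-elim (∈-─⁻ S″ (U ∪ W) x∈ (p⊆p∪q W x∈U))
    ... | inj₂ x∈WT with x∈p∪q⁻ W T x∈WT
    ...   | inj₁ x∈W = ⊥-elim (∈-─⁻ S″ (U ∪ W) x∈ (q⊆p∪q U W x∈W))
    ...   | inj₂ x∈T = x∈T
    T⊆pick : T ⊆ pick U ℓ (W ∪ T)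
    T⊆pick {x} x∈T = subst (x ∈_) (sym (proj₂ (proj₂ (proj₂ p₀))))
      (x∈p∧x∉q⇒x∈p─q (p─q⊆p S″ (U ∪ W) x∈S″) λ x∈U → ∈-─⁻ S″ (U ∪ W) x∈S″ (p⊆p∪q W x∈U))
      where
      -- `S″` is itself a candidate for the minimum that defines `T`, so its part outside `U ∪ W` is
      -- no smaller than `T`; being contained in `T`, it equals `T`.
      x∈S″ : x ∈ S″ ─ (U ∪ W)
      x∈S″ = ⊆-card-≥ rest⊆T (proj₂ (proj₂ least) S″cand) x∈T

  -- Each element of a fragment brings a spread factor `suc g * (μ * ν)`: `suc g` repays the change
  -- of variables, `μ` is the gain for a fragment larger than `ℓ′`, and `ν` damps the number of
  -- subsets of `pick`.
  module Spread (g μ ν : ℕ) (μ≥1 : 1 ≤ μ) (ν≥1 : 1 ≤ ν)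
    (spread : ∀ T → ∑ H (λ S → 𝟙 (T ⊆? S)) * (suc g * (μ * ν)) ^ ∣ T ∣ ≤ length H) where

    empty? : (T W : Subset N) → Dec (Empty (T ∩ W))
    empty? T W = ¬? (nonempty? (T ∩ W))

    -- On average over `S`, a good pair turns bad with probability at most
    -- `(1 + 1/ν)^ℓ / μ^(ℓ′ + 1)`. A bad pair `(S , W)` is encoded by its fragment `T` and by
    -- `Z = W ∪ T`. Spread bounds the number of `S` above `T`, and for fixed `Z` all possible `T`
    -- are subsets of one set of size at most `ℓ`.
    fragment-step : ∀ U ℓ ℓ′ →
      μ ^ suc ℓ′ * ν ^ ℓ * ∑ H (λ S → 𝔼 1 g (λ W → 𝟙 (Good? U S ℓ ×-dec ¬? (Good? (U ∪ W) S ℓ′))))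
        ≤ length H * (suc g ^ N * suc ν ^ ℓ)
    fragment-step U ℓ ℓ′ = begin
      K * ∑ H (λ S → 𝔼 1 g (λ W → 𝟙 (Good? U S ℓ ×-dec ¬? (Good? (U ∪ W) S ℓ′))))
        ≤⟨ *-monoʳ-≤ K (∑-mono H λ S → 𝔼-mono 1 g λ W → encode S W) ⟩
      K * ∑ H (λ S → 𝔼 1 g (λ W → ∑ (subsets N) (λ T → 𝟙 (T ⊆? S) * (𝟙 (empty? T W) * c T (W ∪ T)))))
        ≡⟨ cong (K *_) (∑-cong H λ S → trans (𝔼-∑ 1 g (subsets N) _) (∑-cong (subsets N) λ T → 𝔼-*ˡ 1 g (𝟙 (T ⊆? S)) _)) ⟩
      K * ∑ H (λ S → ∑ (subsets N) (λ T → 𝟙 (T ⊆? S) * 𝔼 1 g (λ W → 𝟙 (empty? T W) * c T (W ∪ T))))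
        ≡⟨ cong (K *_) (trans (∑-swap H (subsets N) _) (∑-cong (subsets N) λ T → ∑-*ʳ H _ _)) ⟩
      K * ∑ (subsets N) (λ T → ∑ H (λ S → 𝟙 (T ⊆? S)) * 𝔼 1 g (λ W → 𝟙 (empty? T W) * c T (W ∪ T)))
        ≤⟨ *-monoʳ-≤ K (∑-mono (subsets N) λ T → *-monoʳ-≤ (∑ H (λ S → 𝟙 (T ⊆? S))) (𝔼-absorb g T (empty? T) (c T))) ⟩
      K * ∑ (subsets N) (λ T → ∑ H (λ S → 𝟙 (T ⊆? S)) * (suc g ^ ∣ T ∣ * 𝔼 1 g (c T)))
        ≡⟨ cong (K *_) (∑-cong (subsets N) λ T → trans (sym (*-assoc (∑ H (λ S → 𝟙 (T ⊆? S))) _ _)) (sym (𝔼-*ˡ 1 g (a T) (c T)))) ⟩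
      K * ∑ (subsets N) (λ T → 𝔼 1 g (λ Z → a T * c T Z))
        ≡⟨ cong (K *_) (𝔼-∑ 1 g (subsets N) _) ⟨
      K * 𝔼 1 g (λ Z → ∑ (subsets N) (λ T → a T * c T Z))
        ≡⟨ 𝔼-*ˡ 1 g K _ ⟨
      𝔼 1 g (λ Z → K * ∑ (subsets N) (λ T → a T * c T Z))
        ≤⟨ 𝔼-mono 1 g perZ ⟩
      𝔼 1 g {N} (λ Z → length H * suc ν ^ ℓ)
        ≡⟨ 𝔼-const 1 g {N} _ ⟩
      suc g ^ N * (length H * suc ν ^ ℓ)
        ≡⟨ lem (suc g ^ N) (length H) _ ⟩
      length H * (suc g ^ N * suc ν ^ ℓ) ∎
      where
      open ≤-Reasoning
      K = μ ^ suc ℓ′ * ν ^ ℓ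
      lem : ∀ a b c → a * (b * c) ≡ b * (a * c)
      lem = solve-∀
      c? : ∀ T Z → Dec (T ⊆ pick U ℓ Z × suc ℓ′ ≤ ∣ T ∣)
      c? T Z = (T ⊆? pick U ℓ Z) ×-dec (suc ℓ′ ≤? ∣ T ∣)
      c : Subset N → Subset N → ℕ
      c T Z = 𝟙 (c? T Z)
      a : Subset N → ℕ
      a T = ∑ H (λ S → 𝟙 (T ⊆? S)) * suc g ^ ∣ T ∣
      encode : ∀ S W → 𝟙 (Good? U S ℓ ×-dec ¬? (Good? (U ∪ W) S ℓ′)) ≤
        ∑ (subsets N) (λ T → 𝟙 (T ⊆? S) * (𝟙 (empty? T W) * c T (W ∪ T)))
      encode S W = 𝟙-elim (Good? U S ℓ ×-dec ¬? (Good? (U ∪ W) S ℓ′)) λ (good , bad) →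
        let (T , T⊆S , disj , big , T⊆pick) = minimal-fragment U W S ℓ ℓ′ good bad in
        ≤-trans (≤-reflexive (sym (cong₂ _*_ (𝟙-yes (T ⊆? S) T⊆S)
                  (cong₂ _*_ (𝟙-yes (empty? T W) disj) (𝟙-yes (c? T (W ∪ T)) ((λ {x} → T⊆pick {x}) , big))))))
          (∑-term (subsets N) (λ T → 𝟙 (T ⊆? S) * (𝟙 (empty? T W) * c T (W ∪ T))) (∈-subsets T))
      perT : ∀ Z T → K * (a T * c T Z) ≤ length H * (𝟙 (T ⊆? pick U ℓ Z) * ν ^ (ℓ ∸ ∣ T ∣))
      perT Z T = 𝟙-cases (λ z → K * (a T * z)) (c? T Z) (λ (T⊆ , big) → main T⊆ big) (≤-trans (≤-reflexive (lem₀ K (a T))) z≤n)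
        where
        lem₀ : ∀ a b → a * (b * 0) ≡ 0
        lem₀ = solve-∀
        lem₁ : ∀ m n r s d → m * (n * r) * (s * d * 1) ≡ s * (d * (m * n)) * (1 * r)
        lem₁ = solve-∀
        main : T ⊆ pick U ℓ Z → suc ℓ′ ≤ ∣ T ∣ → K * (a T * 1) ≤ length H * (𝟙 (T ⊆? pick U ℓ Z) * ν ^ (ℓ ∸ ∣ T ∣))
        main T⊆ big = begin
          μ ^ suc ℓ′ * ν ^ ℓ * (a T * 1)
            ≤⟨ *-monoˡ-≤ (a T * 1) (*-monoˡ-≤ (ν ^ ℓ) (^-monoʳ-≤ μ ⦃ >-nonZero μ≥1 ⦄ big)) ⟩
          μ ^ ∣ T ∣ * ν ^ ℓ * (a T * 1)
            ≡⟨ cong (λ z → μ ^ ∣ T ∣ * ν ^ z * (a T * 1)) (m+[n∸m]≡n T≤ℓ) ⟨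
          μ ^ ∣ T ∣ * ν ^ (∣ T ∣ + (ℓ ∸ ∣ T ∣)) * (a T * 1)
            ≡⟨ cong (λ z → μ ^ ∣ T ∣ * z * (a T * 1)) (^-distribˡ-+-* ν ∣ T ∣ _) ⟩
          μ ^ ∣ T ∣ * (ν ^ ∣ T ∣ * ν ^ (ℓ ∸ ∣ T ∣)) * (a T * 1)
            ≡⟨ lem₁ (μ ^ ∣ T ∣) (ν ^ ∣ T ∣) (ν ^ (ℓ ∸ ∣ T ∣)) (∑ H (λ S → 𝟙 (T ⊆? S))) (suc g ^ ∣ T ∣) ⟩
          ∑ H (λ S → 𝟙 (T ⊆? S)) * (suc g ^ ∣ T ∣ * (μ ^ ∣ T ∣ * ν ^ ∣ T ∣)) * (1 * ν ^ (ℓ ∸ ∣ T ∣))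
            ≡⟨ cong (λ z → ∑ H (λ S → 𝟙 (T ⊆? S)) * (suc g ^ ∣ T ∣ * z) * (1 * ν ^ (ℓ ∸ ∣ T ∣))) (^-distribʳ-* ∣ T ∣ μ ν) ⟨
          ∑ H (λ S → 𝟙 (T ⊆? S)) * (suc g ^ ∣ T ∣ * (μ * ν) ^ ∣ T ∣) * (1 * ν ^ (ℓ ∸ ∣ T ∣))
            ≡⟨ cong (λ z → ∑ H (λ S → 𝟙 (T ⊆? S)) * z * (1 * ν ^ (ℓ ∸ ∣ T ∣))) (^-distribʳ-* ∣ T ∣ (suc g) (μ * ν)) ⟨
          ∑ H (λ S → 𝟙 (T ⊆? S)) * (suc g * (μ * ν)) ^ ∣ T ∣ * (1 * ν ^ (ℓ ∸ ∣ T ∣))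
            ≤⟨ *-monoˡ-≤ _ (spread T) ⟩
          length H * (1 * ν ^ (ℓ ∸ ∣ T ∣))
            ≡⟨ cong (λ z → length H * (z * ν ^ (ℓ ∸ ∣ T ∣))) (𝟙-yes (T ⊆? pick U ℓ Z) T⊆) ⟨
          length H * (𝟙 (T ⊆? pick U ℓ Z) * ν ^ (ℓ ∸ ∣ T ∣)) ∎
          where
          T≤ℓ : ∣ T ∣ ≤ ℓ
          T≤ℓ = ≤-trans (p⊆q⇒∣p∣≤∣q∣ T⊆) (∣pick∣≤ U ℓ Z)
      perZ : ∀ Z → K * ∑ (subsets N) (λ T → a T * c T Z) ≤ length H * suc ν ^ ℓ
      perZ Z = begin
        K * ∑ (subsets N) (λ T → a T * c T Z) ≡⟨ ∑-*ˡ (subsets N) K _ ⟨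
        ∑ (subsets N) (λ T → K * (a T * c T Z)) ≤⟨ ∑-mono (subsets N) (perT Z) ⟩
        ∑ (subsets N) (λ T → length H * (𝟙 (T ⊆? pick U ℓ Z) * ν ^ (ℓ ∸ ∣ T ∣))) ≡⟨ ∑-*ˡ (subsets N) (length H) _ ⟩
        length H * ∑ (subsets N) (λ T → 𝟙 (T ⊆? pick U ℓ Z) * ν ^ (ℓ ∸ ∣ T ∣))
          ≤⟨ *-monoʳ-≤ (length H) (∑-⊆-pow ν ν≥1 (pick U ℓ Z) ℓ (∣pick∣≤ U ℓ Z)) ⟩
        length H * suc ν ^ ℓ ∎

-- Unions of independent random sets, exposed in rounds

𝔼ᴿ : (g R : ℕ) {N : ℕ} → (Subset N → ℕ) → Subset N → ℕ
𝔼ᴿ g zero φ U = φ U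
𝔼ᴿ g (suc R) φ U = 𝔼 1 g (λ W → 𝔼ᴿ g R φ (U ∪ W))

𝔼ᴿ-mono : (g R : ℕ) {N : ℕ} {φ ψ : Subset N → ℕ} (U : Subset N) →
  (∀ U′ → U ⊆ U′ → φ U′ ≤ ψ U′) → 𝔼ᴿ g R φ U ≤ 𝔼ᴿ g R ψ U
𝔼ᴿ-mono g zero U le = le U (λ x∈ → x∈)
𝔼ᴿ-mono g (suc R) U le = 𝔼-mono 1 g λ W → 𝔼ᴿ-mono g R (U ∪ W) λ U′ sub → le U′ (sub ∘ p⊆p∪q W)

𝔼ᴿ-const : (g R : ℕ) {N : ℕ} (c : ℕ) (U : Subset N) → 𝔼ᴿ g R (λ _ → c) U ≡ (suc g ^ N) ^ R * c
𝔼ᴿ-const g zero c U = sym (*-identityˡ c)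
𝔼ᴿ-const g (suc R) {N} c U = trans (𝔼-cong 1 g λ W → 𝔼ᴿ-const g R c (U ∪ W))
  (trans (𝔼-const 1 g {N} _) (sym (*-assoc (suc g ^ N) _ c)))

𝔼ᴿ-*ˡ : (g R : ℕ) {N : ℕ} (c : ℕ) (φ : Subset N → ℕ) (U : Subset N) → 𝔼ᴿ g R (λ V → c * φ V) U ≡ c * 𝔼ᴿ g R φ U
𝔼ᴿ-*ˡ g zero c φ U = refl
𝔼ᴿ-*ˡ g (suc R) c φ U = trans (𝔼-cong 1 g λ W → 𝔼ᴿ-*ˡ g R c φ (U ∪ W)) (𝔼-*ˡ 1 g c _)

𝔼ᴿ-+ : (g R : ℕ) {N : ℕ} (φ ψ : Subset N → ℕ) (U : Subset N) → 𝔼ᴿ g R (λ V → φ V + ψ V) U ≡ 𝔼ᴿ g R φ U + 𝔼ᴿ g R ψ U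
𝔼ᴿ-+ g zero φ ψ U = refl
𝔼ᴿ-+ g (suc R) φ ψ U = trans (𝔼-cong 1 g λ W → 𝔼ᴿ-+ g R φ ψ (U ∪ W)) (𝔼-+ 1 g _ _)

𝔼ᴿ-∑ : (g R : ℕ) {N : ℕ} {A : Set} (xs : List A) (φ : A → Subset N → ℕ) (U : Subset N) →
  𝔼ᴿ g R (λ V → ∑ xs (λ x → φ x V)) U ≡ ∑ xs (λ x → 𝔼ᴿ g R (φ x) U)
𝔼ᴿ-∑ g zero xs φ U = refl
𝔼ᴿ-∑ g (suc R) xs φ U = trans (𝔼-cong 1 g λ W → 𝔼ᴿ-∑ g R xs φ (U ∪ W)) (𝔼-∑ 1 g xs _)

𝔼ᴿ-compose : (g R R′ : ℕ) {N : ℕ} (φ : Subset N → ℕ) (U : Subset N) → 𝔼ᴿ g (R + R′) φ U ≡ 𝔼ᴿ g R (𝔼ᴿ g R′ φ) U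
𝔼ᴿ-compose g zero R′ φ U = refl
𝔼ᴿ-compose g (suc R) R′ φ U = 𝔼-cong 1 g λ W → 𝔼ᴿ-compose g R R′ φ (U ∪ W)

∣p∣≡0⇒∉ : {N : ℕ} (p : Subset N) → ∣ p ∣ ≤ 0 → {x : Fin N} → x ∉ p
∣p∣≡0⇒∉ p le {x} x∈p = <-irrefl refl (≤-trans (≤-trans (≤-reflexive (sym (∣⁅x⁆∣≡1 x))) (p⊆q⇒∣p∣≤∣q∣ sub)) le)
  where
  sub : ⁅ x ⁆ ⊆ p
  sub y∈ rewrite x∈⁅y⁆⇒x≡y x y∈ = x∈p

iterdiv : (μ₀ R ℓ : ℕ) → ℕ
iterdiv μ₀ zero ℓ = ℓ
iterdiv μ₀ (suc R) ℓ = iterdiv μ₀ R (ℓ / suc μ₀)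

iterdiv-zero : (μ₀ R ℓ : ℕ) → ℓ < suc μ₀ ^ R → iterdiv μ₀ R ℓ ≡ 0
iterdiv-zero μ₀ zero ℓ lt = n<1⇒n≡0 lt
iterdiv-zero μ₀ (suc R) ℓ lt = iterdiv-zero μ₀ R (ℓ / suc μ₀) (m<n*o⇒m/o<n (<-≤-trans lt (≤-reflexive (*-comm (suc μ₀) _))))

-- Either `b` fails and the whole mass `o` is charged to this event, or the process goes on from
-- `b`: one step of the union bound over the rounds.
charge : {P Q : Set} (a : Dec P) (b : Dec Q) (f o : ℕ) → f ≤ o → 𝟙 a * f ≤ o * 𝟙 (a ×-dec ¬? b) + 𝟙 b * f
charge (no _) _ f o le = z≤n
charge (yes _) (yes _) f o le = m≤n+m (1 * f) (o * 0)
charge (yes _) (no _) f o le = ≤-trans (≤-reflexive (*-identityˡ f)) (≤-trans le (≤-trans (≤-reflexive (sym (*-identityʳ o))) (m≤m+n _ _)))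

vanish : {P : Set} (d : Dec P) (x c : ℕ) → x ≤ c → (P → x ≤ 0) → x ≤ c * 𝟙 (¬? d)
vanish (yes p) x c le h = ≤-trans (h p) z≤n
vanish (no _) x c le h = ≤-trans le (≤-reflexive (sym (*-identityʳ c)))

module Rounds {N : ℕ} (H : List (Subset N)) (H≢[] : 1 ≤ length H) (g μ₀ : ℕ) (4≤μ : 4 ≤ suc μ₀)
  (spread : ∀ T → ∑ H (λ S → 𝟙 (T ⊆? S)) * (suc g * (suc μ₀ * suc μ₀)) ^ ∣ T ∣ ≤ length H) where

  open Fragments H
  open Spread g (suc μ₀) (suc μ₀) (s≤s z≤n) (s≤s z≤n) spread

  private
    μ = suc μ₀
    Ω = suc g ^ N

  -- With `ν = μ` and `j = ℓ / μ`, the loss `(1 + 1/μ)^ℓ` is at most `4 ^ suc j`, hence at most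
  -- `4 * μ ^ j`, against a gain of `μ ^ suc j`. So one round fails with probability at most
  -- `4 / μ`, whatever `ℓ` is.
  geometric-step : ∀ U ℓ →
    μ * ∑ H (λ S → 𝔼 1 g (λ W → 𝟙 (Good? U S ℓ ×-dec ¬? (Good? (U ∪ W) S (ℓ / μ))))) ≤ length H * (Ω * 4)
  geometric-step U ℓ = *-cancelʳ-≤ _ _ (μ ^ j) ⦃ m^n≢0 μ j ⦄ (*-cancelʳ-≤ _ _ (μ ^ ℓ) ⦃ m^n≢0 μ ℓ ⦄ (begin
    μ * X * μ ^ j * μ ^ ℓ ≡⟨ lem₁ μ X (μ ^ j) (μ ^ ℓ) ⟩
    μ ^ suc j * μ ^ ℓ * X ≤⟨ fragment-step U ℓ j ⟩
    length H * (Ω * suc μ ^ ℓ) ≤⟨ *-monoʳ-≤ (length H) (*-monoʳ-≤ Ω (pow-exp-bound μ₀ ℓ (suc j) ℓ≤)) ⟩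
    length H * (Ω * (4 * 4 ^ j * μ ^ ℓ)) ≤⟨ *-monoʳ-≤ (length H) (*-monoʳ-≤ Ω (*-monoˡ-≤ (μ ^ ℓ) (*-monoʳ-≤ 4 (^-monoˡ-≤ j 4≤μ)))) ⟩
    length H * (Ω * (4 * μ ^ j * μ ^ ℓ)) ≡⟨ lem₂ (length H) Ω (μ ^ j) (μ ^ ℓ) ⟩
    length H * (Ω * 4) * μ ^ j * μ ^ ℓ ∎))
    where
    open ≤-Reasoning
    j = ℓ / μ
    X = ∑ H (λ S → 𝔼 1 g (λ W → 𝟙 (Good? U S ℓ ×-dec ¬? (Good? (U ∪ W) S (ℓ / μ)))))
    ℓ≤ : ℓ ≤ suc j * μ
    ℓ≤ = ≤-trans (≤-reflexive (m≡m%n+[m/n]*n ℓ μ)) (+-monoˡ-≤ (j * μ) (<⇒≤ (m%n<n ℓ μ)))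
    lem₁ : ∀ m x a b → m * x * a * b ≡ m * a * b * x
    lem₁ = solve-∀
    lem₂ : ∀ h o a b → h * (o * (4 * a * b)) ≡ h * (o * 4) * a * b
    lem₂ = solve-∀

  -- Union bound, averaged over `S`: each round divides the allowed fragment size by `μ` and loses
  -- at most `4 / μ`.
  rounds : ∀ R U ℓ →
    μ * ∑ H (λ S → 𝟙 (Good? U S ℓ) * 𝔼ᴿ g R (λ V → 𝟙 (¬? (Good? V S (iterdiv μ₀ R ℓ)))) U)
      ≤ R * (4 * length H * Ω ^ R)
  rounds zero U ℓ = ≤-reflexive (trans (cong (μ *_) (trans (∑-cong H λ S → both (Good? U S ℓ)) (∑-zero H))) (*-zeroʳ μ))
    where
    both : {P : Set} (d : Dec P) → 𝟙 d * 𝟙 (¬? d) ≡ 0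
    both (yes _) = refl
    both (no _) = refl
  rounds (suc R) U ℓ = begin
    μ * ∑ H (λ S → 𝟙 (Good? U S ℓ) * 𝔼 1 g (λ W → F (U ∪ W) S))
      ≡⟨ cong (μ *_) (∑-cong H λ S → 𝔼-*ˡ 1 g (𝟙 (Good? U S ℓ)) _) ⟨
    μ * ∑ H (λ S → 𝔼 1 g (λ W → 𝟙 (Good? U S ℓ) * F (U ∪ W) S))
      ≤⟨ *-monoʳ-≤ μ (∑-mono H λ S → 𝔼-mono 1 g λ W → split S W) ⟩
    μ * ∑ H (λ S → 𝔼 1 g (λ W → Ω ^ R * B S W + 𝟙 (Good? (U ∪ W) S ℓ′) * F (U ∪ W) S))
      ≡⟨ cong (μ *_) (trans (∑-cong H λ S → trans (𝔼-+ 1 g _ _) (cong (_+ 𝔼 1 g (λ W → 𝟙 (Good? (U ∪ W) S ℓ′) * F (U ∪ W) S)) (𝔼-*ˡ 1 g (Ω ^ R) (B S)))) (∑-+ H _ _)) ⟩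
    μ * (∑ H (λ S → Ω ^ R * 𝔼 1 g (B S)) + ∑ H (λ S → 𝔼 1 g (λ W → 𝟙 (Good? (U ∪ W) S ℓ′) * F (U ∪ W) S)))
      ≡⟨ cong₂ (λ a b → μ * (a + b)) (∑-*ˡ H (Ω ^ R) _) (sym (𝔼-∑ 1 g H _)) ⟩
    μ * (Ω ^ R * ∑ H (λ S → 𝔼 1 g (B S)) + 𝔼 1 g (λ W → ∑ H (λ S → 𝟙 (Good? (U ∪ W) S ℓ′) * F (U ∪ W) S)))
      ≡⟨ lem₁ μ (Ω ^ R) _ _ ⟩
    Ω ^ R * (μ * ∑ H (λ S → 𝔼 1 g (B S))) + μ * 𝔼 1 g (λ W → ∑ H (λ S → 𝟙 (Good? (U ∪ W) S ℓ′) * F (U ∪ W) S))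
      ≡⟨ cong (Ω ^ R * (μ * ∑ H (λ S → 𝔼 1 g (B S))) +_) (𝔼-*ˡ 1 g μ _) ⟨
    Ω ^ R * (μ * ∑ H (λ S → 𝔼 1 g (B S))) + 𝔼 1 g (λ W → μ * ∑ H (λ S → 𝟙 (Good? (U ∪ W) S ℓ′) * F (U ∪ W) S))
      ≤⟨ +-mono-≤ (*-monoʳ-≤ (Ω ^ R) (geometric-step U ℓ)) (𝔼-mono 1 g λ W → rounds R (U ∪ W) ℓ′) ⟩
    Ω ^ R * (length H * (Ω * 4)) + 𝔼 1 g {N} (λ W → R * (4 * length H * Ω ^ R))
      ≡⟨ cong (Ω ^ R * (length H * (Ω * 4)) +_) (𝔼-const 1 g {N} _) ⟩
    Ω ^ R * (length H * (Ω * 4)) + Ω * (R * (4 * length H * Ω ^ R))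
      ≡⟨ lem₂ (Ω ^ R) (length H) Ω R ⟩
    suc R * (4 * length H * Ω ^ suc R) ∎
    where
    open ≤-Reasoning
    ℓ′ = ℓ / μ
    F : Subset N → Subset N → ℕ
    F V S = 𝔼ᴿ g R (λ V′ → 𝟙 (¬? (Good? V′ S (iterdiv μ₀ R ℓ′)))) V
    B : Subset N → Subset N → ℕ
    B S W = 𝟙 (Good? U S ℓ ×-dec ¬? (Good? (U ∪ W) S ℓ′))
    F≤ : ∀ V S → F V S ≤ Ω ^ R
    F≤ V S = ≤-trans (𝔼ᴿ-mono g R V λ V′ _ → 𝟙≤1 (¬? (Good? V′ S (iterdiv μ₀ R ℓ′)))) (≤-reflexive (trans (𝔼ᴿ-const g R 1 V) (*-identityʳ _)))
    split : ∀ S W → 𝟙 (Good? U S ℓ) * F (U ∪ W) S ≤ Ω ^ R * B S W + 𝟙 (Good? (U ∪ W) S ℓ′) * F (U ∪ W) S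
    split S W = charge (Good? U S ℓ) (Good? (U ∪ W) S ℓ′) (F (U ∪ W) S) (Ω ^ R) (F≤ (U ∪ W) S)
    lem₁ : ∀ m o a b → m * (o * a + b) ≡ o * (m * a) + m * b
    lem₁ = solve-∀
    lem₂ : ∀ o h w r → o * (h * (w * 4)) + w * (r * (4 * h * o)) ≡ suc r * (4 * h * (w * o))
    lem₂ = solve-∀

  module _ (ℓ R : ℕ) (sizes : ∀ {S} → S L.∈ H → ∣ S ∣ ≤ ℓ) (ℓ< : ℓ < μ ^ R) where

    -- Every `S` starts good, since `ℓ` bounds its size, and after `R` rounds the allowed size is 0,
    -- so that some member lies inside the exposed set. That event does not mention `S`, so the
    -- average over `S` can be cancelled.
    attempt : ∀ U → μ * 𝔼ᴿ g R (λ V → 𝟙 (¬? (Hit? V))) U ≤ R * 4 * Ω ^ R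
    attempt U = *-cancelˡ-≤ (length H) ⦃ >-nonZero H≢[] ⦄ (begin
      length H * (μ * miss₀) ≡⟨ lem₁ (length H) μ miss₀ ⟩
      μ * (length H * miss₀) ≡⟨ cong (μ *_) (∑-const H miss₀) ⟨
      μ * ∑ H (λ S → miss₀) ≤⟨ *-monoʳ-≤ μ (∑-mono-∈ H bound) ⟩
      μ * ∑ H (λ S → 𝟙 (Good? U S ℓ) * 𝔼ᴿ g R (λ V → 𝟙 (¬? (Good? V S (iterdiv μ₀ R ℓ)))) U) ≤⟨ rounds R U ℓ ⟩
      R * (4 * length H * Ω ^ R) ≡⟨ lem₂ R (length H) (Ω ^ R) ⟩
      length H * (R * 4 * Ω ^ R) ∎)
      where
      open ≤-Reasoning
      miss₀ = 𝔼ᴿ g R (λ V → 𝟙 (¬? (Hit? V))) U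
      lem₁ : ∀ a b c → a * (b * c) ≡ b * (a * c)
      lem₁ = solve-∀
      lem₂ : ∀ r h o → r * (4 * h * o) ≡ h * (r * 4 * o)
      lem₂ = solve-∀
      hit : ∀ V S → Good V S (iterdiv μ₀ R ℓ) → Hit V
      hit V S good with L.find good
      ... | S′ , S′∈ , _ , small = L.lose S′∈ sub
        where
        sub : S′ ⊆ V
        sub {x} x∈ with x ∈? V
        ... | yes x∈V = x∈V
        ... | no x∉V = ⊥-elim (∣p∣≡0⇒∉ (S′ ─ V) (≤-trans small (≤-reflexive (iterdiv-zero μ₀ R ℓ ℓ<))) (x∈p∧x∉q⇒x∈p─q x∈ x∉V))
      bound : ∀ {S} → S L.∈ H → miss₀ ≤ 𝟙 (Good? U S ℓ) * 𝔼ᴿ g R (λ V → 𝟙 (¬? (Good? V S (iterdiv μ₀ R ℓ)))) U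
      bound {S} S∈ = begin
        miss₀ ≤⟨ 𝔼ᴿ-mono g R U (λ V _ → 𝟙-mono (¬? (Hit? V)) (¬? (Good? V S (iterdiv μ₀ R ℓ))) λ nohit good → nohit (hit V S good)) ⟩
        𝔼ᴿ g R (λ V → 𝟙 (¬? (Good? V S (iterdiv μ₀ R ℓ)))) U ≡⟨ *-identityˡ _ ⟨
        1 * 𝔼ᴿ g R (λ V → 𝟙 (¬? (Good? V S (iterdiv μ₀ R ℓ)))) U
          ≡⟨ cong (_* 𝔼ᴿ g R (λ V → 𝟙 (¬? (Good? V S (iterdiv μ₀ R ℓ)))) U) (𝟙-yes (Good? U S ℓ) initial) ⟨
        𝟙 (Good? U S ℓ) * 𝔼ᴿ g R (λ V → 𝟙 (¬? (Good? V S (iterdiv μ₀ R ℓ)))) U ∎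
        where
        initial : Good U S ℓ
        initial = L.lose S∈ ((λ {x} → p⊆p∪q U {x}) , ≤-trans (∣p─q∣≤∣p∣ S U) (sizes S∈))

    -- The bound of `attempt` holds from every starting set, so `A` blocks of `R` fresh rounds act
    -- as independent trials and the bounds multiply.
    attempts : ∀ A U → μ ^ A * 𝔼ᴿ g (A * R) (λ V → 𝟙 (¬? (Hit? V))) U ≤ (R * 4 * Ω ^ R) ^ A
    attempts zero U = ≤-trans (≤-reflexive (*-identityˡ _)) (𝟙≤1 (¬? (Hit? U)))
    attempts (suc A) U = begin
      μ * μ ^ A * 𝔼ᴿ g (R + A * R) miss U ≡⟨ cong (μ * μ ^ A *_) (𝔼ᴿ-compose g R (A * R) miss U) ⟩
      μ * μ ^ A * 𝔼ᴿ g R (𝔼ᴿ g (A * R) miss) U ≡⟨ *-assoc μ (μ ^ A) _ ⟩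
      μ * (μ ^ A * 𝔼ᴿ g R (𝔼ᴿ g (A * R) miss) U) ≡⟨ cong (μ *_) (𝔼ᴿ-*ˡ g R (μ ^ A) _ U) ⟨
      μ * 𝔼ᴿ g R (λ V → μ ^ A * 𝔼ᴿ g (A * R) miss V) U ≤⟨ *-monoʳ-≤ μ (𝔼ᴿ-mono g R U λ V _ → keep V) ⟩
      μ * 𝔼ᴿ g R (λ V → (R * 4 * Ω ^ R) ^ A * miss V) U ≡⟨ cong (μ *_) (𝔼ᴿ-*ˡ g R ((R * 4 * Ω ^ R) ^ A) miss U) ⟩
      μ * ((R * 4 * Ω ^ R) ^ A * 𝔼ᴿ g R miss U) ≡⟨ lem μ ((R * 4 * Ω ^ R) ^ A) (𝔼ᴿ g R miss U) ⟩
      μ * 𝔼ᴿ g R miss U * (R * 4 * Ω ^ R) ^ A ≤⟨ *-monoˡ-≤ _ (attempt U) ⟩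
      R * 4 * Ω ^ R * (R * 4 * Ω ^ R) ^ A ∎
      where
      open ≤-Reasoning
      miss : Subset N → ℕ
      miss V = 𝟙 (¬? (Hit? V))
      lem : ∀ a b c → a * (b * c) ≡ a * c * b
      lem = solve-∀
      persist : ∀ {V V′} → V ⊆ V′ → Hit V → Hit V′
      persist sub hit with L.find hit
      ... | S , S∈ , S⊆ = L.lose S∈ (λ {x} x∈ → sub {x} (S⊆ x∈))
      -- A hit is never lost, because later sets only grow; the remaining attempts matter only if
      -- the present one has missed.
      keep : ∀ V → μ ^ A * 𝔼ᴿ g (A * R) miss V ≤ (R * 4 * Ω ^ R) ^ A * miss V
      keep V = vanish (Hit? V) _ _ (attempts A V) λ hit →
        ≤-trans (*-monoʳ-≤ (μ ^ A) (𝔼ᴿ-mono g (A * R) {ψ = λ _ → 0} V λ V′ sub → ≤-reflexive (𝟙-no (¬? (Hit? V′)) λ nohit → nohit (persist (λ {x} → sub {x}) hit))))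
          (≤-reflexive (trans (cong (μ ^ A *_) (trans (𝔼ᴿ-const g (A * R) 0 V) (*-zeroʳ ((suc g ^ N) ^ (A * R))))) (*-zeroʳ (μ ^ A))))

𝔼-0-1 : {N : ℕ} (φ : Subset N → ℕ) → 𝔼 0 1 φ ≡ φ ⊥
𝔼-0-1 {zero} φ = 𝔼-zero 0 1 φ
𝔼-0-1 {suc N} φ = trans (𝔼-suc 0 1 φ) (trans (*-identityˡ _) (𝔼-0-1 (φ ∘ (outside ∷_))))

-- A coordinate is missed exactly when both sets miss it, which has weight `b * g` out of
-- `(a + b) * (h + g)`.
𝔼-union : (a b h g : ℕ) {N : ℕ} (ψ : Subset N → ℕ) →
  𝔼 a b (λ V → 𝔼 h g (λ W → ψ (V ∪ W))) ≡ 𝔼 (a * (h + g) + b * h) (b * g) ψ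
𝔼-union a b h g {zero} ψ = trans (𝔼-zero a b _) (trans (𝔼-zero h g _) (sym (𝔼-zero _ _ ψ)))
𝔼-union a b h g {suc N} ψ = begin
  𝔼 a b (λ V → 𝔼 h g (λ W → ψ (V ∪ W)))
    ≡⟨ 𝔼-suc a b {N} _ ⟩
  a * 𝔼 a b (λ V → 𝔼 h g (λ W → ψ ((inside ∷ V) ∪ W))) + b * 𝔼 a b (λ V → 𝔼 h g (λ W → ψ ((outside ∷ V) ∪ W)))
    ≡⟨ cong₂ (λ x y → a * x + b * y) (expand inside) (expand outside) ⟩
  a * (h * I + g * I) + b * (h * I + g * O)
    ≡⟨ lem a b h g I O ⟩
  (a * (h + g) + b * h) * I + b * g * O
    ≡⟨ cong₂ (λ x y → (a * (h + g) + b * h) * x + b * g * y) (𝔼-union a b h g (ψ ∘ (inside ∷_))) (𝔼-union a b h g (ψ ∘ (outside ∷_))) ⟩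
  (a * (h + g) + b * h) * 𝔼 (a * (h + g) + b * h) (b * g) (ψ ∘ (inside ∷_)) + b * g * 𝔼 (a * (h + g) + b * h) (b * g) (ψ ∘ (outside ∷_))
    ≡⟨ 𝔼-suc _ _ ψ ⟨
  𝔼 (a * (h + g) + b * h) (b * g) ψ ∎
  where
  open ≡-Reasoning
  I = 𝔼 a b (λ V → 𝔼 h g (λ W → ψ (inside ∷ (V ∪ W))))
  O = 𝔼 a b (λ V → 𝔼 h g (λ W → ψ (outside ∷ (V ∪ W))))
  expand : ∀ s → 𝔼 a b (λ V → 𝔼 h g (λ W → ψ ((s ∷ V) ∪ W))) ≡
    h * 𝔼 a b (λ V → 𝔼 h g (λ W → ψ ((s ∷ V) ∪ (inside ∷ W)))) + g * 𝔼 a b (λ V → 𝔼 h g (λ W → ψ ((s ∷ V) ∪ (outside ∷ W))))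
  expand s = trans (𝔼-cong a b λ V → 𝔼-suc h g {N} (λ W → ψ ((s ∷ V) ∪ W)))
    (trans (𝔼-+ a b _ _) (cong₂ _+_ (𝔼-*ˡ a b h _) (𝔼-*ˡ a b g _)))
  lem : ∀ a b h g I O → a * (h * I + g * I) + b * (h * I + g * O) ≡ (a * (h + g) + b * h) * I + b * g * O
  lem = solve-∀

-- The comparison with random orderings is made for one product measure, so all rounds are collapsed
-- into a single one of the same total mass.
𝔼ᴿ-product : (g R : ℕ) → Σ ℕ λ h → Σ ℕ λ g′ → (h + g′ ≡ suc g ^ R) ×
  ({N : ℕ} (φ : Subset N → ℕ) (U : Subset N) → 𝔼ᴿ g R φ U ≡ 𝔼 h g′ (λ W → φ (U ∪ W)))
𝔼ᴿ-product g zero = 0 , 1 , refl , λ φ U → trans (cong φ (sym (∪-identityʳ U))) (sym (𝔼-0-1 (λ W → φ (U ∪ W))))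
𝔼ᴿ-product g (suc R) with 𝔼ᴿ-product g R
... | h , g′ , eq , prod = 1 * (h + g′) + g * h , g * g′ , trans (lem h g g′) (cong (suc g *_) eq) ,
      λ φ U → trans (𝔼-cong 1 g λ W → trans (prod φ (U ∪ W)) (𝔼-cong h g′ λ V → cong φ (∪-assoc U W V))) (𝔼-union 1 g h g′ (λ W → φ (U ∪ W)))
  where
  lem : ∀ h g g′ → 1 * (h + g′) + g * h + g * g′ ≡ suc g * (h + g′)
  lem = solve-∀

-- Exponential moments and tails

∣∪∩∣≤ : {N : ℕ} (U W I : Subset N) → ∣ (U ∪ W) ∩ I ∣ ≤ ∣ U ∩ I ∣ + ∣ W ∩ I ∣
∣∪∩∣≤ [] [] [] = z≤n
∣∪∩∣≤ (u ∷ U) (w ∷ W) (outside ∷ I) rewrite ∧-zeroʳ u | ∧-zeroʳ w | ∧-zeroʳ (u ∨ w) = ∣∪∩∣≤ U W I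
∣∪∩∣≤ (inside ∷ U) (inside ∷ W) (inside ∷ I) = s≤s (≤-trans (∣∪∩∣≤ U W I) (+-monoʳ-≤ ∣ U ∩ I ∣ (n≤1+n _)))
∣∪∩∣≤ (inside ∷ U) (outside ∷ W) (inside ∷ I) = s≤s (∣∪∩∣≤ U W I)
∣∪∩∣≤ (outside ∷ U) (inside ∷ W) (inside ∷ I) = ≤-trans (s≤s (∣∪∩∣≤ U W I)) (≤-reflexive (sym (+-suc ∣ U ∩ I ∣ _)))
∣∪∩∣≤ (outside ∷ U) (outside ∷ W) (inside ∷ I) = ∣∪∩∣≤ U W I

-- Coordinates are independent, and each one in `I` contributes the mean `1 + 1 / suc g` of the
-- factor 2 that its presence brings.
𝔼-exp : (g : ℕ) {N : ℕ} (I : Subset N) → 𝔼 1 g (λ W → 2 ^ ∣ W ∩ I ∣) * suc g ^ ∣ I ∣ ≡ suc (suc g) ^ ∣ I ∣ * suc g ^ N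
𝔼-exp g [] = cong (_* 1) (𝔼-zero 1 g _)
𝔼-exp g {suc N} (inside ∷ I) = begin
  𝔼 1 g (λ W → 2 ^ ∣ W ∩ (inside ∷ I) ∣) * (suc g * suc g ^ ∣ I ∣)
    ≡⟨ cong (_* (suc g * suc g ^ ∣ I ∣)) (trans (𝔼-suc 1 g {N} _) (cong (λ z → 1 * z + g * X) (𝔼-*ˡ 1 g {N} 2 _))) ⟩
  (1 * (2 * X) + g * X) * (suc g * suc g ^ ∣ I ∣) ≡⟨ lem₁ g X (suc g ^ ∣ I ∣) ⟩
  suc (suc g) * suc g * (X * suc g ^ ∣ I ∣) ≡⟨ cong (suc (suc g) * suc g *_) (𝔼-exp g I) ⟩
  suc (suc g) * suc g * (suc (suc g) ^ ∣ I ∣ * suc g ^ N) ≡⟨ lem₂ (suc (suc g)) (suc g) (suc (suc g) ^ ∣ I ∣) (suc g ^ N) ⟩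
  suc (suc g) * suc (suc g) ^ ∣ I ∣ * (suc g * suc g ^ N) ∎
  where
  open ≡-Reasoning
  X = 𝔼 1 g (λ W → 2 ^ ∣ W ∩ I ∣)
  lem₁ : ∀ g x y → (1 * (2 * x) + g * x) * (suc g * y) ≡ suc (suc g) * suc g * (x * y)
  lem₁ = solve-∀
  lem₂ : ∀ a b x y → a * b * (x * y) ≡ a * x * (b * y)
  lem₂ = solve-∀
𝔼-exp g {suc N} (outside ∷ I) = begin
  𝔼 1 g (λ W → 2 ^ ∣ W ∩ (outside ∷ I) ∣) * suc g ^ ∣ I ∣ ≡⟨ cong (_* suc g ^ ∣ I ∣) (𝔼-suc 1 g {N} _) ⟩
  (1 * X + g * X) * suc g ^ ∣ I ∣ ≡⟨ lem₁ g X (suc g ^ ∣ I ∣) ⟩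
  suc g * (X * suc g ^ ∣ I ∣) ≡⟨ cong (suc g *_) (𝔼-exp g I) ⟩
  suc g * (suc (suc g) ^ ∣ I ∣ * suc g ^ N) ≡⟨ lem₂ (suc g) (suc (suc g) ^ ∣ I ∣) (suc g ^ N) ⟩
  suc (suc g) ^ ∣ I ∣ * (suc g * suc g ^ N) ∎
  where
  open ≡-Reasoning
  X = 𝔼 1 g (λ W → 2 ^ ∣ W ∩ I ∣)
  lem₁ : ∀ g x y → (1 * x + g * x) * y ≡ suc g * (x * y)
  lem₁ = solve-∀
  lem₂ : ∀ b x y → b * (x * y) ≡ x * (b * y)
  lem₂ = solve-∀

module Tail (g y : ℕ) {N : ℕ} (I : Subset N) (∣I∣≤ : ∣ I ∣ ≤ y * suc g) where

  𝔼ᴿ-exp : (R : ℕ) (U : Subset N) → 𝔼ᴿ g R (λ V → 2 ^ ∣ V ∩ I ∣) U ≤ 2 ^ ∣ U ∩ I ∣ * (4 ^ y * suc g ^ N) ^ R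
  𝔼ᴿ-exp zero U = ≤-reflexive (sym (*-identityʳ _))
  𝔼ᴿ-exp (suc R) U = begin
    𝔼 1 g (λ W → 𝔼ᴿ g R (λ V → 2 ^ ∣ V ∩ I ∣) (U ∪ W)) ≤⟨ 𝔼-mono 1 g (λ W → 𝔼ᴿ-exp R (U ∪ W)) ⟩
    𝔼 1 g (λ W → 2 ^ ∣ (U ∪ W) ∩ I ∣ * B ^ R)
      ≤⟨ 𝔼-mono 1 g (λ W → *-monoˡ-≤ (B ^ R) (≤-trans (^-monoʳ-≤ 2 (∣∪∩∣≤ U W I)) (≤-reflexive (^-distribˡ-+-* 2 ∣ U ∩ I ∣ _)))) ⟩
    𝔼 1 g (λ W → 2 ^ ∣ U ∩ I ∣ * 2 ^ ∣ W ∩ I ∣ * B ^ R)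
      ≡⟨ 𝔼-cong 1 g (λ W → lem (2 ^ ∣ U ∩ I ∣) (2 ^ ∣ W ∩ I ∣) (B ^ R)) ⟩
    𝔼 1 g (λ W → 2 ^ ∣ U ∩ I ∣ * B ^ R * 2 ^ ∣ W ∩ I ∣) ≡⟨ 𝔼-*ˡ 1 g (2 ^ ∣ U ∩ I ∣ * B ^ R) _ ⟩
    2 ^ ∣ U ∩ I ∣ * B ^ R * 𝔼 1 g (λ W → 2 ^ ∣ W ∩ I ∣) ≤⟨ *-monoʳ-≤ (2 ^ ∣ U ∩ I ∣ * B ^ R) single ⟩
    2 ^ ∣ U ∩ I ∣ * B ^ R * B ≡⟨ lem₂ (2 ^ ∣ U ∩ I ∣) (B ^ R) B ⟩
    2 ^ ∣ U ∩ I ∣ * (B * B ^ R) ∎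
    where
    open ≤-Reasoning
    B = 4 ^ y * suc g ^ N
    lem : ∀ a b c → a * b * c ≡ a * c * b
    lem = solve-∀
    lem₂ : ∀ a b c → a * b * c ≡ a * (c * b)
    lem₂ = solve-∀
    single : 𝔼 1 g (λ W → 2 ^ ∣ W ∩ I ∣) ≤ B
    single = *-cancelʳ-≤ _ _ (suc g ^ ∣ I ∣) ⦃ m^n≢0 (suc g) ∣ I ∣ ⦄ (begin
      𝔼 1 g (λ W → 2 ^ ∣ W ∩ I ∣) * suc g ^ ∣ I ∣ ≡⟨ 𝔼-exp g I ⟩
      suc (suc g) ^ ∣ I ∣ * suc g ^ N ≤⟨ *-monoˡ-≤ (suc g ^ N) (pow-exp-bound g ∣ I ∣ y ∣I∣≤) ⟩
      4 ^ y * suc g ^ ∣ I ∣ * suc g ^ N ≡⟨ lem (4 ^ y) (suc g ^ ∣ I ∣) (suc g ^ N) ⟩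
      B * suc g ^ ∣ I ∣ ∎)

  -- Markov's inequality for `2 ^ ∣ V ∩ I ∣`: over `R` rounds its mean is at most `4 ^ (y * R)`,
  -- while beyond the threshold it is at least `16 ^ (y * R)`. Here `y` bounds the expected number
  -- of elements of `I` in one round.
  tail : (R : ℕ) → 4 ^ (y * R) * 𝔼ᴿ g R (λ V → 𝟙 (¬? (∣ V ∩ I ∣ ≤? 4 * (y * R)))) ⊥ ≤ (suc g ^ N) ^ R
  tail R = *-cancelˡ-≤ (4 ^ (y * R)) ⦃ m^n≢0 4 (y * R) ⦄ (begin
    4 ^ (y * R) * (4 ^ (y * R) * 𝔼ᴿ g R over ⊥) ≡⟨ *-assoc (4 ^ (y * R)) (4 ^ (y * R)) _ ⟨
    4 ^ (y * R) * 4 ^ (y * R) * 𝔼ᴿ g R over ⊥ ≡⟨ 𝔼ᴿ-*ˡ g R (4 ^ (y * R) * 4 ^ (y * R)) over ⊥ ⟨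
    𝔼ᴿ g R (λ V → 4 ^ (y * R) * 4 ^ (y * R) * over V) ⊥ ≤⟨ 𝔼ᴿ-mono g R ⊥ (λ V _ → markov V) ⟩
    𝔼ᴿ g R (λ V → 2 ^ ∣ V ∩ I ∣) ⊥ ≤⟨ 𝔼ᴿ-exp R ⊥ ⟩
    2 ^ ∣ ⊥ ∩ I ∣ * (4 ^ y * suc g ^ N) ^ R ≡⟨ cong₂ (λ a b → 2 ^ a * b) (trans (cong ∣_∣ (∩-zeroˡ I)) (∣⊥∣≡0 N)) (^-distribʳ-* R (4 ^ y) (suc g ^ N)) ⟩
    1 * ((4 ^ y) ^ R * (suc g ^ N) ^ R) ≡⟨ trans (*-identityˡ _) (cong (_* (suc g ^ N) ^ R) (^-*-assoc 4 y R)) ⟩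
    4 ^ (y * R) * (suc g ^ N) ^ R ∎)
    where
    open ≤-Reasoning
    over : Subset N → ℕ
    over V = 𝟙 (¬? (∣ V ∩ I ∣ ≤? 4 * (y * R)))
    lem : ∀ z → 4 * z ≡ 2 * z + 2 * z
    lem = solve-∀
    pow : 4 ^ (y * R) * 4 ^ (y * R) ≡ 2 ^ (4 * (y * R))
    pow = sym (trans (cong (2 ^_) (lem (y * R))) (trans (^-distribˡ-+-* 2 (2 * (y * R)) _) (cong₂ _*_ (sym (^-*-assoc 2 2 (y * R))) (sym (^-*-assoc 2 2 (y * R))))))
    markov : ∀ V → 4 ^ (y * R) * 4 ^ (y * R) * over V ≤ 2 ^ ∣ V ∩ I ∣
    markov V = 𝟙-cases (4 ^ (y * R) * 4 ^ (y * R) *_) (¬? (∣ V ∩ I ∣ ≤? 4 * (y * R)))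
      (λ gt → ≤-trans (≤-reflexive (trans (*-identityʳ _) pow)) (^-monoʳ-≤ 2 (<⇒≤ (≰⇒> gt))))
      (≤-trans (≤-reflexive (*-zeroʳ (4 ^ (y * R) * 4 ^ (y * R)))) z≤n)

-- Random orderings

-- Adjacent transpositions generate all reorderings, so such a `ψ` depends on the content of the
-- list and not on its order.
SwapInvariant : {A : Set} → (List A → ℕ) → Set
SwapInvariant {A} ψ = ∀ ys (x y : A) l → ψ (ys ++ x ∷ y ∷ l) ≡ ψ (ys ++ y ∷ x ∷ l)

module _ {A : Set} where

  -- Of the `t + r` positions for `x`, the first `t` put it into the prefix of length `t`, where by
  -- invariance it may be moved to the front; the other `r` leave the prefix of `π` as it was.
  ∑-insertions : (ψ : List A → ℕ) → SwapInvariant ψ → ∀ x π t r → t + r ≡ suc (length π) →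
    ∑ (insertions x π) (ψ ∘ take t) ≡ t * ψ (x ∷ take (pred t) π) + r * ψ (take t π)
  ∑-insertions ψ inv x [] zero r refl = refl
  ∑-insertions ψ inv x [] (suc zero) r refl = sym (+-identityʳ _)
  ∑-insertions ψ inv x [] (suc (suc t)) r ()
  ∑-insertions ψ inv x (y ∷ π) zero (suc r) eq = cong (ψ [] +_)
    (trans (∑-map (y ∷_) (insertions x π) _) (∑-insertions ψ inv x π zero r (suc-injective eq)))
  ∑-insertions ψ inv x (y ∷ π) (suc t) r eq = trans (cong (ψ (x ∷ take t (y ∷ π)) +_)
      (trans (∑-map (y ∷_) (insertions x π) _) (∑-insertions (ψ ∘ (y ∷_)) (inv ∘ (y ∷_)) x π t r (suc-injective eq))))
    (trans (sym (+-assoc (ψ (x ∷ take t (y ∷ π))) _ _)) (cong (λ z → ψ (x ∷ take t (y ∷ π)) + z + r * ψ (y ∷ take t π)) (swap t)))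
    where
    swap : ∀ t → t * ψ (y ∷ x ∷ take (pred t) π) ≡ t * ψ (x ∷ take t (y ∷ π))
    swap zero = refl
    swap (suc t) = cong (suc t *_) (inv [] y x (take t π))

  length-insertions-∈ : ∀ (x : A) π {l} → l L.∈ insertions x π → length l ≡ suc (length π)
  length-insertions-∈ x [] (here refl) = refl
  length-insertions-∈ x (y ∷ π) (here refl) = refl
  length-insertions-∈ x (y ∷ π) (there l∈) with ∈-map⁻ (y ∷_) l∈
  ... | l′ , l′∈ , refl = cong suc (length-insertions-∈ x π l′∈)

  length-perms-∈ : (xs : List A) {π : List A} → π L.∈ perms xs → length π ≡ length xs
  length-perms-∈ [] (here refl) = refl
  length-perms-∈ (x ∷ xs) π∈ with L.find (∈-concatMap⁻ (insertions x) {xs = perms xs} π∈)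
  ... | π′ , π′∈ , mem = trans (length-insertions-∈ x π′ mem) (cong suc (length-perms-∈ xs π′∈))

  select : (xs : List A) → Subset (length xs) → List A
  select [] [] = []
  select (x ∷ xs) (inside ∷ W) = x ∷ select xs W
  select (x ∷ xs) (outside ∷ W) = select xs W

  layer : (xs : List A) (j : ℕ) (ψ : List A → ℕ) → ℕ
  layer xs j ψ = ∑ (subsets (length xs)) (λ W → 𝟙 (∣ W ∣ ≟ j) * ψ (select xs W))

  layer-suc : ∀ x xs j ψ → layer (x ∷ xs) (suc j) ψ ≡ layer xs j (ψ ∘ (x ∷_)) + layer xs (suc j) ψ
  layer-suc x xs j ψ = trans (∑-subsets-suc (length xs) _) (cong (_+ layer xs (suc j) ψ)
    (∑-cong (subsets (length xs)) λ W → cong (_* ψ (x ∷ select xs W)) (𝟙-cong (suc ∣ W ∣ ≟ suc j) (∣ W ∣ ≟ j) suc-injective (cong suc))))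

  layer-zero : ∀ x xs ψ → layer (x ∷ xs) 0 ψ ≡ layer xs 0 ψ
  layer-zero x xs ψ = trans (∑-subsets-suc (length xs) _) (cong (_+ layer xs 0 ψ) (∑-zero (subsets (length xs))))

  layer-big : ∀ xs j ψ → length xs < j → layer xs j ψ ≡ 0
  layer-big xs j ψ lt = trans (∑-cong (subsets (length xs)) λ W → cong (_* ψ (select xs W))
    (𝟙-no (∣ W ∣ ≟ j) λ eq → <-irrefl eq (≤-<-trans (∣p∣≤n W) lt))) (∑-zero (subsets (length xs)))

  -- Each subset of size `j` is the content of the prefix in exactly `j ! * r !` orderings.
  ∑-perms : ∀ xs (ψ : List A → ℕ) → SwapInvariant ψ → ∀ j r → j + r ≡ length xs →
    ∑ (perms xs) (ψ ∘ take j) ≡ j ! * (r ! * layer xs j ψ)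
  ∑-perms [] ψ inv zero zero refl = lem (ψ [])
    where
    lem : ∀ z → z + 0 ≡ 1 * (1 * (1 * z + 0))
    lem = solve-∀
  ∑-perms (x ∷ xs) ψ inv j r eq = trans (∑-concatMap (insertions x) (perms xs) _)
    (trans (∑-cong-∈ (perms xs) λ {π} π∈ → ∑-insertions ψ inv x π j r (trans eq (cong suc (sym (length-perms-∈ xs π∈)))))
    (trans (∑-+ (perms xs) _ _) (trans (cong₂ _+_ (∑-*ˡ (perms xs) j _) (∑-*ˡ (perms xs) r _)) (combine j r eq))))
    where
    combine : ∀ j r → j + r ≡ suc (length xs) →
      j * ∑ (perms xs) (λ π → ψ (x ∷ take (pred j) π)) + r * ∑ (perms xs) (ψ ∘ take j) ≡ j ! * (r ! * layer (x ∷ xs) j ψ)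
    combine zero (suc r) e = trans (cong (suc r *_) (∑-perms xs ψ inv 0 r (suc-injective e)))
      (trans (lem (suc r) (r !) _) (cong (λ z → 1 * (suc r ! * z)) (sym (layer-zero x xs ψ))))
      where
      lem : ∀ s f l → s * (1 * (f * l)) ≡ 1 * (s * f * l)
      lem = solve-∀
    combine (suc j) zero e = trans (cong (λ z → suc j * z + 0) (∑-perms xs (ψ ∘ (x ∷_)) (inv ∘ (x ∷_)) j 0 (suc-injective e)))
      (trans (lem (suc j) (j !) (layer xs j (ψ ∘ (x ∷_)))) (cong (λ z → suc j ! * (1 * z))
        (trans (sym (trans (cong (layer xs j (ψ ∘ (x ∷_)) +_) (layer-big xs (suc j) ψ (≤-reflexive (trans (sym e) (+-identityʳ (suc j)))))) (+-identityʳ _)))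
          (sym (layer-suc x xs j ψ)))))
      where
      lem : ∀ s f l → s * (f * (1 * l)) + 0 ≡ s * f * (1 * l)
      lem = solve-∀
    combine (suc j) (suc r) e = trans (cong₂ (λ a b → suc j * a + suc r * b)
        (∑-perms xs (ψ ∘ (x ∷_)) (inv ∘ (x ∷_)) j (suc r) (suc-injective e))
        (∑-perms xs ψ inv (suc j) r (suc-injective (trans (sym (+-suc (suc j) r)) e))))
      (trans (lem (suc j) (j !) (suc r) (r !) _ _) (cong (λ z → suc j ! * (suc r ! * z)) (sym (layer-suc x xs j ψ))))
      where
      lem : ∀ s f u v a b → s * (f * (u * v * a)) + u * (s * f * (v * b)) ≡ s * f * (u * v * (a + b))
      lem = solve-∀

  wt-size : (h g : ℕ) {N : ℕ} (W : Subset N) → wt h g W ≡ h ^ ∣ W ∣ * g ^ (N ∸ ∣ W ∣)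
  wt-size h g [] = refl
  wt-size h g (inside ∷ W) = trans (cong (h *_) (wt-size h g W)) (sym (*-assoc h _ _))
  wt-size h g {suc N} (outside ∷ W) = trans (cong (g *_) (wt-size h g W))
    (trans (lem g (h ^ ∣ W ∣) _) (cong (λ z → h ^ ∣ W ∣ * g ^ z) (sym (+-∸-assoc 1 (∣p∣≤n W)))))
    where
    lem : ∀ g a b → g * (a * b) ≡ a * (g * b)
    lem = solve-∀

  ∑-downFrom-≥ : (n i : ℕ) (f : ℕ → ℕ) → n ≤ i → ∑ (downFrom n) (λ j → 𝟙 (i ≟ j) * f j) ≡ 0
  ∑-downFrom-≥ zero i f le = refl
  ∑-downFrom-≥ (suc n) i f le = cong₂ (λ a b → a * f n + b) (𝟙-no (i ≟ n) λ eq → <-irrefl (sym eq) le) (∑-downFrom-≥ n i f (<⇒≤ le))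

  ∑-downFrom : (n i : ℕ) (f : ℕ → ℕ) → i < n → ∑ (downFrom n) (λ j → 𝟙 (i ≟ j) * f j) ≡ f i
  ∑-downFrom (suc n) i f lt with m≤n⇒m<n∨m≡n (≤-pred lt)
  ... | inj₁ i<n = trans (cong (λ a → a * f n + ∑ (downFrom n) (λ j → 𝟙 (i ≟ j) * f j)) (𝟙-no (i ≟ n) (<⇒≢ i<n))) (∑-downFrom n i f i<n)
  ... | inj₂ refl = trans (cong₂ (λ a b → a * f n + b) (𝟙-yes (i ≟ i) refl) (∑-downFrom-≥ i i f ≤-refl)) (trans (+-identityʳ _) (*-identityˡ _))

  𝔼-layers : (h g : ℕ) (xs : List A) (ψ : List A → ℕ) →
    𝔼 h g (λ W → ψ (select xs W)) ≡ ∑ (downFrom (suc (length xs))) (λ j → h ^ j * g ^ (length xs ∸ j) * layer xs j ψ)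
  𝔼-layers h g xs ψ = trans (𝔼-unfold h g _) (trans (∑-cong (subsets N) perW) (trans (∑-swap (subsets N) (downFrom (suc N)) _)
    (∑-cong (downFrom (suc N)) λ j → ∑-*ˡ (subsets N) (w j) _)))
    where
    N = length xs
    w : ℕ → ℕ
    w j = h ^ j * g ^ (N ∸ j)
    lem : ∀ a b c → a * (b * c) ≡ b * (a * c)
    lem = solve-∀
    perW : ∀ W → wt h g W * ψ (select xs W) ≡ ∑ (downFrom (suc N)) (λ j → w j * (𝟙 (∣ W ∣ ≟ j) * ψ (select xs W)))
    perW W = trans (cong (_* ψ (select xs W)) (wt-size h g W)) (sym (trans (∑-cong (downFrom (suc N)) λ j → lem (w j) (𝟙 (∣ W ∣ ≟ j)) _)
      (∑-downFrom (suc N) ∣ W ∣ (λ j → w j * ψ (select xs W)) (s≤s (∣p∣≤n W)))))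

  -- The size of the random set is independent of the ordering, so it suffices to compare sizes one at a time.
  ordering≤product : (h g : ℕ) (xs : List A) (ψ : List A → ℕ) → SwapInvariant ψ → (fail : List A → ℕ) →
    (∀ j → j ≤ length xs → ∀ {π} → π L.∈ perms xs → fail π ≤ ψ (take j π)) →
    ∑ (perms xs) fail * (h + g) ^ length xs ≤ length (perms xs) * 𝔼 h g (λ W → ψ (select xs W))
  ordering≤product h g xs ψ inv fail le = begin
    F * (h + g) ^ N ≡⟨ cong (F *_) (trans (sym (*-identityʳ _)) (sym (𝔼-const h g {N} 1))) ⟩
    F * 𝔼 h g {N} (λ _ → 1) ≡⟨ cong (F *_) (𝔼-layers h g xs (λ _ → 1)) ⟩
    F * ∑ (downFrom (suc N)) (λ j → w j * layer xs j (λ _ → 1)) ≡⟨ ∑-*ˡ (downFrom (suc N)) F _ ⟨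
    ∑ (downFrom (suc N)) (λ j → F * (w j * layer xs j (λ _ → 1))) ≤⟨ ∑-mono-∈ (downFrom (suc N)) (λ {j} j∈ → perLayer j (≤-pred (∈-downFrom⁻ j∈))) ⟩
    ∑ (downFrom (suc N)) (λ j → length (perms xs) * (w j * layer xs j ψ)) ≡⟨ ∑-*ˡ (downFrom (suc N)) (length (perms xs)) _ ⟩
    length (perms xs) * ∑ (downFrom (suc N)) (λ j → w j * layer xs j ψ) ≡⟨ cong (length (perms xs) *_) (𝔼-layers h g xs ψ) ⟨
    length (perms xs) * 𝔼 h g (λ W → ψ (select xs W)) ∎
    where
    open ≤-Reasoning
    N = length xs
    F = ∑ (perms xs) fail
    w : ℕ → ℕ
    w j = h ^ j * g ^ (N ∸ j)
    ∈-downFrom⁻ : ∀ {n j} → j L.∈ downFrom n → j < n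
    ∈-downFrom⁻ {suc n} (here refl) = ≤-refl
    ∈-downFrom⁻ {suc n} (there j∈) = m≤n⇒m≤1+n (∈-downFrom⁻ j∈)
    perLayer : ∀ j → j ≤ N → F * (w j * layer xs j (λ _ → 1)) ≤ length (perms xs) * (w j * layer xs j ψ)
    perLayer j j≤N = ≤-trans (≤-reflexive (lem₁ F (w j) _)) (≤-trans (*-monoʳ-≤ (w j) (*-cancelˡ-≤ (j ! * r !) ⦃ m*n≢0 (j !) (r !) ⦃ j !≢0 ⦄ ⦃ r !≢0 ⦄ ⦄ (begin
      j ! * r ! * (F * layer xs j (λ _ → 1)) ≡⟨ lem₂ (j !) (r !) F (layer xs j (λ _ → 1)) ⟩
      F * (j ! * (r ! * layer xs j (λ _ → 1))) ≡⟨ cong (F *_) (∑-perms xs (λ _ → 1) (λ _ _ _ _ → refl) j r j+r) ⟨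
      F * ∑ (perms xs) (λ _ → 1) ≡⟨ cong (F *_) (trans (∑-const (perms xs) 1) (*-identityʳ _)) ⟩
      F * length (perms xs) ≤⟨ *-monoˡ-≤ (length (perms xs)) (∑-mono-∈ (perms xs) (le j j≤N)) ⟩
      ∑ (perms xs) (ψ ∘ take j) * length (perms xs) ≡⟨ cong (_* length (perms xs)) (∑-perms xs ψ inv j r j+r) ⟩
      j ! * (r ! * layer xs j ψ) * length (perms xs) ≡⟨ lem₃ (j !) (r !) (layer xs j ψ) (length (perms xs)) ⟩
      j ! * r ! * (length (perms xs) * layer xs j ψ) ∎))) (≤-reflexive (lem₄ (w j) (length (perms xs)) (layer xs j ψ))))
      where
      r = N ∸ j
      j+r = m+[n∸m]≡n j≤N
      lem₁ : ∀ f w l → f * (w * l) ≡ w * (f * l)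
      lem₁ = solve-∀
      lem₂ : ∀ a b f l → a * b * (f * l) ≡ f * (a * (b * l))
      lem₂ = solve-∀
      lem₃ : ∀ a b l p → a * (b * l) * p ≡ a * b * (p * l)
      lem₃ = solve-∀
      lem₄ : ∀ w p l → w * (p * l) ≡ p * (w * l)
      lem₄ = solve-∀

module Indicator {A : Set} (_≟A_ : (x y : A) → Dec (x ≡ y)) where

  open import Data.List.Membership.DecPropositional _≟A_ using () renaming (_∈?_ to _∈ᴸ?_)

  χ : (xs l : List A) → Subset (length xs)
  χ [] l = []
  χ (x ∷ xs) l = does (x ∈ᴸ? l) ∷ χ xs l

  χ-cong : (xs : List A) {l l′ : List A} → (∀ {x} → x L.∈ l → x L.∈ l′) → (∀ {x} → x L.∈ l′ → x L.∈ l) → χ xs l ≡ χ xs l′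
  χ-cong [] f g = refl
  χ-cong (x ∷ xs) {l} {l′} f g = cong₂ _∷_ (does-⇔ (mk⇔ f g) (x ∈ᴸ? l) (x ∈ᴸ? l′)) (χ-cong xs f g)

  χ-swap : (xs : List A) → ∀ ys (x y : A) l → χ xs (ys ++ x ∷ y ∷ l) ≡ χ xs (ys ++ y ∷ x ∷ l)
  χ-swap xs ys x y l = χ-cong xs (turn ys x y) (turn ys y x)
    where
    turn : ∀ ys (x y : A) {z} → z L.∈ ys ++ x ∷ y ∷ l → z L.∈ ys ++ y ∷ x ∷ l
    turn [] x y (here e) = there (here e)
    turn [] x y (there (here e)) = here e
    turn [] x y (there (there z∈)) = there (there z∈)
    turn (w ∷ ys) x y (here e) = here e
    turn (w ∷ ys) x y (there z∈) = there (turn ys x y z∈)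

  select-⊆ : (xs : List A) (W : Subset (length xs)) {x : A} → x L.∈ select xs W → x L.∈ xs
  select-⊆ [] [] ()
  select-⊆ (x ∷ xs) (inside ∷ W) (here e) = here e
  select-⊆ (x ∷ xs) (inside ∷ W) (there x∈) = there (select-⊆ xs W x∈)
  select-⊆ (x ∷ xs) (outside ∷ W) x∈ = there (select-⊆ xs W x∈)

  χ-skip : (x : A) (xs l : List A) → All (x ≢_) xs → χ xs (x ∷ l) ≡ χ xs l
  χ-skip x [] l [] = refl
  χ-skip x (y ∷ xs) l (x≢y ∷ ne) = cong₂ _∷_
    (does-⇔ (mk⇔ (λ { (here refl) → ⊥-elim (x≢y refl) ; (there m) → m }) there) (y ∈ᴸ? (x ∷ l)) (y ∈ᴸ? l)) (χ-skip x xs l ne)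

  χ-select : (xs : List A) → Unique xs → (W : Subset (length xs)) → χ xs (select xs W) ≡ W
  χ-select [] _ [] = refl
  χ-select (x ∷ xs) (x∉ ∷ u) (inside ∷ W) = cong₂ _∷_ (dec-true (x ∈ᴸ? (x ∷ select xs W)) (here refl)) (trans (χ-skip x xs _ x∉) (χ-select xs u W))
  χ-select (x ∷ xs) (x∉ ∷ u) (outside ∷ W) = cong₂ _∷_ (dec-false (x ∈ᴸ? select xs W) λ x∈ → AllP.lookup x∉ (select-⊆ xs W x∈) refl) (χ-select xs u W)

  χ-∈ : (xs l : List A) {i : Fin (length xs)} → i ∈ χ xs l → lookup xs i L.∈ l
  χ-∈ (x ∷ xs) l {zero} i∈ with x ∈ᴸ? l
  ... | yes x∈ = x∈
  χ-∈ (x ∷ xs) l {suc i} (there i∈) = χ-∈ xs l i∈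

  χ-∈⁺ : (xs l : List A) (i : Fin (length xs)) → lookup xs i L.∈ l → i ∈ χ xs l
  χ-∈⁺ (x ∷ xs) l zero x∈ with x ∈ᴸ? l
  ... | yes _ = here
  ... | no x∉ = ⊥-elim (x∉ x∈)
  χ-∈⁺ (x ∷ xs) l (suc i) x∈ = there (χ-∈⁺ xs l i x∈)

-- Permutations with prescribed values

∑-allFin-suc : (n : ℕ) (f : Fin (suc n) → ℕ) → ∑ (allFin (suc n)) f ≡ f zero + ∑ (allFin n) (f ∘ suc)
∑-allFin-suc n f = cong (f zero +_) (trans (cong (λ l → ∑ l f) (sym (map-tabulate id suc))) (∑-map suc (allFin n) f))

length-filter-∑ : {A : Set} {P : A → Set} (P? : ∀ x → Dec (P x)) (xs : List A) → length (filter P? xs) ≡ ∑ xs (λ x → 𝟙 (P? x))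
length-filter-∑ P? [] = refl
length-filter-∑ P? (x ∷ xs) with P? x
... | yes _ = cong suc (length-filter-∑ P? xs)
... | no _ = length-filter-∑ P? xs

∣∣-∑ : {n : ℕ} (p : Subset n) → ∣ p ∣ ≡ ∑ (allFin n) (λ i → 𝟙 (i ∈? p))
∣∣-∑ [] = refl
∣∣-∑ {suc n} (s ∷ p) = trans (head s) (sym (trans (∑-allFin-suc n (λ i → 𝟙 (i ∈? (s ∷ p))))
    (cong (𝟙 (zero ∈? (s ∷ p)) +_) (∑-cong (allFin n) λ i → 𝟙-cong (suc i ∈? (s ∷ p)) (i ∈? p) drop-there there))))
  where
  head : ∀ s → ∣ s ∷ p ∣ ≡ 𝟙 (zero ∈? (s ∷ p)) + ∑ (allFin n) (λ i → 𝟙 (i ∈? p))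
  head inside = cong suc (∣∣-∑ p)
  head outside = ∣∣-∑ p

elements : {n : ℕ} → Subset n → List (Fin n)
elements {n} p = filter (_∈? p) (allFin n)

length-elements : {n : ℕ} (p : Subset n) → length (elements p) ≡ ∣ p ∣
length-elements {n} p = trans (length-filter-∑ (_∈? p) (allFin n)) (sym (∣∣-∑ p))

elements-unique : {n : ℕ} (p : Subset n) → Unique (elements p)
elements-unique {n} p = UniqueP.filter⁺ (_∈? p) (UniqueP.allFin⁺ n)

∈-elements⁺ : {n : ℕ} (p : Subset n) {i : Fin n} → i ∈ p → i L.∈ elements p
∈-elements⁺ p {i} i∈ = ∈-filter⁺ (_∈? p) (∈-allFin i) i∈

∈-elements⁻ : {n : ℕ} (p : Subset n) {i : Fin n} → i L.∈ elements p → i ∈ p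
∈-elements⁻ {n} p i∈ = proj₂ (∈-filter⁻ (_∈? p) {xs = allFin n} i∈)

comprehend : {n : ℕ} {P : Fin n → Set} → (∀ i → Dec (P i)) → Subset n
comprehend P? = Vec.tabulate (λ i → does (P? i))

∈-comprehend⁺ : {n : ℕ} {P : Fin n → Set} (P? : ∀ i → Dec (P i)) {i : Fin n} → P i → i ∈ comprehend P?
∈-comprehend⁺ P? {i} p = lookup⇒[]= i _ (trans (lookup∘tabulate _ i) (dec-true (P? i) p))

∈-comprehend⁻ : {n : ℕ} {P : Fin n → Set} (P? : ∀ i → Dec (P i)) {i : Fin n} → i ∈ comprehend P? → P i
∈-comprehend⁻ P? {i} i∈ with P? i | trans (sym (lookup∘tabulate (λ i → does (P? i)) i)) ([]=⇒lookup i∈)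
... | yes p | _ = p
... | no _ | ()

fromList : {n : ℕ} → List (Fin n) → Subset n
fromList [] = ⊥
fromList (i ∷ l) = ⁅ i ⁆ ∪ fromList l

∈-fromList⁺ : {n : ℕ} (l : List (Fin n)) {i : Fin n} → i L.∈ l → i ∈ fromList l
∈-fromList⁺ (j ∷ l) {i} (here refl) = p⊆p∪q (fromList l) (x∈⁅x⁆ i)
∈-fromList⁺ (j ∷ l) (there i∈) = q⊆p∪q ⁅ j ⁆ (fromList l) (∈-fromList⁺ l i∈)

∈-fromList⁻ : {n : ℕ} (l : List (Fin n)) {i : Fin n} → i ∈ fromList l → i L.∈ l
∈-fromList⁻ [] i∈ = ⊥-elim (∉⊥ i∈)
∈-fromList⁻ (j ∷ l) i∈ with x∈p∪q⁻ ⁅ j ⁆ (fromList l) i∈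
... | inj₁ i∈j = here (x∈⁅y⁆⇒x≡y j i∈j)
... | inj₂ i∈l = there (∈-fromList⁻ l i∈l)

∣∪∣≤ : {n : ℕ} (p q : Subset n) → ∣ p ∪ q ∣ ≤ ∣ p ∣ + ∣ q ∣
∣∪∣≤ p q = subst (λ z → ∣ z ∣ ≤ ∣ p ∣ + ∣ q ∣) (∩-identityʳ (p ∪ q))
  (≤-trans (∣∪∩∣≤ p q ⊤) (≤-reflexive (cong₂ (λ a b → ∣ a ∣ + ∣ b ∣) (∩-identityʳ p) (∩-identityʳ q))))

∣fromList∣≤ : {n : ℕ} (l : List (Fin n)) → ∣ fromList l ∣ ≤ length l
∣fromList∣≤ {n} [] = ≤-reflexive (∣⊥∣≡0 n)
∣fromList∣≤ (j ∷ l) = ≤-trans (∣∪∣≤ ⁅ j ⁆ (fromList l)) (+-mono-≤ (≤-reflexive (∣⁅x⁆∣≡1 j)) (∣fromList∣≤ l))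

module _ {A : Set} (_≟A_ : (x y : A) → Dec (x ≡ y)) where

  remove : A → List A → List A
  remove x = filter (λ y → ¬? (x ≟A y))

  length-remove : ∀ x xs → Unique xs → x L.∈ xs → suc (length (remove x xs)) ≡ length xs
  length-remove x (y ∷ xs) (y∉ ∷ u) x∈ with x ≟A y
  ... | yes refl = cong suc (trans (cong length (filter-all (λ z → ¬? (x ≟A z)) y∉)) refl)
  ... | no x≢y with x∈
  ...   | here e = ⊥-elim (x≢y e)
  ...   | there x∈xs = cong suc (length-remove x xs u x∈xs)

  length-remove-< : ∀ x xs → x L.∈ xs → length (remove x xs) < length xs
  length-remove-< x xs x∈ = filter-notAll (λ y → ¬? (x ≟A y)) xs (L.lose x∈ λ ne → ne refl)

  unique-⊆-length : ∀ ws xs → Unique ws → (∀ {w} → w L.∈ ws → w L.∈ xs) → length ws ≤ length xs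
  unique-⊆-length [] xs _ _ = z≤n
  unique-⊆-length (w ∷ ws) xs (w∉ ∷ u) sub = ≤-trans
    (s≤s (unique-⊆-length ws (remove w xs) u λ {v} v∈ → ∈-filter⁺ (λ y → ¬? (w ≟A y)) (sub (there v∈)) (AllP.lookup w∉ v∈)))
    (length-remove-< w xs (sub (here refl)))

  arrangements : (n : ℕ) → List A → List (Vec A n)
  arrangements zero av = [] ∷ []
  arrangements (suc n) av = concatMap (λ x → map (x ∷_) (arrangements n (remove x av))) av

  ∑-arrangements : ∀ n av (f : Vec A (suc n) → ℕ) →
    ∑ (arrangements (suc n) av) f ≡ ∑ av (λ x → ∑ (arrangements n (remove x av)) (λ π → f (x ∷ π)))
  ∑-arrangements n av f = trans (∑-concatMap (λ x → map (x ∷_) (arrangements n (remove x av))) av f)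
    (∑-cong av λ x → ∑-map (x ∷_) (arrangements n (remove x av)) f)

  ∈-arrangements⁻ : ∀ n av {x} {π : Vec A n} → (x ∷ π) L.∈ arrangements (suc n) av → x L.∈ av × π L.∈ arrangements n (remove x av)
  ∈-arrangements⁻ n av mem with L.find (∈-concatMap⁻ (λ x → map (x ∷_) (arrangements n (remove x av))) {xs = av} mem)
  ... | x , x∈ , mem′ with ∈-map⁻ (x ∷_) mem′
  ...   | π , π∈ , refl = x∈ , π∈

  remove-unique : ∀ x {xs} → Unique xs → Unique (remove x xs)
  remove-unique x = UniqueP.filter⁺ (λ y → ¬? (x ≟A y))

  ∈-remove⁻ : ∀ x xs {y} → y L.∈ remove x xs → y L.∈ xs × x ≢ y
  ∈-remove⁻ x xs = ∈-filter⁻ (λ y → ¬? (x ≟A y)) {xs = xs}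

  length-arrangements : ∀ n av → Unique av → length av ≡ n → length (arrangements n av) ≡ n !
  length-arrangements zero av u eq = refl
  length-arrangements (suc n) av u eq = trans (sym (trans (∑-const (arrangements (suc n) av) 1) (*-identityʳ _)))
    (trans (∑-arrangements n av (λ _ → 1))
    (trans (∑-cong-∈ av λ {x} x∈ → trans (∑-const (arrangements n (remove x av)) 1)
        (trans (*-identityʳ _) (length-arrangements n (remove x av) (remove-unique x u) (suc-injective (trans (length-remove x av u x∈) eq)))))
    (trans (∑-const av (n !)) (cong (_* n !) eq))))

  arrangement-∈ : ∀ n av {π : Vec A n} → π L.∈ arrangements n av → ∀ i → Vec.lookup π i L.∈ av
  arrangement-∈ (suc n) av {x ∷ π} mem zero = proj₁ (∈-arrangements⁻ n av mem)
  arrangement-∈ (suc n) av {x ∷ π} mem (suc i) = proj₁ (∈-remove⁻ x av (arrangement-∈ n (remove x av) (proj₂ (∈-arrangements⁻ n av mem)) i))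

  arrangement-injective : ∀ n av {π : Vec A n} → π L.∈ arrangements n av → ∀ i j → Vec.lookup π i ≡ Vec.lookup π j → i ≡ j
  arrangement-injective (suc n) av {x ∷ π} mem zero zero eq = refl
  arrangement-injective (suc n) av {x ∷ π} mem (suc i) (suc j) eq =
    cong suc (arrangement-injective n (remove x av) (proj₂ (∈-arrangements⁻ n av mem)) i j eq)
  arrangement-injective (suc n) av {x ∷ π} mem zero (suc j) eq =
    ⊥-elim (proj₂ (∈-remove⁻ x av (arrangement-∈ n (remove x av) (proj₂ (∈-arrangements⁻ n av mem)) j)) eq)
  arrangement-injective (suc n) av {x ∷ π} mem (suc i) zero eq =
    ⊥-elim (proj₂ (∈-remove⁻ x av (arrangement-∈ n (remove x av) (proj₂ (∈-arrangements⁻ n av mem)) i)) (sym eq))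

  arrangement-surjective : ∀ n av → Unique av → length av ≡ n → {π : Vec A n} → π L.∈ arrangements n av →
    ∀ {v} → v L.∈ av → ∃ λ i → Vec.lookup π i ≡ v
  arrangement-surjective zero [] u eq mem ()
  arrangement-surjective (suc n) av u eq {x ∷ π} mem {v} v∈ with x ≟A v
  ... | yes refl = zero , refl
  ... | no x≢v with arrangement-surjective n (remove x av) (remove-unique x u)
                      (suc-injective (trans (length-remove x av u (proj₁ (∈-arrangements⁻ n av mem))) eq)) (proj₂ (∈-arrangements⁻ n av mem))
                      (∈-filter⁺ (λ y → ¬? (x ≟A y)) v∈ x≢v)
  ...   | i , e = suc i , e

  Agree : {n : ℕ} → Subset n → (Fin n → A) → Vec A n → Set
  Agree P v π = ∀ i → i ∈ P → Vec.lookup π i ≡ v i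

  agree? : {n : ℕ} (P : Subset n) (v : Fin n → A) (π : Vec A n) → Dec (Agree P v π)
  agree? P v π = FinP.all? (λ i → (i ∈? P) →-dec (Vec.lookup π i ≟A v i))

  ∑-𝟙-≟ : ∀ v av → Unique av → ∑ av (λ x → 𝟙 (x ≟A v)) ≤ 1
  ∑-𝟙-≟ v [] u = z≤n
  ∑-𝟙-≟ v (x ∷ av) (x∉ ∷ u) with x ≟A v
  ... | yes refl = s≤s (≤-reflexive (trans (∑-cong-∈ av λ {y} y∈ → 𝟙-no (y ≟A x) λ { refl → AllP.lookup x∉ y∈ refl }) (∑-zero av)))
  ... | no _ = ∑-𝟙-≟ v av u

  -- A position in `P` has one admissible value. At a free position the values prescribed for later
  -- positions are excluded, and they are distinct as soon as some arrangement agrees at all, which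
  -- leaves `suc n ∸ ∣ P ∣` values. If no arrangement agrees, the sum is zero.
  count-agree : ∀ n av → Unique av → length av ≡ n → (P : Subset n) (v : Fin n → A) →
    ∑ (arrangements n av) (λ π → 𝟙 (agree? P v π)) ≤ (n ∸ ∣ P ∣) !
  count-agree zero av u eq [] v = ≤-trans (≤-reflexive (+-identityʳ _)) (𝟙≤1 (agree? [] v []))
  count-agree (suc n) av u eq (inside ∷ P) v = begin
    ∑ (arrangements (suc n) av) (λ π → 𝟙 (agree? (inside ∷ P) v π)) ≡⟨ ∑-arrangements n av _ ⟩
    ∑ av (λ x → ∑ (arrangements n (remove x av)) (λ π → 𝟙 (agree? (inside ∷ P) v (x ∷ π))))
      ≤⟨ ∑-mono-∈ av (λ {x} x∈ → ∑-mono (arrangements n (remove x av)) (λ π → head x π)) ⟩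
    ∑ av (λ x → ∑ (arrangements n (remove x av)) (λ π → 𝟙 (x ≟A v zero) * 𝟙 (agree? P (v ∘ suc) π)))
      ≡⟨ ∑-cong av (λ x → ∑-*ˡ (arrangements n (remove x av)) (𝟙 (x ≟A v zero)) _) ⟩
    ∑ av (λ x → 𝟙 (x ≟A v zero) * ∑ (arrangements n (remove x av)) (λ π → 𝟙 (agree? P (v ∘ suc) π)))
      ≤⟨ ∑-mono-∈ av (λ {x} x∈ → *-monoʳ-≤ (𝟙 (x ≟A v zero)) (count-agree n (remove x av) (remove-unique x u)
            (suc-injective (trans (length-remove x av u x∈) eq)) P (v ∘ suc))) ⟩
    ∑ av (λ x → 𝟙 (x ≟A v zero) * (n ∸ ∣ P ∣) !) ≡⟨ ∑-*ʳ av ((n ∸ ∣ P ∣) !) _ ⟩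
    ∑ av (λ x → 𝟙 (x ≟A v zero)) * (n ∸ ∣ P ∣) ! ≤⟨ *-monoˡ-≤ ((n ∸ ∣ P ∣) !) (∑-𝟙-≟ (v zero) av u) ⟩
    1 * (n ∸ ∣ P ∣) ! ≡⟨ *-identityˡ _ ⟩
    (n ∸ ∣ P ∣) ! ∎
    where
    open ≤-Reasoning
    head : ∀ x π → 𝟙 (agree? (inside ∷ P) v (x ∷ π)) ≤ 𝟙 (x ≟A v zero) * 𝟙 (agree? P (v ∘ suc) π)
    head x π = 𝟙-elim (agree? (inside ∷ P) v (x ∷ π)) λ ag → ≤-reflexive (sym (cong₂ _*_
      (𝟙-yes (x ≟A v zero) (ag zero here)) (𝟙-yes (agree? P (v ∘ suc) π) λ i i∈ → ag (suc i) (there i∈))))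
  count-agree (suc n) av u eq (outside ∷ P) v with any? (agree? (outside ∷ P) v) (arrangements (suc n) av)
  ... | no none = ≤-trans (≤-reflexive (trans (∑-cong-∈ (arrangements (suc n) av) λ {π} π∈ →
           𝟙-no (agree? (outside ∷ P) v π) λ ag → none (L.lose π∈ ag)) (∑-zero (arrangements (suc n) av)))) z≤n
  ... | yes some with L.find some
  ...   | (x₀ ∷ π₀) , π₀∈ , ag₀ = begin
    ∑ (arrangements (suc n) av) (λ π → 𝟙 (agree? (outside ∷ P) v π)) ≡⟨ ∑-arrangements n av _ ⟩
    ∑ av (λ x → ∑ (arrangements n (remove x av)) (λ π → 𝟙 (agree? (outside ∷ P) v (x ∷ π))))
      ≤⟨ ∑-mono-∈ av perX ⟩
    ∑ av (λ x → 𝟙 (¬? (used? x)) * (n ∸ ∣ P ∣) !) ≡⟨ ∑-*ʳ av ((n ∸ ∣ P ∣) !) _ ⟩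
    ∑ av (λ x → 𝟙 (¬? (used? x))) * (n ∸ ∣ P ∣) ! ≤⟨ *-monoˡ-≤ ((n ∸ ∣ P ∣) !) few ⟩
    suc (n ∸ ∣ P ∣) * (n ∸ ∣ P ∣) ! ≡⟨ cong _! (+-∸-assoc 1 (∣p∣≤n P)) ⟨
    (suc n ∸ ∣ P ∣) ! ∎
    where
    open ≤-Reasoning
    Used : A → Set
    Used x = ∃ λ i → i ∈ P × v (suc i) ≡ x
    used? : ∀ x → Dec (Used x)
    used? x = FinP.any? (λ i → (i ∈? P) ×-dec (v (suc i) ≟A x))
    perX : ∀ {x} → x L.∈ av → ∑ (arrangements n (remove x av)) (λ π → 𝟙 (agree? (outside ∷ P) v (x ∷ π))) ≤ 𝟙 (¬? (used? x)) * (n ∸ ∣ P ∣) !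
    perX {x} x∈ = ≤-trans (vanish (used? x) _ _ (≤-trans (∑-mono (arrangements n (remove x av)) λ π →
          𝟙-mono (agree? (outside ∷ P) v (x ∷ π)) (agree? P (v ∘ suc) π) λ ag i i∈ → ag (suc i) (there i∈))
          (count-agree n (remove x av) (remove-unique x u) (suc-injective (trans (length-remove x av u x∈) eq)) P (v ∘ suc)))
        λ (i , i∈ , e) → ≤-reflexive (trans (∑-cong-∈ (arrangements n (remove x av)) λ {π} π∈ →
          𝟙-no (agree? (outside ∷ P) v (x ∷ π)) λ ag → proj₂ (∈-remove⁻ x av (arrangement-∈ n (remove x av) π∈ i)) (sym (trans (ag (suc i) (there i∈)) e)))
          (∑-zero (arrangements n (remove x av)))))
        (≤-reflexive (*-comm ((n ∸ ∣ P ∣) !) _))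
    π₀∈′ : π₀ L.∈ arrangements n (remove x₀ av)
    π₀∈′ = proj₂ (∈-arrangements⁻ n av π₀∈)
    ws : List A
    ws = map (Vec.lookup π₀) (elements P)
    many : ∣ P ∣ ≤ ∑ av (λ x → 𝟙 (used? x))
    many = ≤-trans (≤-reflexive (sym (trans (length-map (Vec.lookup π₀) (elements P)) (length-elements P))))
      (≤-trans (unique-⊆-length ws (filter used? av) (UniqueP.map⁺ (λ {i} {j} → arrangement-injective n _ π₀∈′ i j) (elements-unique P)) sub)
        (≤-reflexive (length-filter-∑ used? av)))
      where
      sub : ∀ {w} → w L.∈ ws → w L.∈ filter used? av
      sub w∈ with ∈-map⁻ (Vec.lookup π₀) w∈
      ... | i , i∈ , refl = ∈-filter⁺ used? (proj₁ (∈-remove⁻ x₀ av (arrangement-∈ n _ π₀∈′ i)))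
              (i , ∈-elements⁻ P i∈ , sym (ag₀ (suc i) (there (∈-elements⁻ P i∈))))
    few : ∑ av (λ x → 𝟙 (¬? (used? x))) ≤ suc (n ∸ ∣ P ∣)
    few = ≤-trans (m+n≤o⇒m≤o∸n _ (≤-trans (≤-reflexive (+-comm _ ∣ P ∣)) (≤-trans (+-monoˡ-≤ _ many) (≤-reflexive
        (trans (sym (∑-+ av _ _)) (trans (∑-cong av λ x → 𝟙-¬ (used? x)) (trans (∑-const av 1) (trans (*-identityʳ _) eq)))))))) (≤-reflexive (+-∸-assoc 1 (∣p∣≤n P)))

∏ : {n : ℕ} → (Fin n → ℕ) → ℕ
∏ {zero} f = 1
∏ {suc n} f = f zero * ∏ (f ∘ suc)

∏-mono : {n : ℕ} {f g : Fin n → ℕ} → (∀ i → f i ≤ g i) → ∏ f ≤ ∏ g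
∏-mono {zero} le = ≤-refl
∏-mono {suc n} le = *-mono-≤ (le zero) (∏-mono (le ∘ suc))

∏-const : (n c : ℕ) → ∏ {n} (λ _ → c) ≡ c ^ n
∏-const zero c = refl
∏-const (suc n) c = cong (c *_) (∏-const n c)

∏-* : {n : ℕ} (f g : Fin n → ℕ) → ∏ (λ i → f i * g i) ≡ ∏ f * ∏ g
∏-* {zero} f g = refl
∏-* {suc n} f g = trans (cong (f zero * g zero *_) (∏-* (f ∘ suc) (g ∘ suc))) (lem (f zero) (g zero) _ _)
  where
  lem : ∀ a b c d → a * b * (c * d) ≡ a * c * (b * d)
  lem = solve-∀

∏-^ : (B n : ℕ) (f : Fin n → ℕ) → ∏ (λ i → B ^ f i) ≡ B ^ ∑ (allFin n) f
∏-^ B zero f = refl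
∏-^ B (suc n) f = trans (cong (B ^ f zero *_) (∏-^ B n (f ∘ suc))) (trans (sym (^-distribˡ-+-* B (f zero) _)) (cong (B ^_) (sym (∑-allFin-suc n f))))

choices : {A : Set} {n : ℕ} → (Fin n → List A) → List (Vec A n)
choices {n = zero} Ls = [] ∷ []
choices {n = suc n} Ls = concatMap (λ x → map (x ∷_) (choices (Ls ∘ suc))) (Ls zero)

module _ {A : Set} where

  ∑-choices : {n : ℕ} (Ls : Fin n → List A) (f : Fin n → A → ℕ) →
    ∑ (choices Ls) (λ v → ∏ (λ i → f i (Vec.lookup v i))) ≡ ∏ (λ i → ∑ (Ls i) (f i))
  ∑-choices {zero} Ls f = refl
  ∑-choices {suc n} Ls f = trans (∑-concatMap (λ x → map (x ∷_) (choices (Ls ∘ suc))) (Ls zero) _)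
    (trans (∑-cong (Ls zero) λ x → trans (∑-map (x ∷_) (choices (Ls ∘ suc)) _) (trans (∑-*ˡ (choices (Ls ∘ suc)) (f zero x) _)
       (cong (f zero x *_) (∑-choices (Ls ∘ suc) (f ∘ suc)))))
      (∑-*ʳ (Ls zero) _ _))

  length-choices : {n : ℕ} (Ls : Fin n → List A) → length (choices Ls) ≡ ∏ (λ i → length (Ls i))
  length-choices {zero} Ls = refl
  length-choices {suc n} Ls = trans (sym (trans (∑-const (choices Ls) 1) (*-identityʳ _)))
    (trans (∑-concatMap (λ x → map (x ∷_) (choices (Ls ∘ suc))) (Ls zero) _)
      (trans (∑-cong (Ls zero) λ x → trans (∑-const (map (x ∷_) (choices (Ls ∘ suc))) 1)
         (trans (*-identityʳ _) (trans (length-map (x ∷_) (choices (Ls ∘ suc))) (length-choices (Ls ∘ suc))))) (∑-const (Ls zero) _)))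

  ∈-choices⁺ : {n : ℕ} (Ls : Fin n → List A) (v : Vec A n) → (∀ i → Vec.lookup v i L.∈ Ls i) → v L.∈ choices Ls
  ∈-choices⁺ {zero} Ls [] mem = here refl
  ∈-choices⁺ {suc n} Ls (x ∷ v) mem = ∈-concatMap⁺ (λ y → map (y ∷_) (choices (Ls ∘ suc)))
    (L.lose (mem zero) (∈-map⁺ (x ∷_) (∈-choices⁺ (Ls ∘ suc) v (mem ∘ suc))))

  ∈-choices⁻ : {n : ℕ} (Ls : Fin n → List A) {v : Vec A n} → v L.∈ choices Ls → ∀ i → Vec.lookup v i L.∈ Ls i
  ∈-choices⁻ {suc n} Ls mem i with L.find (∈-concatMap⁻ (λ y → map (y ∷_) (choices (Ls ∘ suc))) {xs = Ls zero} mem)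
  ... | x , x∈ , mem′ with ∈-map⁻ (x ∷_) mem′
  ∈-choices⁻ {suc n} Ls mem zero | x , x∈ , mem′ | v , v∈ , refl = x∈
  ∈-choices⁻ {suc n} Ls mem (suc i) | x , x∈ , mem′ | v , v∈ , refl = ∈-choices⁻ (Ls ∘ suc) v∈ i

-- Passing from a falling factorial to a power costs a factor 4 per chosen element, because
-- `suc m ^ h ≤ 4 * m ^ h` for `h ≤ m`. This is the origin of the constant `4 ^ s` in the density
-- condition for templates.
falling-factorial : ∀ m h → h ≤ m → m ^ h * (m ∸ h) ! ≤ 4 ^ h * m !
falling-factorial m zero le = ≤-refl
falling-factorial (suc m) (suc h) (s≤s le) = begin
  suc m * suc m ^ h * (m ∸ h) ! ≤⟨ *-monoˡ-≤ ((m ∸ h) !) (*-monoʳ-≤ (suc m) (shift m h le)) ⟩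
  suc m * (4 * m ^ h) * (m ∸ h) ! ≡⟨ lem₁ (suc m) (m ^ h) ((m ∸ h) !) ⟩
  4 * suc m * (m ^ h * (m ∸ h) !) ≤⟨ *-monoʳ-≤ (4 * suc m) (falling-factorial m h le) ⟩
  4 * suc m * (4 ^ h * m !) ≡⟨ lem₂ (suc m) (4 ^ h) (m !) ⟩
  4 * 4 ^ h * (suc m * m !) ∎
  where
  open ≤-Reasoning
  shift : ∀ m h → h ≤ m → suc m ^ h ≤ 4 * m ^ h
  shift zero zero le = s≤s z≤n
  shift (suc m) h le = pow-exp-bound m h 1 (≤-trans le (≤-reflexive (sym (*-identityˡ (suc m)))))
  lem₁ : ∀ s x y → s * (4 * x) * y ≡ 4 * s * (x * y)
  lem₁ = solve-∀
  lem₂ : ∀ s x y → 4 * s * (x * y) ≡ 4 * x * (s * y)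
  lem₂ = solve-∀

-- Copies of an edge template

!-mono-≤ : ∀ {a b} → a ≤ b → a ! ≤ b !
!-mono-≤ {b = b} z≤n = n>0⇒1≤ (b !≢0)
  where
  n>0⇒1≤ : ∀ {n} → NonZero n → 1 ≤ n
  n>0⇒1≤ {suc n} _ = s≤s z≤n
!-mono-≤ (s≤s le) = *-mono-≤ (s≤s le) (!-mono-≤ le)

image-size : {s : ℕ} → (Fin s → Fin s) → ℕ
image-size {s} r = ∑ (allFin s) (λ l → 𝟙 (FinP.any? (λ l′ → r l′ FinP.≟ l)))

-- A class outside the image of `r` gets the single dummy `c`, which is never read; this makes the
-- number of vectors exactly `m ^ image-size r`.
fibre-options : {s m : ℕ} → (Fin s → Fin s) → Fin m → Fin s → List (Fin m)
fibre-options {m = m} r c l = if does (FinP.any? (λ l′ → r l′ FinP.≟ l)) then allFin m else c ∷ []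

fibre-constant : {s m : ℕ} → (Fin s → Fin s) → Fin m → List (Vec (Fin m) s)
fibre-constant {s} {m} r c = map (λ μ → Vec.tabulate (λ l → Vec.lookup μ (r l)))
  (choices (fibre-options r c))

length-fibre-constant : {s m : ℕ} (r : Fin s → Fin s) (c : Fin m) → length (fibre-constant r c) ≡ m ^ image-size r
length-fibre-constant {s} {m} r c = trans (length-map _ (choices (fibre-options r c))) (trans (length-choices (fibre-options r c))
  (trans (∏-cong λ l → size (FinP.any? (λ l′ → r l′ FinP.≟ l))) (∏-^ m s _)))
  where
  ∏-cong : {n : ℕ} {f g : Fin n → ℕ} → (∀ i → f i ≡ g i) → ∏ f ≡ ∏ g
  ∏-cong {zero} eq = refl
  ∏-cong {suc n} eq = cong₂ _*_ (eq zero) (∏-cong (eq ∘ suc))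
  size : {P : Set} (d : Dec P) → length (if does d then allFin m else c ∷ []) ≡ m ^ 𝟙 d
  size (yes _) = trans (length-tabulate id) (sym (*-identityʳ m))
  size (no _) = refl

∈-fibre-constant : {s m : ℕ} (r : Fin s → Fin s) (c : Fin m) (λ′ : Fin s → Fin m) → (∀ l → λ′ (r l) ≡ λ′ l) →
  Vec.tabulate λ′ L.∈ fibre-constant r c
∈-fibre-constant {s} {m} r c λ′ fix = subst (L._∈ fibre-constant r c) eq (∈-map⁺ _ (∈-choices⁺ (fibre-options r c) μ mem))
  where
  inImage? : ∀ l → Dec (∃ λ l′ → r l′ ≡ l)
  inImage? l = FinP.any? (λ l′ → r l′ FinP.≟ l)
  val : Fin s → Fin m
  val l = if does (inImage? l) then λ′ l else c
  μ : Vec (Fin m) s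
  μ = Vec.tabulate val
  mem : ∀ l → Vec.lookup μ l L.∈ (if does (inImage? l) then allFin m else c ∷ [])
  mem l = subst (L._∈ (if does (inImage? l) then allFin m else c ∷ [])) (sym (lookup∘tabulate val l)) (pick′ (inImage? l))
    where
    pick′ : {P : Set} (d : Dec P) → (if does d then λ′ l else c) L.∈ (if does d then allFin m else c ∷ [])
    pick′ (yes _) = ∈-allFin _
    pick′ (no _) = here refl
  val-r : ∀ l → val (r l) ≡ λ′ (r l)
  val-r l = cong (if_then λ′ (r l) else c) (dec-true (inImage? (r l)) (l , refl))
  eq : Vec.tabulate (λ l → Vec.lookup μ (r l)) ≡ Vec.tabulate λ′
  eq = tabulate-cong λ l → trans (lookup∘tabulate val (r l)) (trans (val-r l) (fix l))

permutations : (m : ℕ) → List (Vec (Fin m) m)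
permutations m = arrangements FinP._≟_ m (allFin m)

inverse : {m n : ℕ} → Vec (Fin m) n → Fin n → Fin m → Fin n
inverse π d c with FinP.any? (λ i → Vec.lookup π i FinP.≟ c)
... | yes (i , _) = i
... | no _ = d

inv : {m : ℕ} → Vec (Fin m) m → Fin m → Fin m
inv π c = inverse π c c

module _ {m : ℕ} {π : Vec (Fin m) m} (π∈ : π L.∈ permutations m) where

  lookup-inv : ∀ c → Vec.lookup π (inv π c) ≡ c
  lookup-inv c with FinP.any? (λ i → Vec.lookup π i FinP.≟ c)
  ... | yes (i , eq) = eq
  ... | no none = ⊥-elim (none (arrangement-surjective FinP._≟_ m (allFin m) (UniqueP.allFin⁺ m) (length-tabulate id) π∈ (∈-allFin c)))

  inv-lookup : ∀ i → inv π (Vec.lookup π i) ≡ i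
  inv-lookup i = arrangement-injective FinP._≟_ m (allFin m) π∈ _ _ (lookup-inv (Vec.lookup π i))

  inv-injective : ∀ {c c′} → inv π c ≡ inv π c′ → c ≡ c′
  inv-injective {c} {c′} eq = trans (sym (lookup-inv c)) (trans (cong (Vec.lookup π) eq) (lookup-inv c′))

length-cartesianProduct : {A B : Set} (xs : List A) (ys : List B) → length (cartesianProduct xs ys) ≡ length xs * length ys
length-cartesianProduct [] ys = refl
length-cartesianProduct (x ∷ xs) ys = trans (length-++ (map (x ,_) ys)) (cong₂ _+_ (length-map (x ,_) ys) (length-cartesianProduct xs ys))

∑-cartesianProduct : {A B : Set} (xs : List A) (ys : List B) (f : A × B → ℕ) →
  ∑ (cartesianProduct xs ys) f ≡ ∑ xs (λ x → ∑ ys (λ y → f (x , y)))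
∑-cartesianProduct [] ys f = refl
∑-cartesianProduct (x ∷ xs) ys f = trans (∑-++ (map (x ,_) ys) _ f) (cong₂ _+_ (∑-map (x ,_) ys f) (∑-cartesianProduct xs ys f))

∑-filter-≤ : {A : Set} {P : A → Set} (P? : ∀ x → Dec (P x)) (xs : List A) →
  ∑ xs (λ x → 𝟙 (P? x)) + ∑ xs (λ x → 𝟙 (¬? (P? x))) ≡ length xs
∑-filter-≤ P? xs = trans (sym (∑-+ xs _ _)) (trans (∑-cong xs λ x → 𝟙-¬ (P? x)) (trans (∑-const xs 1) (*-identityʳ _)))

unique-map : {A B : Set} (f : A → B) (xs : List A) → Unique xs →
  (∀ {x y} → x L.∈ xs → y L.∈ xs → f x ≡ f y → x ≡ y) → Unique (map f xs)
unique-map f [] u inj = []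
unique-map f (x ∷ xs) (x∉ ∷ u) inj = AllP.tabulate new ∷ unique-map f xs u λ x∈ y∈ → inj (there x∈) (there y∈)
  where
  new : ∀ {z} → z L.∈ map f xs → f x ≢ z
  new z∈ eq with ∈-map⁻ f z∈
  ... | y , y∈ , refl = AllP.lookup x∉ y∈ (inj (here refl) (there y∈) eq)

-- A template with s vertex classes of size m and e edge types.  A family τ of permutations assigns the vertices of each
-- class to m locations, and copy τ consists of the edges of the active types between vertices at equal locations.
module Template (s m e N : ℕ) (src tgt : Fin e → Fin s) (active : Subset e)
  (edge : Fin e → Fin m → Fin m → Fin N)
  (edge-inj : ∀ {x x′ i i′ j j′} → x ∈ active → x′ ∈ active → edge x i j ≡ edge x′ i′ j′ → x ≡ x′ × i ≡ i′ × j ≡ j′) where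

  families : List (Vec (Vec (Fin m) m) s)
  families = choices (λ _ → permutations m)

  length-families : length families ≡ (m !) ^ s
  length-families = trans (length-choices (λ (_ : Fin s) → permutations m)) (trans (∏-const s _)
    (cong (_^ s) (length-arrangements FinP._≟_ m (allFin m) (UniqueP.allFin⁺ m) (length-tabulate id))))

  slot : Vec (Vec (Fin m) m) s → Fin m → Fin e → Fin N
  slot τ c x = edge x (inv (Vec.lookup τ (src x)) c) (inv (Vec.lookup τ (tgt x)) c)

  places : List (Fin m × Fin e)
  places = cartesianProduct (allFin m) (elements active)

  copy : Vec (Vec (Fin m) m) s → Subset N
  copy τ = fromList (map (λ (c , x) → slot τ c x) places)

  copies : List (Subset N)
  copies = map copy families

  ∣copy∣≤ : ∀ τ → ∣ copy τ ∣ ≤ m * e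
  ∣copy∣≤ τ = ≤-trans (∣fromList∣≤ (map (λ (c , x) → slot τ c x) places)) (≤-trans (≤-reflexive (trans (length-map _ places)
    (trans (length-cartesianProduct (allFin m) (elements active)) (cong₂ _*_ (length-tabulate {n = m} id) (length-elements active)))))
    (*-monoʳ-≤ m (∣p∣≤n active)))

  slot-∈ : ∀ τ c {x} → x ∈ active → slot τ c x ∈ copy τ
  slot-∈ τ c {x} x∈ = ∈-fromList⁺ _ (∈-map⁺ (λ (c , x) → slot τ c x) (∈-cartesianProduct⁺ (∈-allFin c) (∈-elements⁺ active x∈)))

  ∈-copy⁻ : ∀ τ {i} → i ∈ copy τ → ∃ λ c → ∃ λ x → x ∈ active × i ≡ slot τ c x
  ∈-copy⁻ τ i∈ with ∈-map⁻ (λ (c , x) → slot τ c x) (∈-fromList⁻ (map (λ (c , x) → slot τ c x) places) i∈)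
  ... | (c , x) , cx∈ , eq = c , x , ∈-elements⁻ active (proj₂ (∈-cartesianProduct⁻ (allFin m) (elements active) cx∈)) , eq

  copy-with : (P : Subset N → Set) → Any P copies → ∃ λ τ → τ L.∈ families × P (copy τ)
  copy-with P some with L.find some
  ... | S , S∈ , pS with ∈-map⁻ copy S∈
  ...   | τ , τ∈ , refl = τ , τ∈ , pS

  ∣copies∣≤ : ∀ {S} → S L.∈ copies → ∣ S ∣ ≤ m * e
  ∣copies∣≤ S∈ with ∈-map⁻ copy S∈
  ... | τ , _ , refl = ∣copy∣≤ τ

  copies≢[] : 1 ≤ length copies
  copies≢[] = ≤-trans (>-nonZero⁻¹ ((m !) ^ s) ⦃ m^n≢0 (m !) s ⦃ m !≢0 ⦄ ⦄) (≤-reflexive (sym (trans (length-map copy families) length-families)))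

  module Gaps (W : Subset N) (τ : Vec (Vec (Fin m) m) s) (τ∈ : τ L.∈ families) where

    complete? : ∀ c → Dec (∀ x → x ∈ active → slot τ c x ∈ W)
    complete? c = FinP.all? (λ x → (x ∈? active) →-dec (slot τ c x ∈? W))

    slotOf : Fin m × Fin e → Fin N
    slotOf (c , x) = slot τ c x

    missing? : ∀ cx → Dec (slotOf cx ∉ W)
    missing? cx = ¬? (slotOf cx ∈? W)

    gaps : List (Fin m × Fin e)
    gaps = filter missing? places

    active-gap : ∀ {cx} → cx L.∈ gaps → proj₂ cx ∈ active
    active-gap {c , x} cx∈ = ∈-elements⁻ active (proj₂ (∈-cartesianProduct⁻ (allFin m) (elements active) (proj₁ (∈-filter⁻ missing? {xs = places} cx∈))))

    gaps-≤ : length gaps ≤ ∣ copy τ ─ W ∣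
    gaps-≤ = ≤-trans (≤-reflexive (sym (length-map slotOf gaps)))
      (≤-trans (unique-⊆-length FinP._≟_ (map slotOf gaps) (elements (copy τ ─ W)) uniq sub′) (≤-reflexive (length-elements (copy τ ─ W))))
      where
      inj : ∀ {cx cx′} → cx L.∈ gaps → cx′ L.∈ gaps → slotOf cx ≡ slotOf cx′ → cx ≡ cx′
      inj {c , x} {c′ , x′} cx∈ cx′∈ eq with edge-inj (active-gap cx∈) (active-gap cx′∈) eq
      ... | refl , eqi , _ = cong (_, x) (inv-injective (∈-choices⁻ (λ _ → permutations m) τ∈ (src x)) eqi)
      uniq : Unique (map slotOf gaps)
      uniq = unique-map slotOf gaps (UniqueP.filter⁺ missing? (UniqueP.cartesianProduct⁺ (UniqueP.allFin⁺ m) (elements-unique active))) inj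
      sub′ : ∀ {i} → i L.∈ map slotOf gaps → i L.∈ elements (copy τ ─ W)
      sub′ i∈ with ∈-map⁻ slotOf i∈
      ... | (c , x) , cx∈ , refl = ∈-elements⁺ (copy τ ─ W) (x∈p∧x∉q⇒x∈p─q (slot-∈ τ c (active-gap cx∈)) (proj₂ (∈-filter⁻ missing? {xs = places} cx∈)))

    good-locations : List (Fin m)
    good-locations = filter complete? (allFin m)

    good-locations-unique : Unique good-locations
    good-locations-unique = UniqueP.filter⁺ complete? (UniqueP.allFin⁺ m)

    good-location : ∀ {c} → c L.∈ good-locations → ∀ x → x ∈ active → slot τ c x ∈ W
    good-location c∈ = proj₂ (∈-filter⁻ complete? {xs = allFin m} c∈)

    -- A location that is not complete has a missing edge, and by `edge-inj` the missing edges at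
    -- different locations are different elements of `copy τ ─ W`.
    good-locations-≥ : m ≤ length good-locations + ∣ copy τ ─ W ∣
    good-locations-≥ = begin
      m ≡⟨ length-tabulate {n = m} id ⟨
      length (allFin m) ≡⟨ ∑-filter-≤ complete? (allFin m) ⟨
      ∑ (allFin m) (λ c → 𝟙 (complete? c)) + ∑ (allFin m) (λ c → 𝟙 (¬? (complete? c)))
        ≤⟨ +-mono-≤ (≤-reflexive (sym (length-filter-∑ complete? (allFin m)))) (∑-mono (allFin m) broken) ⟩
      length good-locations + ∑ (allFin m) (λ c → ∑ (elements active) (λ x → 𝟙 (missing? (c , x))))
        ≡⟨ cong (length good-locations +_) (trans (sym (∑-cartesianProduct (allFin m) (elements active) _)) (sym (length-filter-∑ missing? places))) ⟩
      length good-locations + length gaps ≤⟨ +-monoʳ-≤ (length good-locations) gaps-≤ ⟩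
      length good-locations + ∣ copy τ ─ W ∣ ∎
      where
      open ≤-Reasoning
      broken : ∀ c → 𝟙 (¬? (complete? c)) ≤ ∑ (elements active) (λ x → 𝟙 (missing? (c , x)))
      broken c = 𝟙-elim (¬? (complete? c)) λ not-all → gap (FinP.¬∀⟶∃¬ e _ (λ x → (x ∈? active) →-dec (slot τ c x ∈? W)) not-all)
        where
        gap : (∃ λ x → ¬ (x ∈ active → slot τ c x ∈ W)) → 1 ≤ ∑ (elements active) (λ x → 𝟙 (missing? (c , x)))
        gap (x , ¬imp) with x ∈? active
        ... | no x∉ = ⊥-elim (¬imp λ x∈ → ⊥-elim (x∉ x∈))
        ... | yes x∈ = ≤-trans (≤-reflexive (sym (𝟙-yes (missing? (c , x)) λ s∈ → ¬imp λ _ → s∈)))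
                (∑-term (elements active) (λ x → 𝟙 (missing? (c , x))) (∈-elements⁺ active x∈))

  -- `rep X` is meant to pick one class in each connected component of the edge types `X`, so that
  -- `m ^ image-size (rep X)` bounds the labellings constant along `X`. In `dense`, `B` is the
  -- spread to be achieved, and `4 ^ s` pays for the falling factorials in the `s` classes.
  module _ (B : ℕ) (rep : Subset e → Fin s → Fin s)
    (rep-fix : ∀ X (λ′ : Fin s → Fin m) → (∀ x → x ∈ X → λ′ (src x) ≡ λ′ (tgt x)) → ∀ l → λ′ (rep X l) ≡ λ′ l)
    (dense : ∀ X → X ⊆ active → Nonempty X → 4 ^ s * B ^ ∣ X ∣ * m ^ image-size (rep X) ≤ m ^ s) where

    module _ (T : Subset N) (τ₀ : Vec (Vec (Fin m) m) s) (τ₀∈ : τ₀ L.∈ families) (T⊆ : T ⊆ copy τ₀) where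

      perm : ∀ {τ} → τ L.∈ families → ∀ a → Vec.lookup τ a L.∈ permutations m
      perm τ∈ = ∈-choices⁻ (λ _ → permutations m) τ∈

      at? : ∀ c x → Dec (x ∈ active × slot τ₀ c x ∈ T)
      at? c x = (x ∈? active) ×-dec (slot τ₀ c x ∈? T)

      at : Fin m → Subset e
      at c = comprehend (at? c)

      C : Subset m
      C = comprehend (λ c → nonempty? (at c))

      h = ∣ C ∣

      -- Candidates for the new locations of the vertices that `τ₀` puts at `c`. An edge of `T` at
      -- `c` forces equal new locations on its two ends, hence constancy along `at c`; a location
      -- without edges of `T` gets a dummy row.
      labels : Fin m → List (Vec (Fin m) s)
      labels c = if does (nonempty? (at c)) then fibre-constant (rep (at c)) c else (Vec.replicate s c ∷ [])

      labellings : List (Vec (Vec (Fin m) s) m)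
      labellings = choices labels

      occupied : Fin s → Subset m
      occupied a = comprehend (λ i → Vec.lookup (Vec.lookup τ₀ a) i ∈? C)

      target : Vec (Vec (Fin m) s) m → (a : Fin s) → Fin m → Fin m
      target Λ a i = Vec.lookup (Vec.lookup Λ (Vec.lookup (Vec.lookup τ₀ a) i)) a

      agree : ∀ Λ a π → Dec (Agree FinP._≟_ (occupied a) (target Λ a) π)
      agree Λ a = agree? FinP._≟_ (occupied a) (target Λ a)

      h≤occupied : ∀ a → h ≤ ∣ occupied a ∣
      h≤occupied a = ≤-trans (≤-reflexive (sym (trans (length-map (inv π₀) (elements C)) (length-elements C))))
        (≤-trans (unique-⊆-length FinP._≟_ (map (inv π₀) (elements C)) (elements (occupied a))
            (UniqueP.map⁺ (inv-injective (perm τ₀∈ a)) (elements-unique C)) sub)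
          (≤-reflexive (length-elements (occupied a))))
        where
        π₀ = Vec.lookup τ₀ a
        sub : ∀ {i} → i L.∈ map (inv π₀) (elements C) → i L.∈ elements (occupied a)
        sub i∈ with ∈-map⁻ (inv π₀) i∈
        ... | c , c∈ , refl = ∈-elements⁺ (occupied a) (∈-comprehend⁺ (λ i → Vec.lookup π₀ i ∈? C)
                (subst (_∈ C) (sym (lookup-inv (perm τ₀∈ a) c)) (∈-elements⁻ C c∈)))

      -- If `T ⊆ copy τ`, the locations to which `τ` sends the vertices at touched locations of `τ₀`
      -- form one of the labellings, and this labelling prescribes every permutation of `τ` on
      -- `occupied`.
      covered : ∀ {τ} → τ L.∈ families → 𝟙 (T ⊆? copy τ) ≤ ∑ labellings (λ Λ → ∏ (λ a → 𝟙 (agree Λ a (Vec.lookup τ a))))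
      covered {τ} τ∈ = 𝟙-elim (T ⊆? copy τ) λ T⊆τ → ≤-trans (≤-reflexive (sym (one T⊆τ))) (∑-term labellings _ (∈-choices⁺ labels Λ (member T⊆τ)))
        where
        moved : Fin m → Fin s → Fin m
        moved c a = Vec.lookup (Vec.lookup τ a) (inv (Vec.lookup τ₀ a) c)
        row : Fin m → Vec (Fin m) s
        row c = if does (nonempty? (at c)) then Vec.tabulate (moved c) else Vec.replicate s c
        Λ : Vec (Vec (Fin m) s) m
        Λ = Vec.tabulate row
        consistent : T ⊆ copy τ → ∀ c x → x ∈ at c → moved c (src x) ≡ moved c (tgt x)
        consistent T⊆τ c x x∈ with ∈-comprehend⁻ (at? c) x∈
        ... | x∈act , slot∈T with ∈-copy⁻ τ (T⊆τ slot∈T)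
        ...   | c′ , x′ , x′∈act , eq with edge-inj x∈act x′∈act eq
        ...     | refl , eqi , eqj = trans (cong (Vec.lookup (Vec.lookup τ (src x))) eqi) (trans (lookup-inv (perm τ∈ (src x)) c′)
                  (sym (trans (cong (Vec.lookup (Vec.lookup τ (tgt x))) eqj) (lookup-inv (perm τ∈ (tgt x)) c′))))
        row-∈ : T ⊆ copy τ → ∀ c → row c L.∈ labels c
        row-∈ T⊆τ c = cases (nonempty? (at c))
          where
          cases : {P : Set} (d : Dec P) → (if does d then Vec.tabulate (moved c) else Vec.replicate s c) L.∈
            (if does d then fibre-constant (rep (at c)) c else (Vec.replicate s c ∷ []))
          cases (yes _) = ∈-fibre-constant (rep (at c)) c (moved c) (rep-fix (at c) (moved c) (consistent T⊆τ c))
          cases (no _) = here refl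
        member : T ⊆ copy τ → ∀ c → Vec.lookup Λ c L.∈ labels c
        member T⊆τ c = subst (L._∈ labels c) (sym (lookup∘tabulate row c)) (row-∈ T⊆τ c)
        agrees : ∀ a → Agree FinP._≟_ (occupied a) (target Λ a) (Vec.lookup τ a)
        agrees a i i∈ = sym (trans (cong (λ r → Vec.lookup r a) (trans (lookup∘tabulate row c)
            (cong (if_then Vec.tabulate (moved c) else Vec.replicate s c) (dec-true (nonempty? (at c)) (∈-comprehend⁻ (λ c → nonempty? (at c)) c∈C)))))
            (trans (lookup∘tabulate (moved c) a) (cong (Vec.lookup (Vec.lookup τ a)) (inv-lookup (perm τ₀∈ a) i))))
          where
          c = Vec.lookup (Vec.lookup τ₀ a) i
          c∈C : c ∈ C
          c∈C = ∈-comprehend⁻ (λ i → Vec.lookup (Vec.lookup τ₀ a) i ∈? C) i∈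
        one : T ⊆ copy τ → ∏ (λ a → 𝟙 (agree Λ a (Vec.lookup τ a))) ≡ 1
        one _ = ones λ a → 𝟙-yes (agree Λ a (Vec.lookup τ a)) (agrees a)
          where
          ones : {n : ℕ} {f : Fin n → ℕ} → (∀ i → f i ≡ 1) → ∏ f ≡ 1
          ones {zero} eq = refl
          ones {suc n} eq = cong₂ _*_ (eq zero) (ones (eq ∘ suc))

      count-copies : ∑ families (λ τ → 𝟙 (T ⊆? copy τ)) ≤ length labellings * ((m ∸ h) !) ^ s
      count-copies = begin
        ∑ families (λ τ → 𝟙 (T ⊆? copy τ)) ≤⟨ ∑-mono-∈ families covered ⟩
        ∑ families (λ τ → ∑ labellings (λ Λ → ∏ (λ a → 𝟙 (agree Λ a (Vec.lookup τ a))))) ≡⟨ ∑-swap families labellings _ ⟩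
        ∑ labellings (λ Λ → ∑ families (λ τ → ∏ (λ a → 𝟙 (agree Λ a (Vec.lookup τ a)))))
          ≡⟨ ∑-cong labellings (λ Λ → ∑-choices (λ _ → permutations m) (λ a π → 𝟙 (agree Λ a π))) ⟩
        ∑ labellings (λ Λ → ∏ (λ a → ∑ (permutations m) (λ π → 𝟙 (agree Λ a π))))
          ≤⟨ ∑-mono labellings (λ Λ → ∏-mono λ a → ≤-trans (count-agree FinP._≟_ m (allFin m) (UniqueP.allFin⁺ m) (length-tabulate id) (occupied a) (target Λ a))
                (!-mono-≤ (∸-monoʳ-≤ m (h≤occupied a)))) ⟩
        ∑ labellings (λ Λ → ∏ {s} (λ a → (m ∸ h) !)) ≡⟨ ∑-cong labellings (λ _ → ∏-const s ((m ∸ h) !)) ⟩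
        ∑ labellings (λ Λ → ((m ∸ h) !) ^ s) ≡⟨ ∑-const labellings _ ⟩
        length labellings * ((m ∸ h) !) ^ s ∎
        where open ≤-Reasoning

      ∣T∣≤ : ∣ T ∣ ≤ ∑ (allFin m) (λ c → ∣ at c ∣)
      ∣T∣≤ = ≤-trans (p⊆q⇒∣p∣≤∣q∣ sub) (≤-trans (∣fromList∣≤ l) (≤-reflexive (trans (sym (trans (∑-const l 1) (*-identityʳ _)))
          (trans (∑-concatMap (λ c → map (slot τ₀ c) (elements (at c))) (allFin m) (λ _ → 1))
            (∑-cong (allFin m) λ c → trans (∑-const (map (slot τ₀ c) (elements (at c))) 1)
              (trans (*-identityʳ _) (trans (length-map (slot τ₀ c) (elements (at c))) (length-elements (at c)))))))))
        where
        l : List (Fin N)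
        l = concatMap (λ c → map (slot τ₀ c) (elements (at c))) (allFin m)
        sub : T ⊆ fromList l
        sub {i} i∈ with ∈-copy⁻ τ₀ (T⊆ i∈)
        ... | c , x , x∈ , refl = ∈-fromList⁺ l (∈-concatMap⁺ (λ c → map (slot τ₀ c) (elements (at c)))
                (L.lose (∈-allFin c) (∈-map⁺ (slot τ₀ c) (∈-elements⁺ (at c) (∈-comprehend⁺ (at? c) (x∈ , i∈))))))

      -- `dense` is applied to `at c` at each of the `h` touched locations; the others contribute 1
      -- on both sides.
      location-bound : (4 ^ s) ^ h * B ^ ∑ (allFin m) (λ c → ∣ at c ∣) * length labellings ≤ (m ^ s) ^ h
      location-bound = ≤-trans (≤-reflexive (sym (trans (∏-* (λ c → (4 ^ s) ^ ind c * B ^ ∣ at c ∣) (λ c → length (labels c)))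
            (cong₂ _*_ (trans (∏-* (λ c → (4 ^ s) ^ ind c) (λ c → B ^ ∣ at c ∣)) (cong₂ _*_ (∏-ind (4 ^ s)) (∏-^ B m (λ c → ∣ at c ∣)))) (sym (length-choices labels))))))
          (≤-trans (∏-mono each) (≤-reflexive (∏-ind (m ^ s))))
        where
        ind : Fin m → ℕ
        ind c = 𝟙 (nonempty? (at c))
        ∏-ind : ∀ z → ∏ (λ c → z ^ ind c) ≡ z ^ h
        ∏-ind z = trans (∏-^ z m ind) (cong (z ^_) (trans (∑-cong (allFin m) λ c → 𝟙-cong (nonempty? (at c)) (c ∈? C)
          (∈-comprehend⁺ (λ c → nonempty? (at c))) (∈-comprehend⁻ (λ c → nonempty? (at c)))) (sym (∣∣-∑ C))))
        each : ∀ c → (4 ^ s) ^ ind c * B ^ ∣ at c ∣ * length (labels c) ≤ (m ^ s) ^ ind c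
        each c with nonempty? (at c)
        ... | yes ne = begin
            4 ^ s * 1 * B ^ ∣ at c ∣ * length (fibre-constant (rep (at c)) c)
              ≡⟨ cong₂ (λ a b → a * B ^ ∣ at c ∣ * b) (*-identityʳ (4 ^ s)) (length-fibre-constant (rep (at c)) c) ⟩
            4 ^ s * B ^ ∣ at c ∣ * m ^ image-size (rep (at c)) ≤⟨ dense (at c) (λ x∈ → proj₁ (∈-comprehend⁻ (at? c) x∈)) ne ⟩
            m ^ s ≡⟨ *-identityʳ (m ^ s) ⟨
            m ^ s * 1 ∎
          where open ≤-Reasoning
        ... | no em = ≤-reflexive (trans (*-identityʳ _) (trans (*-identityˡ _) (cong (B ^_)
            (trans (cong ∣_∣ (Empty-unique em)) (∣⊥∣≡0 e)))))

      -- A labelling leaves at most `(m ∸ h) !` completions in each of the `s` classes. The factor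
      -- `(4 ^ s) ^ h` from `location-bound` cancels what `falling-factorial` costs in comparing
      -- `(m ^ h * (m ∸ h) !) ^ s` with `(m !) ^ s`.
      copies-containing : ∑ families (λ τ → 𝟙 (T ⊆? copy τ)) * B ^ ∑ (allFin m) (λ c → ∣ at c ∣) ≤ (m !) ^ s
      copies-containing = *-cancelˡ-≤ ((4 ^ s) ^ h) ⦃ m^n≢0 (4 ^ s) h ⦃ m^n≢0 4 s ⦄ ⦄ (begin
        (4 ^ s) ^ h * (∑ families (λ τ → 𝟙 (T ⊆? copy τ)) * b) ≤⟨ *-monoʳ-≤ ((4 ^ s) ^ h) (*-monoˡ-≤ b count-copies) ⟩
        (4 ^ s) ^ h * (length labellings * ((m ∸ h) !) ^ s * b) ≡⟨ lem₁ ((4 ^ s) ^ h) (length labellings) (((m ∸ h) !) ^ s) b ⟩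
        (4 ^ s) ^ h * b * length labellings * ((m ∸ h) !) ^ s ≤⟨ *-monoˡ-≤ (((m ∸ h) !) ^ s) location-bound ⟩
        (m ^ s) ^ h * ((m ∸ h) !) ^ s ≡⟨ cong (_* ((m ∸ h) !) ^ s) (exchange m) ⟩
        (m ^ h) ^ s * ((m ∸ h) !) ^ s ≡⟨ ^-distribʳ-* s (m ^ h) ((m ∸ h) !) ⟨
        (m ^ h * (m ∸ h) !) ^ s ≤⟨ ^-monoˡ-≤ s (falling-factorial m h (∣p∣≤n C)) ⟩
        (4 ^ h * m !) ^ s ≡⟨ ^-distribʳ-* s (4 ^ h) (m !) ⟩
        (4 ^ h) ^ s * (m !) ^ s ≡⟨ cong (_* (m !) ^ s) (exchange 4) ⟨
        (4 ^ s) ^ h * (m !) ^ s ∎)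
        where
        open ≤-Reasoning
        b = B ^ ∑ (allFin m) (λ c → ∣ at c ∣)
        exchange : ∀ z → (z ^ s) ^ h ≡ (z ^ h) ^ s
        exchange z = trans (^-*-assoc z s h) (trans (cong (z ^_) (*-comm s h)) (sym (^-*-assoc z h s)))
        lem₁ : ∀ a l f b → a * (l * f * b) ≡ a * b * l * f
        lem₁ = solve-∀

    template-spread : 1 ≤ B → ∀ T → ∑ copies (λ S → 𝟙 (T ⊆? S)) * B ^ ∣ T ∣ ≤ length copies
    template-spread B≥1 T with any? (λ S → T ⊆? S) copies
    ... | no none = ≤-trans (≤-reflexive (cong (_* B ^ ∣ T ∣) (trans (∑-cong-∈ copies λ {S} S∈ → 𝟙-no (T ⊆? S) λ T⊆ →
            none (L.lose S∈ λ {x} → T⊆ {x})) (∑-zero copies)))) z≤n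
    ... | yes some with L.find some
    ...   | S , S∈ , T⊆ with ∈-map⁻ copy S∈
    ...     | τ₀ , τ₀∈ , refl = begin
        ∑ copies (λ S → 𝟙 (T ⊆? S)) * B ^ ∣ T ∣ ≡⟨ cong (_* B ^ ∣ T ∣) (∑-map copy families _) ⟩
        ∑ families (λ τ → 𝟙 (T ⊆? copy τ)) * B ^ ∣ T ∣
          ≤⟨ *-monoʳ-≤ (∑ families (λ τ → 𝟙 (T ⊆? copy τ))) (^-monoʳ-≤ B ⦃ >-nonZero B≥1 ⦄ (∣T∣≤ T τ₀ τ₀∈ (λ {x} → T⊆ {x}))) ⟩
        ∑ families (λ τ → 𝟙 (T ⊆? copy τ)) * B ^ ∑ (allFin m) (λ c → ∣ at T τ₀ τ₀∈ (λ {x} → T⊆ {x}) c ∣) ≤⟨ copies-containing T τ₀ τ₀∈ (λ {x} → T⊆ {x}) ⟩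
        (m !) ^ s ≡⟨ trans (length-map copy families) length-families ⟨
        length copies ∎
      where open ≤-Reasoning

-- Tight subgraphs of F

∑-lookup : {A : Set} (xs : List A) (f : A → ℕ) → ∑ xs f ≡ ∑ (allFin (length xs)) (f ∘ lookup xs)
∑-lookup [] f = refl
∑-lookup (x ∷ xs) f = trans (cong (f x +_) (∑-lookup xs f)) (sym (∑-allFin-suc (length xs) (f ∘ lookup (x ∷ xs))))

∑-𝟙-collapse : {n : ℕ} (i : Fin n) (c : ℕ) → ∑ (allFin n) (λ l → 𝟙 (i FinP.≟ l) * c) ≤ c
∑-𝟙-collapse {n} i c = ≤-trans (≤-reflexive (trans (∑-*ʳ (allFin n) c _) (cong (_* c) (∑-cong (allFin n) λ l → 𝟙-cong (i FinP.≟ l) (l FinP.≟ i) sym sym))))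
  (≤-trans (*-monoˡ-≤ c (∑-𝟙-≟ FinP._≟_ i (allFin n) (UniqueP.allFin⁺ n))) (≤-reflexive (*-identityˡ c)))

two-elements : {n : ℕ} (P : Subset n) → 2 ≤ ∣ P ∣ → ∃ λ a → ∃ λ b → a ∈ P × b ∈ P × a ≢ b
two-elements P le with elements P | length-elements P | elements-unique P | (λ {i} → ∈-elements⁻ P {i})
... | [] | eq | _ | _ = ⊥-elim (<⇒≱ le (≤-trans (≤-reflexive (sym eq)) z≤n))
... | a ∷ [] | eq | _ | _ = ⊥-elim (<⇒≱ le (≤-reflexive (sym eq)))
... | a ∷ b ∷ l | eq | (a≢b ∷ _) ∷ _ | mem = a , b , mem (here refl) , mem (there (here refl)) , a≢b

distinct⇒2≤ : {n : ℕ} (P : Subset n) {a b : Fin n} → a ∈ P → b ∈ P → a ≢ b → 2 ≤ ∣ P ∣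
distinct⇒2≤ P {a} {b} a∈ b∈ a≢b = ≤-trans (unique-⊆-length FinP._≟_ (a ∷ b ∷ []) (elements P) ((a≢b ∷ []) ∷ [] ∷ []) mem) (≤-reflexive (length-elements P))
  where
  mem : ∀ {w} → w L.∈ (a ∷ b ∷ []) → w L.∈ elements P
  mem (here refl) = ∈-elements⁺ P a∈
  mem (there (here refl)) = ∈-elements⁺ P b∈

nonempty⇒1≤ : {n : ℕ} (P : Subset n) {a : Fin n} → a ∈ P → 1 ≤ ∣ P ∣
nonempty⇒1≤ P {a} a∈ = ≤-trans (≤-reflexive (sym (∣⁅x⁆∣≡1 a))) (p⊆q⇒∣p∣≤∣q∣ sub′)
  where
  sub′ : ⁅ a ⁆ ⊆ P
  sub′ x∈ rewrite x∈⁅y⁆⇒x≡y a x∈ = a∈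

image : {n s : ℕ} → (Fin n → Fin s) → Subset s
image r = comprehend (λ l → FinP.any? (λ l′ → r l′ FinP.≟ l))

∈-image : {n s : ℕ} (r : Fin n → Fin s) (i : Fin n) → r i ∈ image r
∈-image r i = ∈-comprehend⁺ (λ l → FinP.any? (λ l′ → r l′ FinP.≟ l)) (i , refl)

∈-image⁻ : {n s : ℕ} (r : Fin n → Fin s) {l : Fin s} → l ∈ image r → ∃ λ i → r i ≡ l
∈-image⁻ r = ∈-comprehend⁻ (λ l → FinP.any? (λ l′ → r l′ FinP.≟ l))

∣image∣ : {s : ℕ} (r : Fin s → Fin s) → ∣ image r ∣ ≡ image-size r
∣image∣ {s} r = trans (∣∣-∑ (image r)) (∑-cong (allFin s) λ l → 𝟙-cong (l ∈? image r) (FinP.any? (λ l′ → r l′ FinP.≟ l))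
  (∈-image⁻ r) (∈-comprehend⁺ (λ l → FinP.any? (λ l′ → r l′ FinP.≟ l))))

module UnionFind {e s : ℕ} (src tgt : Fin e → Fin s) where

  merge : List (Fin e) → Fin s → Fin s
  merge [] l = l
  merge (x ∷ xs) l = if does (merge xs l FinP.≟ merge xs (src x)) then merge xs (tgt x) else merge xs l

  merge-fix : (xs : List (Fin e)) {A : Set} (f : Fin s → A) → (∀ {x} → x L.∈ xs → f (src x) ≡ f (tgt x)) → ∀ l → f (merge xs l) ≡ f l
  merge-fix [] f con l = refl
  merge-fix (x ∷ xs) f con l with merge xs l FinP.≟ merge xs (src x)
  ... | no _ = merge-fix xs f (con ∘ there) l
  ... | yes eq = trans (merge-fix xs f (con ∘ there) (tgt x)) (trans (sym (con (here refl)))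
      (trans (sym (merge-fix xs f (con ∘ there) (src x))) (trans (cong f (sym eq)) (merge-fix xs f (con ∘ there) l))))

  merge-edge : (xs : List (Fin e)) {x : Fin e} → x L.∈ xs → merge xs (src x) ≡ merge xs (tgt x)
  merge-edge (x ∷ xs) (here refl) with merge xs (src x) FinP.≟ merge xs (src x) | merge xs (tgt x) FinP.≟ merge xs (src x)
  ... | yes _ | yes _ = refl
  ... | yes _ | no _ = refl
  ... | no ne | _ = ⊥-elim (ne refl)
  merge-edge (x ∷ xs) {y} (there y∈) = cong (λ z → if does (z FinP.≟ merge xs (src x)) then merge xs (tgt x) else z) (merge-edge xs y∈)

  rep : Subset e → Fin s → Fin s
  rep X = merge (elements X)

  rep-fix : ∀ X {A : Set} (f : Fin s → A) → (∀ x → x ∈ X → f (src x) ≡ f (tgt x)) → ∀ l → f (rep X l) ≡ f l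
  rep-fix X f con = merge-fix (elements X) f (λ {x} x∈ → con x (∈-elements⁻ X x∈))

  rep-edge : ∀ X {x} → x ∈ X → rep X (src x) ≡ rep X (tgt x)
  rep-edge X x∈ = merge-edge (elements X) (∈-elements⁺ X x∈)

  block : Subset e → Fin s → Subset s
  block X b = comprehend (λ l → rep X l FinP.≟ b)

  edgesAt? : ∀ X b x → Dec (x ∈ X × rep X (src x) ≡ b)
  edgesAt? X b x = (x ∈? X) ×-dec (rep X (src x) FinP.≟ b)

  edgesAt : Subset e → Fin s → ℕ
  edgesAt X b = ∑ (allFin e) (λ x → 𝟙 (edgesAt? X b x))

  -- The blocks are disjoint and each edge of `X` lies in one of them, so inequalities for the
  -- blocks add up. The image of `rep X` contributes one `p` per component, and `extra` carries any
  -- slack along.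
  ∑-blocks : (X : Subset e) (p q : ℕ) (extra : Fin s → ℕ) →
    (∀ b → q * edgesAt X b + p * 𝟙 (b ∈? image (rep X)) + extra b ≤ p * ∣ block X b ∣) →
    q * ∣ X ∣ + p * image-size (rep X) + ∑ (allFin s) extra ≤ p * s
  ∑-blocks X p q extra le = begin
    q * ∣ X ∣ + p * image-size (rep X) + ∑ (allFin s) extra
      ≤⟨ +-monoˡ-≤ (∑ (allFin s) extra) (+-mono-≤ (*-monoʳ-≤ q edges) (≤-reflexive (cong (p *_) (trans (sym (∣image∣ (rep X))) (∣∣-∑ (image (rep X))))))) ⟩
    q * ∑ (allFin s) (edgesAt X) + p * ∑ (allFin s) (λ b → 𝟙 (b ∈? image (rep X))) + ∑ (allFin s) extra
      ≡⟨ cong (_+ ∑ (allFin s) extra) (cong₂ _+_ (∑-*ˡ (allFin s) q _) (∑-*ˡ (allFin s) p _)) ⟨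
    ∑ (allFin s) (λ b → q * edgesAt X b) + ∑ (allFin s) (λ b → p * 𝟙 (b ∈? image (rep X))) + ∑ (allFin s) extra
      ≡⟨ trans (∑-+ (allFin s) _ _) (cong (_+ ∑ (allFin s) extra) (∑-+ (allFin s) _ _)) ⟨
    ∑ (allFin s) (λ b → q * edgesAt X b + p * 𝟙 (b ∈? image (rep X)) + extra b) ≤⟨ ∑-mono (allFin s) le ⟩
    ∑ (allFin s) (λ b → p * ∣ block X b ∣) ≡⟨ ∑-*ˡ (allFin s) p _ ⟩
    p * ∑ (allFin s) (λ b → ∣ block X b ∣) ≤⟨ *-monoʳ-≤ p vertices ⟩
    p * s ∎
    where
    open ≤-Reasoning
    edges : ∣ X ∣ ≤ ∑ (allFin s) (edgesAt X)
    edges = ≤-trans (≤-reflexive (∣∣-∑ X)) (≤-trans (∑-mono (allFin e) λ x → 𝟙-elim (x ∈? X) λ x∈ →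
        ≤-trans (≤-reflexive (sym (𝟙-yes (edgesAt? X (rep X (src x)) x) (x∈ , refl)))) (∑-term (allFin s) (λ b → 𝟙 (edgesAt? X b x)) (∈-allFin (rep X (src x)))))
      (≤-reflexive (∑-swap (allFin e) (allFin s) _)))
    vertices : ∑ (allFin s) (λ b → ∣ block X b ∣) ≤ s
    vertices = begin
      ∑ (allFin s) (λ b → ∣ block X b ∣) ≡⟨ ∑-cong (allFin s) (λ b → trans (∣∣-∑ (block X b)) (∑-cong (allFin s) λ l →
          𝟙-cong (l ∈? block X b) (rep X l FinP.≟ b) (∈-comprehend⁻ (λ l → rep X l FinP.≟ b)) (∈-comprehend⁺ (λ l → rep X l FinP.≟ b)))) ⟩
      ∑ (allFin s) (λ b → ∑ (allFin s) (λ l → 𝟙 (rep X l FinP.≟ b))) ≡⟨ ∑-swap (allFin s) (allFin s) _ ⟩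
      ∑ (allFin s) (λ l → ∑ (allFin s) (λ b → 𝟙 (rep X l FinP.≟ b))) ≤⟨ ∑-mono (allFin s) (λ l → ≤-trans
          (≤-reflexive (∑-cong (allFin s) λ b → sym (*-identityʳ _))) (∑-𝟙-collapse (rep X l) 1)) ⟩
      ∑ (allFin s) (λ l → 1) ≡⟨ trans (∑-const (allFin s) 1) (trans (*-identityʳ _) (length-tabulate {n = s} id)) ⟩
      s ∎

module Structure (F : Graph) where

  e : ℕ
  e = length (E F)

  src tgt : Fin e → Fin (k F)
  src x = proj₁ (lookup (E F) x)
  tgt x = proj₂ (lookup (E F) x)

  src<tgt : ∀ x → src x Fin.< tgt x
  src<tgt x = AllP.lookup (ordered F) (∈-lookup {xs = E F} x)

  src≢tgt : ∀ x → src x ≢ tgt x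
  src≢tgt x eq = <-irrefl (cong Fin.toℕ eq) (src<tgt x)

  inside? : (V : Subset (k F)) (x : Fin e) → Dec (src x ∈ V × tgt x ∈ V)
  inside? V x = (src x ∈? V) ×-dec (tgt x ∈? V)

  edgesIn : Subset (k F) → ℕ
  edgesIn V = ∑ (allFin e) (λ x → 𝟙 (inside? V x))

  induced : Subset (k F) → SubG F
  induced V = record
    { S = V
    ; E' = filter in? (E F)
    ; sub = filter-⊆ in? (E F)
    ; ends = all-filter in? (E F)
    }
    where
    in? : (x : Fin (k F) × Fin (k F)) → Dec (proj₁ x ∈ V × proj₂ x ∈ V)
    in? x = (proj₁ x ∈? V) ×-dec (proj₂ x ∈? V)

  length-induced : ∀ V → length (E' (induced V)) ≡ edgesIn V
  length-induced V = trans (length-filter-∑ (λ x → (proj₁ x ∈? V) ×-dec (proj₂ x ∈? V)) (E F)) (∑-lookup (E F) _)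

  module WithDensity (unbalanced : ¬ VertexBalanced F) (p q : ℕ) (1≤q : 1 ≤ q) (dstar : IsDStar F p q) where

    private instance
      q≢0 : NonZero q
      q≢0 = >-nonZero 1≤q

    sparse : ∀ V → 2 ≤ ∣ V ∣ → q * edgesIn V ≤ p * (∣ V ∣ ∸ 1)
    sparse V le = ≤-trans (≤-reflexive (trans (*-comm q _) (cong (_* q) (sym (length-induced V))))) (proj₂ dstar (induced V) le)

    sparse′ : ∀ V → 2 ≤ ∣ V ∣ → q * edgesIn V + p ≤ p * ∣ V ∣
    sparse′ V le = ≤-trans (+-monoˡ-≤ p (sparse V le)) (≤-reflexive (trans (trans (+-comm _ p) (sym (*-suc p (∣ V ∣ ∸ 1)))) (cong (p *_) (m+[n∸m]≡n {1} (<⇒≤ le)))))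

    Tight : Fin (k F) → Subset (k F) → Set
    Tight v V = v ∈ V × 2 ≤ ∣ V ∣ × p * (∣ V ∣ ∸ 1) ≤ q * edgesIn V

    tight? : ∀ v V → Dec (Tight v V)
    tight? v V = (v ∈? V) ×-dec ((2 ≤? ∣ V ∣) ×-dec (p * (∣ V ∣ ∸ 1) ≤? q * edgesIn V))

    -- `VertexBalanced` ranges over all fractions that represent `d*`. Two of them are proportional
    -- because each is attained and each is an upper bound.
    same-ratio : ∀ p′ q′ → 1 ≤ q′ → IsDStar F p′ q′ → p′ * q ≡ p * q′
    same-ratio p′ q′ 1≤q′ dstar′ = ≤-antisym (half p′ q′ p q dstar′ dstar) (half p q p′ q′ dstar dstar′)
      where
      half : ∀ p q p′ q′ → IsDStar F p q → IsDStar F p′ q′ → p * q′ ≤ p′ * q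
      half p q p′ q′ ((H , 2≤ , eq) , _) (_ , le) = *-cancelʳ-≤ _ _ (∣ SubG.S H ∣ ∸ 1) ⦃ >-nonZero (∸-monoˡ-≤ 1 2≤) ⦄
        (≤-trans (≤-reflexive (trans (lem₁ p q′ v) (trans (cong (_* q′) (sym eq)) (lem₁ (length (SubG.E' H)) q q′))))
          (≤-trans (*-monoˡ-≤ q (le H 2≤)) (≤-reflexive (lem₁ p′ v q))))
        where
        v = ∣ SubG.S H ∣ ∸ 1
        lem₁ : ∀ a b c → a * b * c ≡ a * c * b
        lem₁ = solve-∀

    opaque
      -- If every vertex lay in a tight set, `F` would be vertex-balanced. Tightness of some subset
      -- is decidable, so an exceptional vertex can be extracted.
      loose-vertex : ∃ λ u → ¬ (∃ λ V → Tight u V)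
      loose-vertex = FinP.¬∀⟶∃¬ (k F) _ (λ v → anySubset? (tight? v)) λ all → unbalanced λ p′ q′ 1≤q′ dstar′ v → balanced all p′ q′ 1≤q′ dstar′ v
        where
        balanced : (∀ v → ∃ λ V → Tight v V) → ∀ p′ q′ → 1 ≤ q′ → IsDStar F p′ q′ → ∀ v → IsDStarAt F v p′ q′
        balanced all p′ q′ 1≤q′ dstar′ v with all v
        ... | V , v∈ , 2≤ , tight = (induced V , 2≤ , v∈ , trans (cong (_* q′) (length-induced V)) (*-cancelʳ-≡ _ _ q (begin
            edgesIn V * q′ * q ≡⟨ lem₁ (edgesIn V) q′ q ⟩
            q * edgesIn V * q′ ≡⟨ cong (_* q′) (≤-antisym (sparse V 2≤) tight) ⟩
            p * (∣ V ∣ ∸ 1) * q′ ≡⟨ lem₂ p (∣ V ∣ ∸ 1) q′ ⟩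
            p * q′ * (∣ V ∣ ∸ 1) ≡⟨ cong (_* (∣ V ∣ ∸ 1)) (same-ratio p′ q′ 1≤q′ dstar′) ⟨
            p′ * q * (∣ V ∣ ∸ 1) ≡⟨ lem₂ p′ q (∣ V ∣ ∸ 1) ⟩
            p′ * (∣ V ∣ ∸ 1) * q ∎))) , λ H 2≤H _ → proj₂ dstar′ H 2≤H
          where
          open ≡-Reasoning
          lem₁ : ∀ a b c → a * b * c ≡ c * a * b
          lem₁ = solve-∀
          lem₂ : ∀ a b c → a * b * c ≡ a * c * b
          lem₂ = solve-∀

    u : Fin (k F)
    u = proj₁ loose-vertex

    loose : ∀ V → u ∈ V → 2 ≤ ∣ V ∣ → q * edgesIn V < p * (∣ V ∣ ∸ 1)
    loose V u∈ 2≤ = ≰⇒> λ tight → proj₂ loose-vertex (V , u∈ , 2≤ , tight)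

    2≤k : 2 ≤ k F
    2≤k = ≤-trans (proj₁ (proj₂ (proj₁ dstar))) (∣p∣≤n (SubG.S (proj₁ (proj₁ dstar))))

    1≤p : 1 ≤ p
    1≤p = positive p (loose ⊤ ∈⊤ (≤-trans 2≤k (≤-reflexive (sym (∣⊤∣≡n (k F))))))
      where
      positive : ∀ p {a b} → a < p * b → 1 ≤ p
      positive (suc _) _ = s≤s z≤n

    -- `d* ≥ 1`: a positive density requires an edge, and a single edge has density 1.
    q≤p : q ≤ p
    q≤p = edge-bound some-edge
      where
      some-edge : Fin e
      some-edge with proj₁ dstar
      ... | H , 2≤ , eq = nonempty (SubG.E' H) (SubG.sub H) (>-nonZero⁻¹ (length (SubG.E' H)) ⦃ m*n≢0⇒m≢0 (length (SubG.E' H)) ⦃ >-nonZero (≤-trans (*-mono-≤ 1≤p (∸-monoˡ-≤ 1 2≤)) (≤-reflexive (sym eq))) ⦄ ⦄)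
        where
        nonempty : ∀ l → l Sublist.⊆ E F → 1 ≤ length l → Fin e
        nonempty (y ∷ l) sub′ _ = Any.index {P = y ≡_} (Any-resp-⊆ sub′ (here refl))
      edge-bound : Fin e → q ≤ p
      edge-bound x = begin
        q ≡⟨ *-identityʳ q ⟨
        q * 1 ≤⟨ *-monoʳ-≤ q (≤-trans (≤-reflexive (sym (𝟙-yes (inside? V x) (src∈ , tgt∈)))) (∑-term (allFin e) (λ x → 𝟙 (inside? V x)) (∈-allFin x))) ⟩
        q * edgesIn V ≤⟨ sparse V (distinct⇒2≤ V src∈ tgt∈ (src≢tgt x)) ⟩
        p * (∣ V ∣ ∸ 1) ≤⟨ *-monoʳ-≤ p (∸-monoˡ-≤ 1 (≤-trans (∣∪∣≤ ⁅ src x ⁆ ⁅ tgt x ⁆) (≤-reflexive (cong₂ _+_ (∣⁅x⁆∣≡1 (src x)) (∣⁅x⁆∣≡1 (tgt x)))))) ⟩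
        p * 1 ≡⟨ *-identityʳ p ⟩
        p ∎
        where
        open ≤-Reasoning
        V = ⁅ src x ⁆ ∪ ⁅ tgt x ⁆
        src∈ : src x ∈ V
        src∈ = p⊆p∪q ⁅ tgt x ⁆ (x∈⁅x⁆ (src x))
        tgt∈ : tgt x ∈ V
        tgt∈ = q⊆p∪q ⁅ src x ⁆ ⁅ tgt x ⁆ (x∈⁅x⁆ (tgt x))

    pre : (Fin (k F) → Fin (k F)) → Subset (k F) → Subset (k F)
    pre g B = comprehend (λ v → g v ∈? B)

    -- Written with `+ p` instead of `∸ 1`, the condition "density at least `d*`" holds trivially
    -- for single vertices and for the empty classes of labels not in use.
    ClassesTight : (Fin (k F) → Fin (k F)) → Set
    ClassesTight g = ∀ l → p * ∣ pre g ⁅ l ⁆ ∣ ≤ q * edgesIn (pre g ⁅ l ⁆) + p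

    Violates : (Fin (k F) → Fin (k F)) → Subset (k F) → Set
    Violates g B = 2 ≤ ∣ B ∩ image g ∣ × p * ∣ pre g B ∣ ≤ q * edgesIn (pre g B) + p

    violates? : ∀ g B → Dec (Violates g B)
    violates? g B = (2 ≤? ∣ B ∩ image g ∣) ×-dec (p * ∣ pre g B ∣ ≤? q * edgesIn (pre g B) + p)

    -- Merging a violating union of classes produces one tight class and shrinks the image of the labelling.
    maximal-labelling : ∀ n g → ∣ image g ∣ ≤ n → ClassesTight g →
      ∃ λ g′ → ClassesTight g′ × (∀ B → ¬ Violates g′ B)
    maximal-labelling n g size tight with anySubset? (violates? g)
    ... | no none = g , tight , λ B v → none (B , v)
    ... | yes (B , 2≤ , dense) with two-elements (B ∩ image g) 2≤
    ...   | l₀ , l₁ , l₀∈ , l₁∈ , l₀≢l₁ = continue n size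
      where
      l₀∈B = proj₁ (x∈p∩q⁻ B (image g) l₀∈)
      l₁∈B = proj₁ (x∈p∩q⁻ B (image g) l₁∈)
      g′ : Fin (k F) → Fin (k F)
      g′ v = if does (g v ∈? B) then l₀ else g v
      smaller : image g′ ⊂ image g
      smaller = sub′ , l₁ , proj₂ (x∈p∩q⁻ B (image g) l₁∈) , l₁∉
        where
        sub′ : image g′ ⊆ image g
        sub′ l∈ with ∈-image⁻ g′ l∈
        ... | v , refl with g v ∈? B
        ...   | yes _ = proj₂ (x∈p∩q⁻ B (image g) l₀∈)
        ...   | no _ = ∈-image g v
        l₁∉ : l₁ ∉ image g′
        l₁∉ l∈ with ∈-image⁻ g′ l∈
        ... | v , eq with g v ∈? B
        ...   | yes _ = l₀≢l₁ eq
        ...   | no gv∉ = gv∉ (subst (_∈ B) (sym eq) l₁∈B)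
      tight′ : ClassesTight g′
      tight′ l with l FinP.≟ l₀
      ... | yes refl = subst (λ V → p * ∣ V ∣ ≤ q * edgesIn V + p) (⊆-antisym there′ back) dense
        where
        there′ : pre g B ⊆ pre g′ ⁅ l ⁆
        there′ {v} v∈ = ∈-comprehend⁺ (λ v → g′ v ∈? ⁅ l ⁆) (subst (_∈ ⁅ l ⁆) (sym (cong (if_then l else g v)
          (dec-true (g v ∈? B) (∈-comprehend⁻ (λ v → g v ∈? B) v∈)))) (x∈⁅x⁆ l))
        back : pre g′ ⁅ l ⁆ ⊆ pre g B
        back {v} v∈ with x∈⁅y⁆⇒x≡y l (∈-comprehend⁻ (λ v → g′ v ∈? ⁅ l ⁆) v∈)
        ... | eq with g v ∈? B
        ...   | yes gv∈ = ∈-comprehend⁺ (λ v → g v ∈? B) gv∈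
        ...   | no gv∉ = ⊥-elim (gv∉ (subst (_∈ B) (sym eq) l₀∈B))
      ... | no l≢l₀ with l ∈? B
      ...   | no l∉ = subst (λ V → p * ∣ V ∣ ≤ q * edgesIn V + p) (⊆-antisym there′ back) (tight l)
        where
        there′ : pre g ⁅ l ⁆ ⊆ pre g′ ⁅ l ⁆
        there′ {v} v∈ with x∈⁅y⁆⇒x≡y l (∈-comprehend⁻ (λ v → g v ∈? ⁅ l ⁆) v∈)
        ... | eq = ∈-comprehend⁺ (λ v → g′ v ∈? ⁅ l ⁆) (subst (_∈ ⁅ l ⁆) (sym (trans (cong (if_then l₀ else g v)
                     (dec-false (g v ∈? B) λ gv∈ → l∉ (subst (_∈ B) eq gv∈))) eq)) (x∈⁅x⁆ l))
        back : pre g′ ⁅ l ⁆ ⊆ pre g ⁅ l ⁆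
        back {v} v∈ with x∈⁅y⁆⇒x≡y l (∈-comprehend⁻ (λ v → g′ v ∈? ⁅ l ⁆) v∈)
        ... | eq with g v ∈? B
        ...   | yes _ = ⊥-elim (l≢l₀ (sym eq))
        ...   | no _ = ∈-comprehend⁺ (λ v → g v ∈? ⁅ l ⁆) (subst (_∈ ⁅ l ⁆) (sym eq) (x∈⁅x⁆ l))
      -- No vertex keeps a label of `B` other than `l₀`, so this class is empty.
      ...   | yes l∈ = ≤-trans (≤-reflexive (trans (cong (λ V → p * ∣ V ∣) (Empty-unique empty)) (trans (cong (p *_) (∣⊥∣≡0 (k F))) (*-zeroʳ p)))) z≤n
        where
        empty : Empty (pre g′ ⁅ l ⁆)
        empty (v , v∈) with x∈⁅y⁆⇒x≡y l (∈-comprehend⁻ (λ v → g′ v ∈? ⁅ l ⁆) v∈)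
        ... | eq with g v ∈? B
        ...   | yes _ = l≢l₀ (sym eq)
        ...   | no gv∉ = gv∉ (subst (_∈ B) (sym eq) l∈)
      continue : ∀ n → ∣ image g ∣ ≤ n → ∃ λ g′ → ClassesTight g′ × (∀ B → ¬ Violates g′ B)
      continue zero size = ⊥-elim (∣p∣≡0⇒∉ (image g) size (∈-image g u))
      continue (suc n) size = maximal-labelling n g′ (≤-pred (≤-trans (p⊂q⇒∣p∣<∣q∣ smaller) size)) tight′

    opaque
      labelling : ∃ λ g → ClassesTight g × (∀ B → ¬ Violates g B)
      labelling = maximal-labelling (k F) id (∣p∣≤n (image id)) λ l →
        ≤-trans (≤-trans (*-monoʳ-≤ p (≤-trans (p⊆q⇒∣p∣≤∣q∣ {q = ⁅ l ⁆} (∈-comprehend⁻ (λ v → v ∈? ⁅ l ⁆))) (≤-reflexive (∣⁅x⁆∣≡1 l)))) (≤-reflexive (*-identityʳ p))) (m≤n+m p _)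

    g : Fin (k F) → Fin (k F)
    g = proj₁ labelling

    classes-tight : ClassesTight g
    classes-tight = proj₁ (proj₂ labelling)

    -- By maximality, two or more classes together never reach density `d*`. Over the integers
    -- strictness is a gap of at least 1: this is the `+ 1` of `outer-rank` and the source of the
    -- polynomial slack.
    unions-sparse : ∀ B → 2 ≤ ∣ B ∩ image g ∣ → q * edgesIn (pre g B) + p < p * ∣ pre g B ∣
    unions-sparse B 2≤ = ≰⇒> λ le → proj₂ (proj₂ labelling) B (2≤ , le)

    inner? : ∀ x → Dec (g (src x) ≡ g (tgt x))
    inner? x = g (src x) FinP.≟ g (tgt x)

    inner outer : Subset e
    inner = comprehend inner?
    outer = comprehend (λ x → ¬? (inner? x))

    -- The class of `u` meets the tightness bound, so a second vertex in it would put `u` into a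
    -- subgraph of density `d*`.
    u-alone : ∀ v → g v ≡ g u → v ≡ u
    u-alone v eq with v FinP.≟ u
    ... | yes v≡u = v≡u
    ... | no v≢u = ⊥-elim (<⇒≱ (loose V u∈ 2≤) (+-cancelʳ-≤ p _ _ (≤-trans (≤-reflexive shift) (classes-tight (g u)))))
      where
      V = pre g ⁅ g u ⁆
      u∈ : u ∈ V
      u∈ = ∈-comprehend⁺ (λ v → g v ∈? ⁅ g u ⁆) (x∈⁅x⁆ (g u))
      v∈ : v ∈ V
      v∈ = ∈-comprehend⁺ (λ v → g v ∈? ⁅ g u ⁆) (subst (_∈ ⁅ g u ⁆) (sym eq) (x∈⁅x⁆ (g u)))
      2≤ : 2 ≤ ∣ V ∣
      2≤ = distinct⇒2≤ V v∈ u∈ v≢u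
      shift : p * (∣ V ∣ ∸ 1) + p ≡ p * ∣ V ∣
      shift = trans (+-comm _ p) (trans (sym (*-suc p (∣ V ∣ ∸ 1))) (cong (p *_) (m+[n∸m]≡n {1} (<⇒≤ 2≤))))

    inner-avoids-u : ∀ {x} → x ∈ inner → src x ≢ u × tgt x ≢ u
    inner-avoids-u {x} x∈ = (λ eq → src≢tgt x (trans eq (sym (u-alone (tgt x) (trans (sym same) (cong g eq))))))
      , (λ eq → src≢tgt x (trans (u-alone (src x) (trans same (cong g eq))) (sym eq)))
      where
      same : g (src x) ≡ g (tgt x)
      same = ∈-comprehend⁻ inner? x∈

    module Inner = UnionFind src tgt
    module Outer = UnionFind (g ∘ src) (g ∘ tgt)

    -- A component with two or more vertices obeys `sparse′`; a smaller block contains no edge,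
    -- since the ends of an edge are distinct. There is no slack here, so the density can match the
    -- threshold only up to a constant.
    inner-rank : ∀ X → X ⊆ inner → q * ∣ X ∣ + p * image-size (Inner.rep X) ≤ p * k F
    inner-rank X X⊆ = ≤-trans (m≤m+n _ _) (Inner.∑-blocks X p q (λ _ → 0) λ b → ≤-trans (≤-reflexive (+-identityʳ _)) (bound b))
      where
      bound : ∀ b → q * Inner.edgesAt X b + p * 𝟙 (b ∈? image (Inner.rep X)) ≤ p * ∣ Inner.block X b ∣
      bound b with 2 ≤? ∣ Inner.block X b ∣
      ... | yes 2≤ = ≤-trans (+-mono-≤ (*-monoʳ-≤ q (∑-mono (allFin e) λ x → 𝟙-mono (Inner.edgesAt? X b x) (inside? V x) λ (x∈ , eq) →
              ∈-comprehend⁺ (λ l → Inner.rep X l FinP.≟ b) eq , ∈-comprehend⁺ (λ l → Inner.rep X l FinP.≟ b) (trans (sym (Inner.rep-edge X x∈)) eq)))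
              (≤-trans (*-monoʳ-≤ p (𝟙≤1 (b ∈? image (Inner.rep X)))) (≤-reflexive (*-identityʳ p)))) (sparse′ V 2≤)
        where V = Inner.block X b
      ... | no small = ≤-trans (≤-reflexive (cong (λ z → q * z + p * 𝟙 (b ∈? image (Inner.rep X))) none))
              (≤-trans (≤-reflexive (cong (_+ p * 𝟙 (b ∈? image (Inner.rep X))) (*-zeroʳ q))) (*-monoʳ-≤ p (𝟙-elim (b ∈? image (Inner.rep X)) some)))
        where
        none : Inner.edgesAt X b ≡ 0
        none = trans (∑-cong (allFin e) λ x → 𝟙-no (Inner.edgesAt? X b x) λ (x∈ , eq) → small (distinct⇒2≤ (Inner.block X b)
          (∈-comprehend⁺ (λ l → Inner.rep X l FinP.≟ b) eq) (∈-comprehend⁺ (λ l → Inner.rep X l FinP.≟ b) (trans (sym (Inner.rep-edge X x∈)) eq)) (src≢tgt x))) (∑-zero (allFin e))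
        some : b ∈ image (Inner.rep X) → 1 ≤ ∣ Inner.block X b ∣
        some b∈ with ∈-image⁻ (Inner.rep X) b∈
        ... | l , eq = nonempty⇒1≤ (Inner.block X b) (∈-comprehend⁺ (λ l → Inner.rep X l FinP.≟ b) eq)

    outer-rank : ∀ X → X ⊆ outer → Nonempty X → q * ∣ X ∣ + p * image-size (Outer.rep X) + 1 ≤ p * k F
    outer-rank X X⊆ (x₀ , x₀∈) = ≤-trans (+-monoʳ-≤ (q * ∣ X ∣ + p * image-size (Outer.rep X)) occupied) (Outer.∑-blocks X p q extra bound)
      where
      r : Fin (k F) → Fin (k F)
      r = Outer.rep X
      extra : Fin (k F) → ℕ
      extra b = 𝟙 (1 ≤? Outer.edgesAt X b)
      occupied : 1 ≤ ∑ (allFin (k F)) extra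
      occupied = ≤-trans (≤-reflexive (sym (𝟙-yes (1 ≤? Outer.edgesAt X b₀)
          (≤-trans (≤-reflexive (sym (𝟙-yes (Outer.edgesAt? X b₀ x₀) (x₀∈ , refl)))) (∑-term (allFin e) (λ x → 𝟙 (Outer.edgesAt? X b₀ x)) (∈-allFin x₀))))))
        (∑-term (allFin (k F)) extra (∈-allFin b₀))
        where b₀ = r (g (src x₀))
      module _ (b : Fin (k F)) where
        B V BI : Subset (k F)
        B = Outer.block X b
        V = pre g B
        BI = B ∩ image g
        ∈B⁺ : ∀ {l} → r l ≡ b → l ∈ B
        ∈B⁺ = ∈-comprehend⁺ (λ l → r l FinP.≟ b)
        ∈B⁻ : ∀ {l} → l ∈ B → r l ≡ b
        ∈B⁻ = ∈-comprehend⁻ (λ l → r l FinP.≟ b)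
        innerAt? : ∀ x → Dec (g (src x) ≡ g (tgt x) × r (g (src x)) ≡ b)
        innerAt? x = inner? x ×-dec (r (g (src x)) FinP.≟ b)
        innerAt : ℕ
        innerAt = ∑ (allFin e) (λ x → 𝟙 (innerAt? x))
        split : innerAt + Outer.edgesAt X b ≤ edgesIn V
        split = ≤-trans (≤-reflexive (sym (∑-+ (allFin e) _ _))) (∑-mono (allFin e) λ x →
          either (innerAt? x) (Outer.edgesAt? X b x) (inside? V x)
            (λ (same , eq) → ∈-comprehend⁺ (λ v → g v ∈? B) (∈B⁺ eq) , ∈-comprehend⁺ (λ v → g v ∈? B) (∈B⁺ (trans (cong r (sym same)) eq)))
            (λ (x∈ , eq) → ∈-comprehend⁺ (λ v → g v ∈? B) (∈B⁺ eq) , ∈-comprehend⁺ (λ v → g v ∈? B) (∈B⁺ (trans (sym (Outer.rep-edge X x∈)) eq)))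
            (λ (same , _) (x∈ , _) → ∈-comprehend⁻ (λ x → ¬? (inner? x)) (X⊆ x∈) same))
          where
          either : {P Q R : Set} (a : Dec P) (b : Dec Q) (c : Dec R) → (P → R) → (Q → R) → (P → Q → Data.Empty.⊥) → 𝟙 a + 𝟙 b ≤ 𝟙 c
          either (yes pp) (yes qq) c f h ex = ⊥-elim (ex pp qq)
          either (yes pp) (no _) c f h ex = ≤-reflexive (sym (𝟙-yes c (f pp)))
          either (no _) b c f h ex = 𝟙-mono b c h
        classes : p * ∣ V ∣ ≤ q * innerAt + p * ∣ BI ∣
        classes = begin
          p * ∣ V ∣ ≤⟨ *-monoʳ-≤ p V≤ ⟩
          p * ∑ (allFin (k F)) (λ l → 𝟙 (l ∈? BI) * ∣ pre g ⁅ l ⁆ ∣) ≡⟨ ∑-*ˡ (allFin (k F)) p _ ⟨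
          ∑ (allFin (k F)) (λ l → p * (𝟙 (l ∈? BI) * ∣ pre g ⁅ l ⁆ ∣))
            ≤⟨ ∑-mono (allFin (k F)) (λ l → ≤-trans (≤-reflexive (lem₁ p (𝟙 (l ∈? BI)) _)) (≤-trans (*-monoʳ-≤ (𝟙 (l ∈? BI)) (classes-tight l)) (≤-reflexive (lem₂ (𝟙 (l ∈? BI)) q _ p)))) ⟩
          ∑ (allFin (k F)) (λ l → q * (𝟙 (l ∈? BI) * edgesIn (pre g ⁅ l ⁆)) + p * 𝟙 (l ∈? BI)) ≡⟨ ∑-+ (allFin (k F)) _ _ ⟩
          ∑ (allFin (k F)) (λ l → q * (𝟙 (l ∈? BI) * edgesIn (pre g ⁅ l ⁆))) + ∑ (allFin (k F)) (λ l → p * 𝟙 (l ∈? BI))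
            ≡⟨ cong₂ _+_ (∑-*ˡ (allFin (k F)) q _) (trans (∑-*ˡ (allFin (k F)) p _) (cong (p *_) (sym (∣∣-∑ BI)))) ⟩
          q * ∑ (allFin (k F)) (λ l → 𝟙 (l ∈? BI) * edgesIn (pre g ⁅ l ⁆)) + p * ∣ BI ∣ ≤⟨ +-monoˡ-≤ (p * ∣ BI ∣) (*-monoʳ-≤ q E≤) ⟩
          q * innerAt + p * ∣ BI ∣ ∎
          where
          open ≤-Reasoning
          lem₁ : ∀ a b c → a * (b * c) ≡ b * (a * c)
          lem₁ = solve-∀
          lem₂ : ∀ i q x p → i * (q * x + p) ≡ q * (i * x) + p * i
          lem₂ = solve-∀
          V≤ : ∣ V ∣ ≤ ∑ (allFin (k F)) (λ l → 𝟙 (l ∈? BI) * ∣ pre g ⁅ l ⁆ ∣)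
          V≤ = begin
            ∣ V ∣ ≡⟨ ∣∣-∑ V ⟩
            ∑ (allFin (k F)) (λ v → 𝟙 (v ∈? V)) ≤⟨ ∑-mono (allFin (k F)) (λ v → 𝟙-elim (v ∈? V) λ v∈ →
                ≤-trans (≤-reflexive (sym (cong₂ _*_ (𝟙-yes (g v ∈? BI) (x∈p∩q⁺ (∈-comprehend⁻ (λ v → g v ∈? B) v∈ , ∈-image g v)))
                    (𝟙-yes (v ∈? pre g ⁅ g v ⁆) (∈-comprehend⁺ (λ w → g w ∈? ⁅ g v ⁆) (x∈⁅x⁆ (g v)))))))
                  (∑-term (allFin (k F)) (λ l → 𝟙 (l ∈? BI) * 𝟙 (v ∈? pre g ⁅ l ⁆)) (∈-allFin (g v)))) ⟩
            ∑ (allFin (k F)) (λ v → ∑ (allFin (k F)) (λ l → 𝟙 (l ∈? BI) * 𝟙 (v ∈? pre g ⁅ l ⁆))) ≡⟨ ∑-swap (allFin (k F)) (allFin (k F)) _ ⟩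
            ∑ (allFin (k F)) (λ l → ∑ (allFin (k F)) (λ v → 𝟙 (l ∈? BI) * 𝟙 (v ∈? pre g ⁅ l ⁆)))
              ≡⟨ ∑-cong (allFin (k F)) (λ l → trans (∑-*ˡ (allFin (k F)) (𝟙 (l ∈? BI)) _) (cong (𝟙 (l ∈? BI) *_) (sym (∣∣-∑ (pre g ⁅ l ⁆))))) ⟩
            ∑ (allFin (k F)) (λ l → 𝟙 (l ∈? BI) * ∣ pre g ⁅ l ⁆ ∣) ∎
          E≤ : ∑ (allFin (k F)) (λ l → 𝟙 (l ∈? BI) * edgesIn (pre g ⁅ l ⁆)) ≤ innerAt
          E≤ = begin
            ∑ (allFin (k F)) (λ l → 𝟙 (l ∈? BI) * edgesIn (pre g ⁅ l ⁆)) ≡⟨ ∑-cong (allFin (k F)) (λ l → sym (∑-*ˡ (allFin e) (𝟙 (l ∈? BI)) _)) ⟩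
            ∑ (allFin (k F)) (λ l → ∑ (allFin e) (λ x → 𝟙 (l ∈? BI) * 𝟙 (inside? (pre g ⁅ l ⁆) x))) ≡⟨ ∑-swap (allFin (k F)) (allFin e) _ ⟩
            ∑ (allFin e) (λ x → ∑ (allFin (k F)) (λ l → 𝟙 (l ∈? BI) * 𝟙 (inside? (pre g ⁅ l ⁆) x)))
              ≤⟨ ∑-mono (allFin e) (λ x → ≤-trans (∑-mono (allFin (k F)) (perLabel x)) (∑-𝟙-collapse (g (src x)) (𝟙 (innerAt? x)))) ⟩
            innerAt ∎
            where
            perLabel : ∀ x l → 𝟙 (l ∈? BI) * 𝟙 (inside? (pre g ⁅ l ⁆) x) ≤ 𝟙 (g (src x) FinP.≟ l) * 𝟙 (innerAt? x)
            perLabel x l = 𝟙-*-elim (l ∈? BI) λ l∈ → 𝟙-elim (inside? (pre g ⁅ l ⁆) x) λ (s∈ , t∈) →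
              let s≡ = x∈⁅y⁆⇒x≡y l (∈-comprehend⁻ (λ v → g v ∈? ⁅ l ⁆) s∈)
                  t≡ = x∈⁅y⁆⇒x≡y l (∈-comprehend⁻ (λ v → g v ∈? ⁅ l ⁆) t∈)
              in ≤-reflexive (sym (cong₂ _*_ (𝟙-yes (g (src x) FinP.≟ l) s≡)
                   (𝟙-yes (innerAt? x) (trans s≡ (sym t≡) , trans (cong r s≡) (∈B⁻ (proj₁ (x∈p∩q⁻ B (image g) l∈)))))))
        bound : q * Outer.edgesAt X b + p * 𝟙 (b ∈? image r) + extra b ≤ p * ∣ B ∣
        bound with 2 ≤? ∣ BI ∣
        ... | yes 2≤ = ≤-trans (+-mono-≤ (+-monoʳ-≤ (q * Outer.edgesAt X b) (≤-trans (*-monoʳ-≤ p (𝟙≤1 (b ∈? image r))) (≤-reflexive (*-identityʳ p)))) (𝟙≤1 (1 ≤? Outer.edgesAt X b)))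
            (≤-trans (+-cancelˡ-≤ (q * innerAt) _ _ (begin
              q * innerAt + (q * Outer.edgesAt X b + p + 1) ≡⟨ lem q innerAt (Outer.edgesAt X b) p ⟩
              suc (q * (innerAt + Outer.edgesAt X b) + p) ≤⟨ s≤s (+-monoˡ-≤ p (*-monoʳ-≤ q split)) ⟩
              suc (q * edgesIn V + p) ≤⟨ unions-sparse B 2≤ ⟩
              p * ∣ V ∣ ≤⟨ classes ⟩
              q * innerAt + p * ∣ BI ∣ ∎)) (*-monoʳ-≤ p (∣p∩q∣≤∣p∣ B (image g))))
          where
          open ≤-Reasoning
          lem : ∀ q i o p → q * i + (q * o + p + 1) ≡ suc (q * (i + o) + p)
          lem = solve-∀
        ... | no small = ≤-trans (≤-reflexive (cong₂ (λ z y → q * z + p * 𝟙 (b ∈? image r) + y) none (𝟙-no (1 ≤? Outer.edgesAt X b) λ 1≤ → <-irrefl refl (≤-trans 1≤ (≤-reflexive none)))))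
              (≤-trans (≤-reflexive (trans (+-identityʳ _) (cong (_+ p * 𝟙 (b ∈? image r)) (*-zeroʳ q)))) (*-monoʳ-≤ p (𝟙-elim (b ∈? image r) some)))
          where
          none : Outer.edgesAt X b ≡ 0
          none = trans (∑-cong (allFin e) λ x → 𝟙-no (Outer.edgesAt? X b x) λ (x∈ , eq) → small (distinct⇒2≤ BI
            (x∈p∩q⁺ (∈B⁺ eq , ∈-image g (src x))) (x∈p∩q⁺ (∈B⁺ (trans (sym (Outer.rep-edge X x∈)) eq) , ∈-image g (tgt x)))
            (∈-comprehend⁻ (λ x → ¬? (inner? x)) (X⊆ x∈)))) (∑-zero (allFin e))
          some : b ∈ image r → 1 ≤ ∣ B ∣
          some b∈ with ∈-image⁻ r b∈
          ... | l , eq = nonempty⇒1≤ B (∈B⁺ eq)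

-- Factors of a chunk

^-cancelˡ-≤ : ∀ p {a b} → 1 ≤ p → a ^ p ≤ b ^ p → a ≤ b
^-cancelˡ-≤ p {a} {b} 1≤p le with a ≤? b
... | yes a≤b = a≤b
... | no a≰b = ⊥-elim (<⇒≱ (^-monoˡ-< p ⦃ >-nonZero 1≤p ⦄ (≰⇒> a≰b)) le)

-- Both dense-subfamily conditions are compared after raising them to the p-th power.
dense-bound : ∀ p q s x i c B M → 1 ≤ p → 1 ≤ x → 1 ≤ c → 1 ≤ M → q * x + p * i ≤ p * s → (c * B) ^ p ≤ M ^ q →
  c * B ^ x * M ^ i ≤ M ^ s
dense-bound p q s x i c B M 1≤p 1≤x 1≤c 1≤M rank le = ^-cancelˡ-≤ p 1≤p (begin
  (c * B ^ x * M ^ i) ^ p ≤⟨ ^-monoˡ-≤ p (*-monoˡ-≤ (M ^ i) (≤-trans (*-monoˡ-≤ (B ^ x) c≤) (≤-reflexive (sym (^-distribʳ-* x c B))))) ⟩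
  ((c * B) ^ x * M ^ i) ^ p ≡⟨ ^-distribʳ-* p _ _ ⟩
  ((c * B) ^ x) ^ p * (M ^ i) ^ p ≡⟨ cong₂ _*_ (trans (^-*-assoc (c * B) x p) (trans (cong ((c * B) ^_) (*-comm x p)) (sym (^-*-assoc (c * B) p x))))
      (trans (^-*-assoc M i p) (cong (M ^_) (*-comm i p))) ⟩
  ((c * B) ^ p) ^ x * M ^ (p * i) ≤⟨ *-monoˡ-≤ (M ^ (p * i)) (^-monoˡ-≤ x le) ⟩
  (M ^ q) ^ x * M ^ (p * i) ≡⟨ trans (cong (_* M ^ (p * i)) (^-*-assoc M q x)) (sym (^-distribˡ-+-* M (q * x) (p * i))) ⟩
  M ^ (q * x + p * i) ≤⟨ ^-monoʳ-≤ M ⦃ >-nonZero 1≤M ⦄ rank ⟩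
  M ^ (p * s) ≡⟨ trans (cong (M ^_) (*-comm p s)) (sym (^-*-assoc M s p)) ⟩
  (M ^ s) ^ p ∎)
  where
  open ≤-Reasoning
  c≤ : c ≤ c ^ x
  c≤ = ≤-trans (≤-reflexive (sym (*-identityʳ c))) (^-monoʳ-≤ c ⦃ >-nonZero 1≤c ⦄ 1≤x)

-- After raising to the `p`-th power the `+ 1` in the rank inequality is worth a full factor `M`. It
-- absorbs `(c * L) ^ (p * e)`, so the spread may exceed `D` by the factor `L`.
dense-bound-slack : ∀ p q s e x i c D L M → 1 ≤ p → 1 ≤ c → 1 ≤ L → 1 ≤ x → x ≤ e → q * x + p * i + 1 ≤ p * s →
  1 ≤ M → D ^ p ≤ M ^ q → (c * L) ^ (p * e) ≤ M → c * (D * L) ^ x * M ^ i ≤ M ^ s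
dense-bound-slack p q s e x i c D L M 1≤p 1≤c 1≤L 1≤x x≤e rank 1≤M le slack = ^-cancelˡ-≤ p 1≤p (begin
  (c * (D * L) ^ x * M ^ i) ^ p ≤⟨ ^-monoˡ-≤ p (*-monoˡ-≤ (M ^ i) (≤-trans (*-monoˡ-≤ ((D * L) ^ x) c≤) (≤-reflexive (trans (cong (c ^ x *_) (^-distribʳ-* x D L))
      (trans (lem (c ^ x) (D ^ x) (L ^ x)) (cong (_* D ^ x) (sym (^-distribʳ-* x c L)))))))) ⟩
  ((c * L) ^ x * D ^ x * M ^ i) ^ p ≡⟨ trans (^-distribʳ-* p ((c * L) ^ x * D ^ x) (M ^ i)) (cong (_* (M ^ i) ^ p) (^-distribʳ-* p ((c * L) ^ x) (D ^ x))) ⟩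
  ((c * L) ^ x) ^ p * (D ^ x) ^ p * (M ^ i) ^ p ≡⟨ cong₂ _*_ (cong₂ _*_ (trans (^-*-assoc (c * L) x p) (cong ((c * L) ^_) (*-comm x p)))
      (trans (^-*-assoc D x p) (trans (cong (D ^_) (*-comm x p)) (sym (^-*-assoc D p x))))) (trans (^-*-assoc M i p) (cong (M ^_) (*-comm i p))) ⟩
  (c * L) ^ (p * x) * (D ^ p) ^ x * M ^ (p * i)
    ≤⟨ *-monoˡ-≤ (M ^ (p * i)) (*-mono-≤ (^-monoʳ-≤ (c * L) ⦃ >-nonZero (*-mono-≤ 1≤c 1≤L) ⦄ (*-monoʳ-≤ p x≤e)) (^-monoˡ-≤ x le)) ⟩
  (c * L) ^ (p * e) * (M ^ q) ^ x * M ^ (p * i) ≤⟨ *-monoˡ-≤ (M ^ (p * i)) (*-monoˡ-≤ ((M ^ q) ^ x) slack) ⟩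
  M * (M ^ q) ^ x * M ^ (p * i) ≡⟨ trans (cong (λ z → M * z * M ^ (p * i)) (^-*-assoc M q x)) (trans (*-assoc M (M ^ (q * x)) (M ^ (p * i))) (cong (M *_) (sym (^-distribˡ-+-* M (q * x) (p * i))))) ⟩
  M ^ suc (q * x + p * i) ≤⟨ ^-monoʳ-≤ M ⦃ >-nonZero 1≤M ⦄ (≤-trans (≤-reflexive (+-comm 1 _)) rank) ⟩
  M ^ (p * s) ≡⟨ trans (cong (M ^_) (*-comm p s)) (sym (^-*-assoc M s p)) ⟩
  (M ^ s) ^ p ∎)
  where
  open ≤-Reasoning
  c≤ : c ≤ c ^ x
  c≤ = ≤-trans (≤-reflexive (sym (*-identityʳ c))) (^-monoʳ-≤ c ⦃ >-nonZero 1≤c ⦄ 1≤x)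
  lem : ∀ a b d → a * (b * d) ≡ a * d * b
  lem = solve-∀

unique-lookup : {A : Set} {xs : List A} → Unique xs → ∀ i j → lookup xs i ≡ lookup xs j → i ≡ j
unique-lookup (x∉ ∷ u) zero zero eq = refl
unique-lookup {xs = x ∷ xs} (x∉ ∷ u) zero (suc j) eq = ⊥-elim (AllP.lookup x∉ (∈-lookup {xs = xs} j) eq)
unique-lookup {xs = x ∷ xs} (x∉ ∷ u) (suc i) zero eq = ⊥-elim (AllP.lookup x∉ (∈-lookup {xs = xs} i) (sym eq))
unique-lookup (x∉ ∷ u) (suc i) (suc j) eq = cong suc (unique-lookup u i j eq)

module EdgeIndex (n : ℕ) where

  X : List (Edge n)
  X = allEdges n

  N : ℕ
  N = length X

  <-edge? : (f : Edge n) → Dec (Fin.toℕ (proj₁ f) < Fin.toℕ (proj₂ f))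
  <-edge? f = Fin.toℕ (proj₁ f) <? Fin.toℕ (proj₂ f)

  ∈-allEdges : ∀ {a b} → a Fin.< b → (a , b) L.∈ X
  ∈-allEdges {a} {b} lt = ∈-filter⁺ <-edge? (∈-cartesianProduct⁺ (∈-allFin a) (∈-allFin b)) lt

  allEdges-unique : Unique X
  allEdges-unique = UniqueP.filter⁺ <-edge? (UniqueP.cartesianProduct⁺ (UniqueP.allFin⁺ n) (UniqueP.allFin⁺ n))

  module _ (x₀ : Fin N) where

    -- The value x₀ for a = b is junk.
    idx : Fin n → Fin n → Fin N
    idx a b with FinP.<-cmp a b
    ... | tri< lt _ _ = Any.index (∈-allEdges lt)
    ... | tri≈ _ _ _ = x₀
    ... | tri> _ _ gt = Any.index (∈-allEdges gt)

    lookup-idx : ∀ {a b} → a ≢ b → lookup X (idx a b) ≡ (a , b) ⊎ lookup X (idx a b) ≡ (b , a)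
    lookup-idx {a} {b} a≢b with FinP.<-cmp a b
    ... | tri< lt _ _ = inj₁ (sym (lookup-index (∈-allEdges lt)))
    ... | tri≈ _ eq _ = ⊥-elim (a≢b eq)
    ... | tri> _ _ gt = inj₂ (sym (lookup-index (∈-allEdges gt)))

    idx-injective : ∀ {a b c d} → a ≢ b → c ≢ d → idx a b ≡ idx c d → (a ≡ c × b ≡ d) ⊎ (a ≡ d × b ≡ c)
    idx-injective {a} {b} {c} {d} a≢b c≢d eq with lookup-idx a≢b | lookup-idx c≢d
    ... | inj₁ e₁ | inj₁ e₂ = inj₁ (cong proj₁ e , cong proj₂ e)
      where e = trans (sym e₁) (trans (cong (lookup X) eq) e₂)
    ... | inj₁ e₁ | inj₂ e₂ = inj₂ (cong proj₁ e , cong proj₂ e)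
      where e = trans (sym e₁) (trans (cong (lookup X) eq) e₂)
    ... | inj₂ e₁ | inj₁ e₂ = inj₂ (cong proj₂ e , cong proj₁ e)
      where e = trans (sym e₁) (trans (cong (lookup X) eq) e₂)
    ... | inj₂ e₁ | inj₂ e₂ = inj₁ (cong proj₂ e , cong proj₁ e)
      where e = trans (sym e₁) (trans (cong (lookup X) eq) e₂)

    -- Injectivity of `base` is asked only at the ends of active edges, since the inner template
    -- places a junk vertex at `u`, which no inner edge touches.
    module Placed (F : Graph) {m : ℕ} (base : Fin (k F) → Fin m → Fin n) (act : Subset (length (E F)))
      (base-inj : ∀ {x x′ y y′ i i′} → x ∈ act → x′ ∈ act →
        y ≡ proj₁ (lookup (E F) x) ⊎ y ≡ proj₂ (lookup (E F) x) → y′ ≡ proj₁ (lookup (E F) x′) ⊎ y′ ≡ proj₂ (lookup (E F) x′) →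
        base y i ≡ base y′ i′ → y ≡ y′ × i ≡ i′) where

      open Structure F using (e; src; tgt; src<tgt; src≢tgt)

      edge : Fin e → Fin m → Fin m → Fin N
      edge x i j = idx (base (src x) i) (base (tgt x) j)

      ends-distinct : ∀ {x i j} → x ∈ act → base (src x) i ≢ base (tgt x) j
      ends-distinct {x} x∈ eq = src≢tgt x (proj₁ (base-inj x∈ x∈ (inj₁ refl) (inj₂ refl) eq))

      edge-inj : ∀ {x x′ i i′ j j′} → x ∈ act → x′ ∈ act → edge x i j ≡ edge x′ i′ j′ → x ≡ x′ × i ≡ i′ × j ≡ j′
      edge-inj {x} {x′} x∈ x′∈ eq with idx-injective (ends-distinct x∈) (ends-distinct x′∈) eq
      ... | inj₁ (es , et) with base-inj x∈ x′∈ (inj₁ refl) (inj₁ refl) es | base-inj x∈ x′∈ (inj₂ refl) (inj₂ refl) et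
      ...   | s≡ , i≡ | t≡ , j≡ = unique-lookup (unique F) x x′ (cong₂ _,_ s≡ t≡) , i≡ , j≡
      -- Exchanged endpoints are impossible, because the edges of `F` list their smaller end first.
      edge-inj {x} {x′} x∈ x′∈ eq | inj₂ (es , et) with base-inj x∈ x′∈ (inj₁ refl) (inj₂ refl) es | base-inj x∈ x′∈ (inj₂ refl) (inj₁ refl) et
      ...   | s≡ , _ | t≡ , _ = ⊥-elim (<-irrefl refl (<-trans (src<tgt x) (subst (λ z → Fin.toℕ z < Fin.toℕ (src x)) (sym t≡)
                (subst (λ z → Fin.toℕ (src x′) < Fin.toℕ z) (sym s≡) (src<tgt x′)))))

module Near {N : ℕ} (H : List (Subset N)) (H≢[] : 1 ≤ length H) (g μ : ℕ) (μ≥1 : 1 ≤ μ)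
  (spread : ∀ T → ∑ H (λ S → 𝟙 (T ⊆? S)) * (suc g * (μ * 1)) ^ ∣ T ∣ ≤ length H)
  (ℓ ℓ′ : ℕ) (sizes : ∀ {S} → S L.∈ H → ∣ S ∣ ≤ ℓ) where

  open Fragments H
  open Spread g μ 1 μ≥1 ≤-refl spread

  near? : ∀ W → Dec (Any (λ S → ∣ S ─ W ∣ ≤ ℓ′) H)
  near? W = any? (λ S → ∣ S ─ W ∣ ≤? ℓ′) H

  -- With `ν = 1` the fragments are counted crudely by `2 ^ ℓ`. A large constant `μ` beats this when
  -- the tolerated remainder `ℓ′` is a constant proportion of `ℓ`.
  near-bound : μ ^ suc ℓ′ * 𝔼 1 g (λ W → 𝟙 (¬? (near? W))) ≤ suc g ^ N * 2 ^ ℓ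
  near-bound = *-cancelˡ-≤ (length H) ⦃ >-nonZero H≢[] ⦄ (begin
    length H * (μ ^ suc ℓ′ * Y) ≡⟨ lem₁ (length H) (μ ^ suc ℓ′) Y ⟩
    μ ^ suc ℓ′ * 1 * (length H * Y) ≡⟨ cong₂ (λ a b → μ ^ suc ℓ′ * a * b) (sym (^-zeroˡ ℓ)) (sym (∑-const H Y)) ⟩
    μ ^ suc ℓ′ * 1 ^ ℓ * ∑ H (λ S → Y) ≤⟨ *-monoʳ-≤ (μ ^ suc ℓ′ * 1 ^ ℓ) (∑-mono-∈ H λ {S} S∈ → 𝔼-mono 1 g λ W →
        𝟙-mono (¬? (near? W)) (Good? ⊥ S ℓ ×-dec ¬? (Good? (⊥ ∪ W) S ℓ′)) λ far → trivial S∈ , λ good → far (close W S good)) ⟩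
    μ ^ suc ℓ′ * 1 ^ ℓ * ∑ H (λ S → 𝔼 1 g (λ W → 𝟙 (Good? ⊥ S ℓ ×-dec ¬? (Good? (⊥ ∪ W) S ℓ′)))) ≤⟨ fragment-step ⊥ ℓ ℓ′ ⟩
    length H * (suc g ^ N * 2 ^ ℓ) ∎)
    where
    open ≤-Reasoning
    Y = 𝔼 1 g (λ W → 𝟙 (¬? (near? W)))
    lem₁ : ∀ h m y → h * (m * y) ≡ m * 1 * (h * y)
    lem₁ = solve-∀
    trivial : ∀ {S} → S L.∈ H → Good ⊥ S ℓ
    trivial {S} S∈ = L.lose S∈ ((λ {x} → p⊆p∪q ⊥ {x}) , ≤-trans (∣p─q∣≤∣p∣ S ⊥) (sizes S∈))
    close : ∀ W S → Good (⊥ ∪ W) S ℓ′ → Any (λ S → ∣ S ─ W ∣ ≤ ℓ′) H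
    close W S good with L.find good
    ... | S′ , S′∈ , _ , le = L.lose S′∈ (subst (λ V → ∣ S′ ─ V ∣ ≤ ℓ′) (∪-identityˡ W) le)

relocate-injective : {n K m M : ℕ} (base : Fin K → Fin m → Fin n) (τ : Vec (Vec (Fin m) m) K) →
  (∀ a → Vec.lookup τ a L.∈ permutations m) → (loc : Fin M → Fin m) → (∀ {i j} → loc i ≡ loc j → i ≡ j) → (P : Fin K → Set) →
  (∀ {x y i j} → P x → P y → base x i ≡ base y j → x ≡ y × i ≡ j) → ∀ {x y i j} → P x → P y →
  base x (inv (Vec.lookup τ x) (loc i)) ≡ base y (inv (Vec.lookup τ y) (loc j)) → x ≡ y × i ≡ j
relocate-injective base τ perm loc loc-inj P inj {x} px py eq with inj px py eq
... | refl , eqi = refl , loc-inj (inv-injective (perm x) eqi)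

M<suc[M/k]*k : ∀ M k ⦃ _ : NonZero k ⦄ → M < suc (M / k) * k
M<suc[M/k]*k M k = ≤-trans (s≤s (≤-reflexive (m≡m%n+[m/n]*n M k))) (+-monoˡ-≤ (M / k * k) (m%n<n M k))

module Others (K : ℕ) (2≤K : 2 ≤ K) (u : Fin K) where

  others : List (Fin K)
  others = remove FinP._≟_ u (allFin K)

  k′ : ℕ
  k′ = length others

  suc-k′ : suc k′ ≡ K
  suc-k′ = trans (length-remove FinP._≟_ u (allFin K) (UniqueP.allFin⁺ K) (∈-allFin u)) (length-tabulate {n = K} id)

  instance
    k′≢0 : NonZero k′
    k′≢0 = >-nonZero (≤-pred (≤-trans 2≤K (≤-reflexive (sym suc-k′))))

  ∈-others : ∀ {x} → x ≢ u → x L.∈ others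
  ∈-others {x} x≢u = ∈-filter⁺ (λ y → ¬? (u FinP.≟ y)) (∈-allFin x) (λ eq → x≢u (sym eq))

  pos : ∀ x → x ≢ u → Fin k′
  pos x x≢u = Any.index (∈-others x≢u)

  pos-injective : ∀ {x y} (x≢u : x ≢ u) (y≢u : y ≢ u) → pos x x≢u ≡ pos y y≢u → x ≡ y
  pos-injective x≢u y≢u eq = trans (lookup-index (∈-others x≢u)) (trans (cong (lookup others) eq) (sym (lookup-index (∈-others y≢u))))

-- The packing of the inner pieces wastes some vertices; the room for this comes from u, whose positions take what is left over.
module Completion (K : ℕ) (2≤K : 2 ≤ K) (u : Fin K) (n M : ℕ) (vs : List (Fin n)) (vs-unique : Unique vs) (length-vs : length vs ≡ K * M)
  (moved : Fin K → Fin M → Fin n) (moved-∈ : ∀ {x} j → x ≢ u → moved x j L.∈ vs)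
  (moved-injective : ∀ {x y i j} → x ≢ u → y ≢ u → moved x i ≡ moved y j → x ≡ y × i ≡ j) where

  open Others K 2≤K u

  used : List (Fin n)
  used = map (λ (x , j) → moved x j) (cartesianProduct others (allFin M))

  open import Data.List.Membership.DecPropositional (FinP._≟_ {n}) using () renaming (_∈?_ to _∈ᴸ?_)

  leftover : List (Fin n)
  leftover = filter (λ v → ¬? (v ∈ᴸ? used)) vs

  M≤leftover : M ≤ length leftover
  M≤leftover = +-cancelˡ-≤ (k′ * M) M _ (begin
    k′ * M + M ≡⟨ trans (+-comm (k′ * M) M) (trans (cong (_* M) suc-k′) (sym length-vs)) ⟩
    length vs ≡⟨ ∑-filter-≤ (_∈ᴸ? used) vs ⟨
    ∑ vs (λ v → 𝟙 (v ∈ᴸ? used)) + ∑ vs (λ v → 𝟙 (¬? (v ∈ᴸ? used)))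
      ≡⟨ cong₂ _+_ (length-filter-∑ (_∈ᴸ? used) vs) (length-filter-∑ (λ v → ¬? (v ∈ᴸ? used)) vs) ⟨
    length (filter (_∈ᴸ? used) vs) + length leftover
      ≤⟨ +-monoˡ-≤ (length leftover) (unique-⊆-length FinP._≟_ (filter (_∈ᴸ? used) vs) used (UniqueP.filter⁺ (_∈ᴸ? used) vs-unique) λ v∈ → proj₂ (∈-filter⁻ (_∈ᴸ? used) {xs = vs} v∈)) ⟩
    length used + length leftover
      ≡⟨ cong (_+ length leftover) (trans (length-map _ (cartesianProduct others (allFin M))) (trans (length-cartesianProduct others (allFin M)) (cong (k′ *_) (length-tabulate {n = M} id)))) ⟩
    k′ * M + length leftover ∎)
    where open ≤-Reasoning

  base₂ : Fin K → Fin M → Fin n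
  base₂ x j with x FinP.≟ u
  ... | yes _ = lookup leftover (Fin.inject≤ j M≤leftover)
  ... | no _ = moved x j

  base₂-moved : ∀ {x} j → x ≢ u → base₂ x j ≡ moved x j
  base₂-moved {x} j x≢u with x FinP.≟ u
  ... | yes x≡u = ⊥-elim (x≢u x≡u)
  ... | no _ = refl

  base₂-∈ : ∀ x j → base₂ x j L.∈ vs
  base₂-∈ x j with x FinP.≟ u
  ... | yes _ = proj₁ (∈-filter⁻ (λ v → ¬? (v ∈ᴸ? used)) {xs = vs} (∈-lookup {xs = leftover} (Fin.inject≤ j M≤leftover)))
  ... | no x≢u = moved-∈ j x≢u

  leftover-fresh : ∀ {x} i j → x ≢ u → lookup leftover (Fin.inject≤ i M≤leftover) ≢ moved x j
  leftover-fresh {x} i j x≢u eq = proj₂ (∈-filter⁻ (λ v → ¬? (v ∈ᴸ? used)) {xs = vs} (∈-lookup {xs = leftover} (Fin.inject≤ i M≤leftover)))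
    (subst (L._∈ used) (sym eq) (∈-map⁺ (λ (x , j) → moved x j) (∈-cartesianProduct⁺ (∈-others x≢u) (∈-allFin j))))

  base₂-injective : ∀ {x y i j} → base₂ x i ≡ base₂ y j → x ≡ y × i ≡ j
  base₂-injective {x} {y} {i} {j} eq with x FinP.≟ u | y FinP.≟ u
  ... | yes refl | yes refl = refl , FinP.inject≤-injective M≤leftover M≤leftover i j (unique-lookup (UniqueP.filter⁺ (λ v → ¬? (v ∈ᴸ? used)) vs-unique) _ _ eq)
  ... | yes _ | no y≢u = ⊥-elim (leftover-fresh i j y≢u eq)
  ... | no x≢u | yes _ = ⊥-elim (leftover-fresh j i x≢u (sym eq))
  ... | no x≢u | no y≢u = moved-injective x≢u y≢u eq

module BlockFactors (F : Graph) (n : ℕ) (x₀ : Fin (EdgeIndex.N n)) (M : ℕ) (vs : List (Fin n)) where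

  open Structure F
  open EdgeIndex n

  private
    K = k F

  Embedded : Subset N → Vec (Vec (Fin n) K) M → Set
  Embedded V φ = (∀ c c′ y y′ → Vec.lookup (Vec.lookup φ c) y ≡ Vec.lookup (Vec.lookup φ c′) y′ → c ≡ c′ × y ≡ y′) ×
    (∀ c x → idx x₀ (Vec.lookup (Vec.lookup φ c) (src x)) (Vec.lookup (Vec.lookup φ c) (tgt x)) ∈ V)

  embedded? : ∀ V φ → Dec (Embedded V φ)
  embedded? V φ = FinP.all? (λ c → FinP.all? λ c′ → FinP.all? λ y → FinP.all? λ y′ →
      (Vec.lookup (Vec.lookup φ c) y FinP.≟ Vec.lookup (Vec.lookup φ c′) y′) →-dec ((c FinP.≟ c′) ×-dec (y FinP.≟ y′)))
    ×-dec FinP.all? (λ c → FinP.all? λ x → idx x₀ (Vec.lookup (Vec.lookup φ c) (src x)) (Vec.lookup (Vec.lookup φ c) (tgt x)) ∈? V)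

  placements : List (Vec (Vec (Fin n) K) M)
  placements = choices (λ _ → choices (λ _ → vs))

  -- Quantifying over the finite list `placements` makes the event decidable, so that its failure
  -- has an indicator and an expectation.
  BlockFactor : Subset N → Set
  BlockFactor V = Any (Embedded V) placements

  blockFactor? : ∀ V → Dec (BlockFactor V)
  blockFactor? V = any? (embedded? V) placements

  block-factor : ∀ V (φ : Fin M → Fin K → Fin n) → (∀ c y → φ c y L.∈ vs) →
    (∀ c c′ y y′ → φ c y ≡ φ c′ y′ → c ≡ c′ × y ≡ y′) → (∀ c x → idx x₀ (φ c (src x)) (φ c (tgt x)) ∈ V) → BlockFactor V
  block-factor V φ mem inj edges = L.lose {x = φs} (∈-choices⁺ (λ _ → choices (λ _ → vs)) φs
      (λ c → ∈-choices⁺ (λ _ → vs) (Vec.lookup φs c) λ y → subst (L._∈ vs) (sym (at c y)) (mem c y)))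
    ( (λ c c′ y y′ eq → inj c c′ y y′ (trans (sym (at c y)) (trans eq (at c′ y′))))
    , (λ c x → subst (_∈ V) (sym (cong₂ (idx x₀) (at c (src x)) (at c (tgt x)))) (edges c x)))
    where
    φs : Vec (Vec (Fin n) K) M
    φs = Vec.tabulate (λ c → Vec.tabulate (φ c))
    at : ∀ c y → Vec.lookup (Vec.lookup φs c) y ≡ φ c y
    at c y = trans (cong (λ r → Vec.lookup r y) (lookup∘tabulate (λ c → Vec.tabulate (φ c)) c)) (lookup∘tabulate (φ c) y)

  -- Vertices of `F` with the same label move by the same permutation: inner edges stay within one
  -- row of `base`, and outer edges are aligned by `τ`.
  assemble : ∀ V (g : Fin K → Fin K) (τ : Vec (Vec (Fin M) M) K) → (∀ a → Vec.lookup τ a L.∈ permutations M) →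
    (base : Fin K → Fin M → Fin n) → (∀ x j → base x j L.∈ vs) → (∀ {x y i j} → base x i ≡ base y j → x ≡ y × i ≡ j) →
    (∀ j x → g (src x) ≡ g (tgt x) → idx x₀ (base (src x) j) (base (tgt x) j) ∈ V) →
    (∀ c x → g (src x) ≢ g (tgt x) →
      idx x₀ (base (src x) (inv (Vec.lookup τ (g (src x))) c)) (base (tgt x) (inv (Vec.lookup τ (g (tgt x))) c)) ∈ V) →
    BlockFactor V
  assemble V g τ perm base base-∈ base-inj within across = block-factor V φ (λ c y → base-∈ y _) φ-injective edges
    where
    φ : Fin M → Fin K → Fin n
    φ c y = base y (inv (Vec.lookup τ (g y)) c)
    φ-injective : ∀ c c′ y y′ → φ c y ≡ φ c′ y′ → c ≡ c′ × y ≡ y′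
    φ-injective c c′ y y′ eq with base-inj eq
    ... | refl , eqj = inv-injective (perm (g y)) eqj , refl
    edges : ∀ c x → idx x₀ (φ c (src x)) (φ c (tgt x)) ∈ V
    edges c x with g (src x) FinP.≟ g (tgt x)
    ... | no apart = across c x apart
    ... | yes same = subst (λ l → idx x₀ (φ c (src x)) (base (tgt x) (inv (Vec.lookup τ l) c)) ∈ V) same (within _ x same)

module Block (F : Graph) (unbalanced : ¬ VertexBalanced F) (p q : ℕ) (1≤q : 1 ≤ q) (dstar : IsDStar F p q)
  (n : ℕ) (x₀ : Fin (EdgeIndex.N n)) (v₀ : Fin n)
  (M : ℕ) (1≤M : 1 ≤ M) (vs : List (Fin n)) (vs-unique : Unique vs) (length-vs : length vs ≡ k F * M) where

  open Structure F
  open WithDensity unbalanced p q 1≤q dstar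
  open EdgeIndex n

  private
    K = k F

  open Others K 2≤k u public

  -- During the inner packing the `M` vertices meant for `u` are shared among the other `k′`
  -- vertices of `F`; this many rows may be spoiled and `M` complete ones still remain.
  spare : ℕ
  spare = M / k′

  m₁ : ℕ
  m₁ = M + spare

  fits : k′ * m₁ ≤ length vs
  fits = begin
    k′ * (M + spare) ≡⟨ *-distribˡ-+ k′ M spare ⟩
    k′ * M + k′ * spare ≤⟨ +-monoʳ-≤ (k′ * M) (≤-trans (≤-reflexive (*-comm k′ spare)) (m/n*n≤m M k′)) ⟩
    k′ * M + M ≡⟨ +-comm (k′ * M) M ⟩
    suc k′ * M ≡⟨ cong (_* M) suc-k′ ⟩
    K * M ≡⟨ length-vs ⟨
    length vs ∎
    where open ≤-Reasoning

  base₁ : Fin K → Fin m₁ → Fin n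
  base₁ x i with x FinP.≟ u
  ... | yes _ = v₀
  ... | no x≢u = lookup vs (Fin.inject≤ (Fin.combine (pos x x≢u) i) fits)

  base₁-injective : ∀ {x y i j} → x ≢ u → y ≢ u → base₁ x i ≡ base₁ y j → x ≡ y × i ≡ j
  base₁-injective {x} {y} {i} {j} x≢u y≢u eq with x FinP.≟ u | y FinP.≟ u
  ... | yes x≡u | _ = ⊥-elim (x≢u x≡u)
  ... | no _ | yes y≡u = ⊥-elim (y≢u y≡u)
  ... | no x≢u′ | no y≢u′ with FinP.combine-injective (pos x x≢u′) i (pos y y≢u′) j
                                (FinP.inject≤-injective fits fits _ _ (unique-lookup vs-unique _ _ eq))
  ...   | pos≡ , i≡j = pos-injective x≢u′ y≢u′ pos≡ , i≡j

  base₁-∈ : ∀ {x} i → x ≢ u → base₁ x i L.∈ vs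
  base₁-∈ {x} i x≢u with x FinP.≟ u
  ... | yes x≡u = ⊥-elim (x≢u x≡u)
  ... | no x≢u′ = ∈-lookup {xs = vs} _

  end≢u : ∀ {x y} → x ∈ inner → y ≡ proj₁ (lookup (E F) x) ⊎ y ≡ proj₂ (lookup (E F) x) → y ≢ u
  end≢u x∈ (inj₁ refl) = proj₁ (inner-avoids-u x∈)
  end≢u x∈ (inj₂ refl) = proj₂ (inner-avoids-u x∈)

  module P₁ = Placed x₀ F base₁ inner (λ x∈ x′∈ y y′ → base₁-injective (end≢u x∈ y) (end≢u x′∈ y′))
  module T₁ = Template K m₁ e N src tgt inner P₁.edge P₁.edge-inj

  open BlockFactors F n x₀ M vs

  module InnerPacking (W : Subset N) (τ₁ : Vec (Vec (Fin m₁) m₁) K) (τ₁∈ : τ₁ L.∈ T₁.families) (few : ∣ T₁.copy τ₁ ─ W ∣ ≤ spare) where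

    perm₁ : ∀ a → Vec.lookup τ₁ a L.∈ permutations m₁
    perm₁ = ∈-choices⁻ (λ _ → permutations m₁) τ₁∈

    module Gaps₁ = T₁.Gaps W τ₁ τ₁∈

    good-locations : List (Fin m₁)
    good-locations = Gaps₁.good-locations

    M≤good : M ≤ length good-locations
    M≤good = +-cancelʳ-≤ spare M _ (≤-trans Gaps₁.good-locations-≥ (+-monoʳ-≤ (length good-locations) few))

    loc : Fin M → Fin m₁
    loc j = lookup good-locations (Fin.inject≤ j M≤good)

    loc-injective : ∀ {i j} → loc i ≡ loc j → i ≡ j
    loc-injective eq = FinP.inject≤-injective M≤good M≤good _ _ (unique-lookup Gaps₁.good-locations-unique _ _ eq)

    loc-complete : ∀ j x → x ∈ inner → T₁.slot τ₁ (loc j) x ∈ W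
    loc-complete j = Gaps₁.good-location (∈-lookup {xs = good-locations} (Fin.inject≤ j M≤good))

    moved : Fin K → Fin M → Fin n
    moved x j = base₁ x (inv (Vec.lookup τ₁ x) (loc j))

    moved-injective : ∀ {x y i j} → x ≢ u → y ≢ u → moved x i ≡ moved y j → x ≡ y × i ≡ j
    moved-injective = relocate-injective base₁ τ₁ perm₁ loc loc-injective (_≢ u) base₁-injective

    open Completion K 2≤k u n M vs vs-unique length-vs moved (λ j → base₁-∈ _) moved-injective
      using (base₂; base₂-moved; base₂-∈; base₂-injective)

    module P₂ = Placed x₀ F base₂ outer (λ _ _ _ _ → base₂-injective)
    module T₂ = Template K M e N (g ∘ src) (g ∘ tgt) outer P₂.edge P₂.edge-inj

    completed : ∀ V → W ⊆ V → Any (λ S → S ⊆ V) T₂.copies → BlockFactor V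
    completed V W⊆V hit = assemble V g τ₂ (∈-choices⁻ (λ _ → permutations M) (proj₁ (proj₂ found))) base₂ base₂-∈ base₂-injective inner-edge
        (λ c x apart → proj₂ (proj₂ found) (T₂.slot-∈ τ₂ c (∈-comprehend⁺ (λ x → ¬? (inner? x)) apart)))
      where
      found : ∃ λ τ → τ L.∈ T₂.families × T₂.copy τ ⊆ V
      found = T₂.copy-with (_⊆ V) hit
      τ₂ = proj₁ found
      inner-edge : ∀ j x → g (src x) ≡ g (tgt x) → idx x₀ (base₂ (src x) j) (base₂ (tgt x) j) ∈ V
      inner-edge j x same = subst (_∈ V) (sym (cong₂ (idx x₀) (base₂-moved j (proj₁ (inner-avoids-u x∈))) (base₂-moved j (proj₂ (inner-avoids-u x∈)))))
          (W⊆V (loc-complete j x x∈))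
        where
        x∈ : x ∈ inner
        x∈ = ∈-comprehend⁺ inner? same

  module Probability (d μ₁ μ₀ : ℕ) (1≤μ₁ : 1 ≤ μ₁) (4≤μ : 4 ≤ suc μ₀)
    (dense₁ : (4 ^ K * (suc d * μ₁)) ^ p ≤ M ^ q) (dense₂ : (4 ^ K * (suc μ₀ * suc μ₀)) ^ (p * e) ≤ M) where

    private
      Ω = suc d ^ N
      1≤4^K : 1 ≤ 4 ^ K
      1≤4^K = >-nonZero⁻¹ (4 ^ K) ⦃ m^n≢0 4 K ⦄

    spread₁ : ∀ T → ∑ T₁.copies (λ S → 𝟙 (T ⊆? S)) * (suc d * (μ₁ * 1)) ^ ∣ T ∣ ≤ length T₁.copies
    spread₁ = T₁.template-spread (suc d * (μ₁ * 1)) Inner.rep (λ X f con → Inner.rep-fix X f con)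
      (λ X X⊆ (x , x∈) → dense-bound p q K ∣ X ∣ (image-size (Inner.rep X)) (4 ^ K) (suc d * (μ₁ * 1)) m₁ 1≤p (nonempty⇒1≤ X x∈) 1≤4^K
        (≤-trans 1≤M (m≤m+n M spare)) (inner-rank X X⊆)
        (≤-trans (≤-reflexive (cong (λ z → (4 ^ K * (suc d * z)) ^ p) (*-identityʳ μ₁))) (≤-trans dense₁ (^-monoˡ-≤ q (m≤m+n M spare)))))
      (*-mono-≤ (s≤s (z≤n {d})) (≤-trans 1≤μ₁ (≤-reflexive (sym (*-identityʳ μ₁)))))

    module Near₁ = Near T₁.copies T₁.copies≢[] d μ₁ 1≤μ₁ spread₁ (m₁ * e) spare T₁.∣copies∣≤

    fail : Subset N → ℕ
    fail V = 𝟙 (¬? (blockFactor? V))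

    module _ (A R : ℕ) (1≤R : 1 ≤ R) (sizes : M * e < suc μ₀ ^ R) where

      -- The outer template is built on the packing found in `W`, hence is fixed before the later
      -- rounds, which are independent of `W`. The inner edges already found persist in every larger
      -- set.
      after-near : ∀ W → Any (λ S → ∣ S ─ W ∣ ≤ spare) T₁.copies → suc μ₀ ^ A * 𝔼ᴿ d (A * R) fail W ≤ (R * 4 * Ω ^ R) ^ A
      after-near W near = ≤-trans (*-monoʳ-≤ (suc μ₀ ^ A) (𝔼ᴿ-mono d (A * R) W λ V W⊆V →
                𝟙-mono (¬? (blockFactor? V)) (¬? (Frag.Hit? V)) λ nofactor hit → nofactor (completed V (λ {x} → W⊆V {x}) hit)))
              (Rounds.attempts T₂.copies T₂.copies≢[] d μ₀ 4≤μ spread₂ (M * e) R T₂.∣copies∣≤ sizes A W)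
        where
        found : ∃ λ τ → τ L.∈ T₁.families × ∣ T₁.copy τ ─ W ∣ ≤ spare
        found = T₁.copy-with (λ S → ∣ S ─ W ∣ ≤ spare) near
        open InnerPacking W (proj₁ found) (proj₁ (proj₂ found)) (proj₂ (proj₂ found))
        module Frag = Fragments T₂.copies
        D^p≤ : suc d ^ p ≤ M ^ q
        D^p≤ = ≤-trans (^-monoˡ-≤ p (≤-trans (≤-trans (≤-reflexive (sym (*-identityʳ (suc d)))) (*-monoʳ-≤ (suc d) 1≤μ₁))
          (≤-trans (≤-reflexive (sym (*-identityˡ _))) (*-monoˡ-≤ (suc d * μ₁) 1≤4^K)))) dense₁
        spread₂ : ∀ T → ∑ T₂.copies (λ S → 𝟙 (T ⊆? S)) * (suc d * (suc μ₀ * suc μ₀)) ^ ∣ T ∣ ≤ length T₂.copies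
        spread₂ = T₂.template-spread (suc d * (suc μ₀ * suc μ₀)) Outer.rep (λ X f con → Outer.rep-fix X f con)
          (λ X X⊆ ne → dense-bound-slack p q K e ∣ X ∣ (image-size (Outer.rep X)) (4 ^ K) (suc d) (suc μ₀ * suc μ₀) M 1≤p 1≤4^K (s≤s z≤n)
            (nonempty⇒1≤ X (proj₂ ne)) (∣p∣≤n X) (outer-rank X X⊆ ne) 1≤M D^p≤ dense₂)
          (s≤s z≤n)

      -- A chunk fails if the first round leaves no near packing or if all attempts at the outer
      -- edges miss. Each event has probability at most `1 / Z`, whence the 2.
      block-bound : ∀ Z → 2 ^ (m₁ * e) * 2 ^ suc spare ≤ μ₁ ^ suc spare → Z ≤ 2 ^ suc spare → Z * (R * 4) ^ A ≤ suc μ₀ ^ A →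
        Z * 𝔼ᴿ d (suc (A * R)) fail ⊥ ≤ 2 * Ω ^ suc (A * R)
      block-bound Z μ₁-large Z≤₁ Z≤₂ = begin
        Z * 𝔼 1 d (λ W → 𝔼ᴿ d (A * R) fail (⊥ ∪ W)) ≡⟨ 𝔼-*ˡ 1 d Z _ ⟨
        𝔼 1 d (λ W → Z * 𝔼ᴿ d (A * R) fail (⊥ ∪ W)) ≤⟨ 𝔼-mono 1 d perW ⟩
        𝔼 1 d (λ W → Z * Ω ^ (A * R) * 𝟙 (¬? (Near₁.near? W)) + Ω ^ (A * R)) ≡⟨ trans (𝔼-+ 1 d _ _) (cong₂ _+_ (𝔼-*ˡ 1 d (Z * Ω ^ (A * R)) _) (𝔼-const 1 d {N} _)) ⟩
        Z * Ω ^ (A * R) * 𝔼 1 d (λ W → 𝟙 (¬? (Near₁.near? W))) + Ω * Ω ^ (A * R)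
          ≤⟨ +-monoˡ-≤ (Ω * Ω ^ (A * R)) (≤-trans (≤-reflexive (lem₁ Z (Ω ^ (A * R)) Y)) (*-monoʳ-≤ (Ω ^ (A * R)) far)) ⟩
        Ω ^ (A * R) * Ω + Ω * Ω ^ (A * R) ≡⟨ lem₂ Ω (Ω ^ (A * R)) ⟩
        2 * (Ω * Ω ^ (A * R)) ∎
        where
        open ≤-Reasoning
        Y = 𝔼 1 d (λ W → 𝟙 (¬? (Near₁.near? W)))
        lem₁ : ∀ a b c → a * b * c ≡ b * (a * c)
        lem₁ = solve-∀
        lem₂ : ∀ a b → b * a + a * b ≡ 2 * (a * b)
        lem₂ = solve-∀
        lem₃ : ∀ a b c → a * (b * c) ≡ a * b * c
        lem₃ = solve-∀
        far : Z * Y ≤ Ω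
        far = ≤-trans (*-monoˡ-≤ Y Z≤₁) (*-cancelˡ-≤ (2 ^ (m₁ * e)) ⦃ m^n≢0 2 (m₁ * e) ⦄ (begin
          2 ^ (m₁ * e) * (2 ^ suc spare * Y) ≡⟨ lem₃ (2 ^ (m₁ * e)) (2 ^ suc spare) Y ⟩
          2 ^ (m₁ * e) * 2 ^ suc spare * Y ≤⟨ *-monoˡ-≤ Y μ₁-large ⟩
          μ₁ ^ suc spare * Y ≤⟨ Near₁.near-bound ⟩
          Ω * 2 ^ (m₁ * e) ≡⟨ *-comm Ω _ ⟩
          2 ^ (m₁ * e) * Ω ∎))
        perW : ∀ W → Z * 𝔼ᴿ d (A * R) fail (⊥ ∪ W) ≤ Z * Ω ^ (A * R) * 𝟙 (¬? (Near₁.near? W)) + Ω ^ (A * R)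
        perW W = subst (λ V → Z * 𝔼ᴿ d (A * R) fail V ≤ Z * Ω ^ (A * R) * 𝟙 (¬? (Near₁.near? W)) + Ω ^ (A * R)) (sym (∪-identityˡ W))
          (split (Near₁.near? W) (*-monoʳ-≤ Z trivial) nearby)
          where
          trivial : 𝔼ᴿ d (A * R) fail W ≤ Ω ^ (A * R)
          trivial = ≤-trans (𝔼ᴿ-mono d (A * R) W λ V _ → 𝟙≤1 (¬? (blockFactor? V))) (≤-reflexive (trans (𝔼ᴿ-const d (A * R) 1 W) (*-identityʳ _)))
          split : {P : Set} (dec : Dec P) {x a b : ℕ} → x ≤ a → (P → x ≤ b) → x ≤ a * 𝟙 (¬? dec) + b
          split (yes pf) le f = ≤-trans (f pf) (m≤n+m _ _)
          split (no _) {a = a} le f = ≤-trans le (≤-trans (≤-reflexive (sym (*-identityʳ a))) (m≤m+n _ _))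
          nearby : Any (λ S → ∣ S ─ W ∣ ≤ spare) T₁.copies → Z * 𝔼ᴿ d (A * R) fail W ≤ Ω ^ (A * R)
          nearby near = *-cancelˡ-≤ ((R * 4) ^ A) ⦃ m^n≢0 (R * 4) A ⦃ m*n≢0 R 4 ⦃ >-nonZero 1≤R ⦄ ⦄ ⦄ (begin
            (R * 4) ^ A * (Z * 𝔼ᴿ d (A * R) fail W) ≡⟨ lem₄ ((R * 4) ^ A) Z _ ⟩
            Z * (R * 4) ^ A * 𝔼ᴿ d (A * R) fail W ≤⟨ *-monoˡ-≤ (𝔼ᴿ d (A * R) fail W) Z≤₂ ⟩
            suc μ₀ ^ A * 𝔼ᴿ d (A * R) fail W ≤⟨ after-near W near ⟩
            (R * 4 * Ω ^ R) ^ A ≡⟨ ^-distribʳ-* A (R * 4) (Ω ^ R) ⟩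
            (R * 4) ^ A * (Ω ^ R) ^ A ≡⟨ cong ((R * 4) ^ A *_) (trans (^-*-assoc Ω R A) (cong (Ω ^_) (*-comm R A))) ⟩
            (R * 4) ^ A * Ω ^ (A * R) ∎)
            where
            lem₄ : ∀ a b c → a * (b * c) ≡ b * a * c
            lem₄ = solve-∀

-- The factor by which the edge density exceeds 1 / M^(1/d*), large enough for exponentially small failure probabilities.
piece-margin : Graph → ℕ
piece-margin F = 2 ^ (2 * (k F * length (E F)) + 1)

block-success : (F : Graph) (unbalanced : ¬ VertexBalanced F) (p q : ℕ) (1≤q : 1 ≤ q) (dstar : IsDStar F p q)
  (n : ℕ) (x₀ : Fin (EdgeIndex.N n)) (v₀ : Fin n) (M : ℕ) (1≤M : 1 ≤ M) (vs : List (Fin n)) → Unique vs → length vs ≡ k F * M →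
  (d μ₀ : ℕ) → 4 ≤ suc μ₀ → (4 ^ k F * (suc d * piece-margin F)) ^ p ≤ M ^ q → (4 ^ k F * (suc μ₀ * suc μ₀)) ^ (p * length (E F)) ≤ M →
  (A R : ℕ) → 1 ≤ R → M * length (E F) < suc μ₀ ^ R → (Z : ℕ) → (∀ r → M < suc r * k F → Z ≤ 2 ^ suc r) → Z * (R * 4) ^ A ≤ suc μ₀ ^ A →
  Σ (Subset (EdgeIndex.N n) → ℕ) λ bad → (∀ V → bad V ≡ 0 → BlockFactors.BlockFactor F n x₀ M vs V) ×
    Z * 𝔼ᴿ d (suc (A * R)) bad ⊥ ≤ 2 * (suc d ^ EdgeIndex.N n) ^ suc (A * R)
block-success F unbalanced p q 1≤q dstar n x₀ v₀ M 1≤M vs vs-unique length-vs d μ₀ 4≤μ dense₁ dense₂ A R 1≤R sizes Z Z≤₁ Z≤₂ =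
  Pr.fail , (λ V → 𝟙¬≡0 (BlockFactors.blockFactor? F n x₀ M vs V)) , Pr.block-bound A R 1≤R sizes Z large (Z≤₁ B.spare M<) Z≤₂
  where
  module B = Block F unbalanced p q 1≤q dstar n x₀ v₀ M 1≤M vs vs-unique length-vs
  module Pr = B.Probability d (piece-margin F) μ₀ (>-nonZero⁻¹ (piece-margin F) ⦃ m^n≢0 2 (2 * (k F * length (E F)) + 1) ⦄) 4≤μ dense₁ dense₂
  M< : M < suc B.spare * k F
  M< = <-≤-trans (M<suc[M/k]*k M B.k′) (*-monoʳ-≤ (suc B.spare) (≤-trans (n≤1+n B.k′) (≤-reflexive B.suc-k′)))
  margin : ∀ M s e K → s ≤ M → M < suc s * K → 2 ^ ((M + s) * e) * 2 ^ suc s ≤ (2 ^ (2 * (K * e) + 1)) ^ suc s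
  margin M s e K s≤M M< = begin
    2 ^ ((M + s) * e) * 2 ^ suc s ≡⟨ ^-distribˡ-+-* 2 ((M + s) * e) (suc s) ⟨
    2 ^ ((M + s) * e + suc s) ≤⟨ ^-monoʳ-≤ 2 (+-monoˡ-≤ (suc s) (*-monoˡ-≤ e (+-mono-≤ (<⇒≤ M<) (≤-trans s≤M (<⇒≤ M<))))) ⟩
    2 ^ ((suc s * K + suc s * K) * e + suc s) ≡⟨ cong (2 ^_) (lem (suc s) K e) ⟩
    2 ^ ((2 * (K * e) + 1) * suc s) ≡⟨ ^-*-assoc 2 (2 * (K * e) + 1) (suc s) ⟨
    (2 ^ (2 * (K * e) + 1)) ^ suc s ∎
    where
    open ≤-Reasoning
    lem : ∀ s K e → (s * K + s * K) * e + s ≡ (2 * (K * e) + 1) * s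
    lem = solve-∀
  large : 2 ^ (B.m₁ * length (E F)) * 2 ^ suc B.spare ≤ piece-margin F ^ suc B.spare
  large = margin M B.spare (length (E F)) (k F) (m/n≤m M B.k′) M<

-- The strategy

-- Cutting stops once fewer than `2 * s` elements remain, so from an input of length at least `s`,
-- with enough fuel, no chunk is shorter than `s` and no divisible remainder is left over.
chunkify : {A : Set} → ℕ → ℕ → List A → List (List A)
chunkify zero s xs = xs ∷ []
chunkify (suc fuel) s xs = if does (length xs <? 2 * s) then xs ∷ [] else take s xs ∷ chunkify fuel s (drop s xs)

concat-chunkify : {A : Set} (fuel s : ℕ) (xs : List A) → concat (chunkify fuel s xs) ≡ xs
concat-chunkify zero s xs = ++-identityʳ xs
concat-chunkify (suc fuel) s xs = cases (length xs <? 2 * s)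
  where
  cases : {P : Set} (d : Dec P) → concat (if does d then xs ∷ [] else take s xs ∷ chunkify fuel s (drop s xs)) ≡ xs
  cases (yes _) = ++-identityʳ xs
  cases (no _) = trans (cong (take s xs ++_) (concat-chunkify fuel s (drop s xs))) (take++drop≡id s xs)

chunkify-sizes : {A : Set} (K m fuel M : ℕ) (xs : List A) → 1 ≤ m → 1 ≤ K → length xs ≡ K * M → m ≤ M → M ≤ fuel →
  All (λ cs → ∃ λ M′ → m ≤ M′ × length cs ≡ K * M′ × length cs ≤ 2 * (K * m)) (chunkify fuel (K * m) xs)
chunkify-sizes K m zero M xs 1≤m 1≤K eq le fuel = ⊥-elim (<⇒≱ 1≤m (≤-trans le fuel))
chunkify-sizes {A} K m (suc fuel) M xs 1≤m 1≤K eq le M≤ = cases (length xs <? 2 * (K * m))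
  where
  Fine : List A → Set
  Fine cs = ∃ λ M′ → m ≤ M′ × length cs ≡ K * M′ × length cs ≤ 2 * (K * m)
  lem : ∀ K m → K * (m + m) ≡ 2 * (K * m)
  lem = solve-∀
  cases : (d : Dec (length xs < 2 * (K * m))) → All Fine (if does d then xs ∷ [] else take (K * m) xs ∷ chunkify fuel (K * m) (drop (K * m) xs))
  cases (yes lt) = (M , le , eq , <⇒≤ lt) ∷ []
  cases (no big) = (m , ≤-refl , first , ≤-trans (≤-reflexive first) (m≤m+n (K * m) _)) ∷
      chunkify-sizes K m fuel (M ∸ m) (drop (K * m) xs) 1≤m 1≤K
        (trans (length-drop (K * m) xs) (trans (cong (_∸ K * m) eq) (sym (*-distribˡ-∸ K M m))))
        (m+n≤o⇒m≤o∸n m (*-cancelˡ-≤ K ⦃ >-nonZero 1≤K ⦄ (≤-trans (≤-reflexive (lem K m)) (≤-trans (≮⇒≥ big) (≤-reflexive eq)))))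
        (≤-trans (∸-monoʳ-≤ M 1≤m) (∸-monoˡ-≤ 1 M≤))
    where
    first : length (take (K * m) xs) ≡ K * m
    first = trans (length-take (K * m) xs) (m≤n⇒m⊓n≡m (≤-trans (m≤m+n (K * m) _) (≮⇒≥ big)))

perms-↭ : {A : Set} (xs : List A) {π : List A} → π L.∈ perms xs → π ↭ xs
perms-↭ [] (here refl) = ↭-refl
perms-↭ (x ∷ xs) π∈ with L.find (∈-concatMap⁻ (insertions x) {xs = perms xs} π∈)
... | π′ , π′∈ , mem = ↭-trans (insertion x π′ mem) (↭-prep x (perms-↭ xs π′∈))
  where
  insertion : ∀ x π {l} → l L.∈ insertions x π → l ↭ x ∷ π
  insertion x [] (here refl) = ↭-refl
  insertion x (y ∷ π) (here refl) = ↭-refl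
  insertion x (y ∷ π) (there l∈) with ∈-map⁻ (y ∷_) l∈
  ... | l′ , l′∈ , refl = ↭-trans (↭-prep y (insertion x π l′∈)) (↭-swap y x ↭-refl)

unique-↭ : {A : Set} {xs ys : List A} → xs ↭ ys → Unique xs → Unique ys
unique-↭ Perm.refl u = u
unique-↭ (Perm.prep x σ) (x∉ ∷ u) = All-resp-↭ σ x∉ ∷ unique-↭ σ u
unique-↭ (Perm.swap x y σ) ((x≢y ∷ x∉) ∷ y∉ ∷ u) = ((x≢y ∘ sym) ∷ All-resp-↭ σ y∉) ∷ All-resp-↭ σ x∉ ∷ unique-↭ σ u
unique-↭ (Perm.trans σ σ′) u = unique-↭ σ′ (unique-↭ σ u)

module _ {n : ℕ} (s? : Edge n → Bool) where

  -- If the wanted edges among the first `j` fit into the remaining budget, none of them is refused;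
  -- purchases after time `j` only add edges.
  runFrom-⊇ : ∀ b j t hist bought (es : List (Edge n)) → j ≤ t → bought + length (filterᵇ s? (take j es)) ≤ b →
    ∀ {f} → f L.∈ take j es → s? f ≡ true → f L.∈ runFrom (λ _ f → s? f) b hist bought (take t es)
  runFrom-⊇ b (suc j) (suc t) hist bought (x ∷ es) (s≤s j≤t) room f∈ sf with s? x in sx
  runFrom-⊇ b (suc j) (suc t) hist bought (x ∷ es) (s≤s j≤t) room f∈ sf | true
    rewrite dec-true (bought <? b) (≤-trans (m<m+n bought (s≤s z≤n)) room) with f∈
  ... | here refl = here refl
  ... | there f∈′ = there (runFrom-⊇ b j t (x ∷ hist) (suc bought) es j≤t (≤-trans (≤-reflexive (sym (+-suc bought _))) room) f∈′ sf)
  runFrom-⊇ b (suc j) (suc t) hist bought (x ∷ es) (s≤s j≤t) room (here refl) sf | false with trans (sym sf) sx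
  ... | ()
  runFrom-⊇ b (suc j) (suc t) hist bought (x ∷ es) (s≤s j≤t) room (there f∈) sf | false =
    runFrom-⊇ b j t (x ∷ hist) bought es j≤t room f∈ sf

FactorOn : (F : Graph) {n : ℕ} (B : List (Edge n)) (vs : List (Fin n)) → Set
FactorOn F {n} B vs = Σ ℕ λ m → (m * k F ≡ length vs) × Σ (Fin m → Fin (k F) → Fin n) λ ψ →
  (∀ i j → ψ i j L.∈ vs) × (∀ i i′ j j′ → ψ i j ≡ ψ i′ j′ → i ≡ i′ × j ≡ j′) ×
  (∀ i → All (λ f → Adj B (ψ i (proj₁ f)) (ψ i (proj₂ f))) (E F))

factor-++ : (F : Graph) {n : ℕ} (B : List (Edge n)) (vs ws : List (Fin n)) → (∀ {v} → v L.∈ vs → v L.∈ ws → Data.Empty.⊥) →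
  FactorOn F B vs → FactorOn F B ws → FactorOn F B (vs ++ ws)
factor-++ F {n} B vs ws disjoint (m , eq , ψ , mem , inj , edges) (m′ , eq′ , ψ′ , mem′ , inj′ , edges′) =
  m + m′ , trans (*-distribʳ-+ (k F) m m′) (trans (cong₂ _+_ eq eq′) (sym (length-++ vs))) , χ₀ ,
  (λ i j → mem₀ (Fin.splitAt m i) j) , inj₀ , λ i → edges₀ (Fin.splitAt m i)
  where
  χ⊎ : Fin m ⊎ Fin m′ → Fin (k F) → Fin n
  χ⊎ (inj₁ i) = ψ i
  χ⊎ (inj₂ i) = ψ′ i
  χ₀ : Fin (m + m′) → Fin (k F) → Fin n
  χ₀ i = χ⊎ (Fin.splitAt m i)
  mem₀ : ∀ i j → χ⊎ i j L.∈ vs ++ ws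
  mem₀ (inj₁ i) j = ∈-++⁺ˡ (mem i j)
  mem₀ (inj₂ i) j = ∈-++⁺ʳ vs (mem′ i j)
  edges₀ : ∀ i → All (λ f → Adj B (χ⊎ i (proj₁ f)) (χ⊎ i (proj₂ f))) (E F)
  edges₀ (inj₁ i) = edges i
  edges₀ (inj₂ i) = edges′ i
  inj⊎ : ∀ i i′ j j′ → χ⊎ i j ≡ χ⊎ i′ j′ → i ≡ i′ × j ≡ j′
  inj⊎ (inj₁ i) (inj₁ i′) j j′ eq with inj i i′ j j′ eq
  ... | i≡ , j≡ = cong inj₁ i≡ , j≡
  inj⊎ (inj₁ i) (inj₂ i′) j j′ eq = ⊥-elim (disjoint (mem i j) (subst (L._∈ ws) (sym eq) (mem′ i′ j′)))
  inj⊎ (inj₂ i) (inj₁ i′) j j′ eq = ⊥-elim (disjoint (mem i′ j′) (subst (L._∈ ws) eq (mem′ i j)))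
  inj⊎ (inj₂ i) (inj₂ i′) j j′ eq with inj′ i i′ j j′ eq
  ... | i≡ , j≡ = cong inj₂ i≡ , j≡
  inj₀ : ∀ i i′ j j′ → χ₀ i j ≡ χ₀ i′ j′ → i ≡ i′ × j ≡ j′
  inj₀ i i′ j j′ eq with inj⊎ (Fin.splitAt m i) (Fin.splitAt m i′) j j′ eq
  ... | i≡ , j≡ = trans (sym (FinP.join-splitAt m m′ i)) (trans (cong (Fin.join m m′) i≡) (FinP.join-splitAt m m′ i′)) , j≡

unique-++⁻ : {A : Set} (xs : List A) {ys : List A} → Unique (xs ++ ys) → Unique xs × Unique ys × (∀ {v} → v L.∈ xs → v L.∈ ys → Data.Empty.⊥)
unique-++⁻ [] u = [] , u , λ ()
unique-++⁻ (x ∷ xs) {ys} (x∉ ∷ u) with unique-++⁻ xs u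
... | u₁ , u₂ , dis = AllP.tabulate (λ z∈ → AllP.lookup x∉ (∈-++⁺ˡ z∈)) ∷ u₁ , u₂ ,
      λ { (here refl) v∈ → AllP.lookup x∉ (∈-++⁺ʳ xs v∈) refl ; (there v∈xs) v∈ → dis v∈xs v∈ }

factor-concat : (F : Graph) {n : ℕ} (B : List (Edge n)) (css : List (List (Fin n))) → Unique (concat css) →
  (∀ {cs} → cs L.∈ css → FactorOn F B cs) → FactorOn F B (concat css)
factor-concat F B [] u fs = 0 , refl , (λ ()) , (λ ()) , (λ ()) , λ ()
factor-concat F B (cs ∷ css) u fs with unique-++⁻ cs u
... | _ , u₂ , dis = factor-++ F B cs (concat css) dis (fs (here refl)) (factor-concat F B css u₂ (fs ∘ there))

chunk-unique : {A : Set} (css : List (List A)) → Unique (concat css) → ∀ {cs} → cs L.∈ css → Unique cs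
chunk-unique (cs ∷ css) u (here refl) = proj₁ (unique-++⁻ cs u)
chunk-unique (cs ∷ css) u (there cs∈) = chunk-unique css (proj₁ (proj₂ (unique-++⁻ cs u))) cs∈

module Chunks {n : ℕ} (css : List (List (Fin n))) where

  open EdgeIndex n using (X; N; allEdges-unique)
  open import Data.List.Membership.DecPropositional (FinP._≟_ {n}) using () renaming (_∈?_ to _∈ᴸ?_)

  Together : Edge n → List (Fin n) → Set
  Together f cs = proj₁ f L.∈ cs × proj₂ f L.∈ cs

  together? : ∀ f cs → Dec (Together f cs)
  together? f cs = (proj₁ f ∈ᴸ? cs) ×-dec (proj₂ f ∈ᴸ? cs)

  joined? : ∀ f → Dec (Any (Together f) css)
  joined? f = any? (together? f) css

  inChunks : Subset N
  inChunks = comprehend (λ i → joined? (lookup X i))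

  buy : Strategy n
  buy _ f = does (joined? f)

  -- A chunk contributes at most the square of its length, and the squares sum to at most the
  -- maximal length times the total.
  ∣inChunks∣≤ : ∀ s → (∀ {cs} → cs L.∈ css → length cs ≤ s) → ∣ inChunks ∣ ≤ s * length (concat css)
  ∣inChunks∣≤ s small = begin
    ∣ inChunks ∣ ≡⟨ trans (∣∣-∑ inChunks) (∑-cong (allFin N) λ i → 𝟙-cong (i ∈? inChunks) (joined? (lookup X i))
        (∈-comprehend⁻ (λ i → joined? (lookup X i))) (∈-comprehend⁺ (λ i → joined? (lookup X i)))) ⟩
    ∑ (allFin N) (λ i → 𝟙 (joined? (lookup X i))) ≡⟨ ∑-lookup X (λ f → 𝟙 (joined? f)) ⟨
    ∑ X (λ f → 𝟙 (joined? f)) ≤⟨ ∑-mono X (λ f → 𝟙-elim (joined? f) λ any → let (cs , cs∈ , tog) = L.find any in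
        ≤-trans (≤-reflexive (sym (𝟙-yes (together? f cs) tog))) (∑-term css (λ cs → 𝟙 (together? f cs)) cs∈)) ⟩
    ∑ X (λ f → ∑ css (λ cs → 𝟙 (together? f cs))) ≡⟨ ∑-swap X css _ ⟩
    ∑ css (λ cs → ∑ X (λ f → 𝟙 (together? f cs))) ≤⟨ ∑-mono-∈ css (λ {cs} cs∈ → ≤-trans (pairs cs) (*-monoˡ-≤ (length cs) (small cs∈))) ⟩
    ∑ css (λ cs → s * length cs) ≡⟨ ∑-*ˡ css s length ⟩
    s * ∑ css length ≡⟨ cong (s *_) (lengths css) ⟩
    s * length (concat css) ∎
    where
    open ≤-Reasoning
    lengths : (css : List (List (Fin n))) → ∑ css length ≡ length (concat css)
    lengths [] = refl
    lengths (cs ∷ css) = trans (cong (length cs +_) (lengths css)) (sym (length-++ cs))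
    pairs : ∀ cs → ∑ X (λ f → 𝟙 (together? f cs)) ≤ length cs * length cs
    pairs cs = ≤-trans (≤-reflexive (sym (length-filter-∑ (λ f → together? f cs) X))) (≤-trans
      (unique-⊆-length (≡-dec FinP._≟_ FinP._≟_) (filter (λ f → together? f cs) X) (cartesianProduct cs cs) (UniqueP.filter⁺ (λ f → together? f cs) allEdges-unique)
        λ f∈ → let tog = proj₂ (∈-filter⁻ (λ f → together? f cs) {xs = X} f∈) in ∈-cartesianProduct⁺ (proj₁ tog) (proj₂ tog))
      (≤-reflexive (length-cartesianProduct cs cs)))

T-does : {P : Set} (d : Dec P) → Bool.T (does d) → P
T-does (yes p) _ = p

≡0-+ˡ : ∀ a b → a + b ≡ 0 → a ≡ 0
≡0-+ˡ zero b eq = refl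

≡0-+ʳ : ∀ a b → a + b ≡ 0 → b ≡ 0
≡0-+ʳ zero b eq = eq

FactorIn : (F : Graph) (n : ℕ) → Fin (EdgeIndex.N n) → Subset (EdgeIndex.N n) → List (Fin n) → Set
FactorIn F n x₀ V cs = Σ ℕ λ M → (M * k F ≡ length cs) × Σ (Fin M → Fin (k F) → Fin n) λ φ →
  (∀ c y → φ c y L.∈ cs) × (∀ c c′ y y′ → φ c y ≡ φ c′ y′ → c ≡ c′ × y ≡ y′) ×
  (∀ c x → EdgeIndex.idx n x₀ (φ c (Structure.src F x)) (φ c (Structure.tgt F x)) ∈ V)

module _ (F : Graph) (n : ℕ) (x₀ : Fin (EdgeIndex.N n)) where

  open Structure F
  open EdgeIndex n
  open BlockFactors F n x₀ using (BlockFactor; Embedded)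

  block⇒factor : ∀ M cs → length cs ≡ k F * M → ∀ V → BlockFactor M cs V → FactorIn F n x₀ V cs
  block⇒factor M cs len V ok with L.find ok
  ... | φs , φs∈ , inj , edges = M , trans (*-comm M (k F)) (sym len) , (λ c y → Vec.lookup (Vec.lookup φs c) y) ,
        (λ c y → ∈-choices⁻ (λ _ → cs) (∈-choices⁻ (λ _ → choices (λ _ → cs)) φs∈ c) y) , inj , edges

module Favourable (F : Graph) (n : ℕ) (x₀ : Fin (EdgeIndex.N n)) (css : List (List (Fin n))) (concat-css : concat css ≡ allFin n) where

  open Structure F
  open EdgeIndex n
  open Chunks css
  open Indicator (≡-dec (FinP._≟_ {n}) (FinP._≟_ {n}))

  positions-≤ : (l : List (Edge n)) → Unique l → (∀ {f} → f L.∈ l → f L.∈ X) → (P : Subset N) →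
    (∀ i → lookup X i L.∈ l → i ∈ P) → length l ≤ ∣ P ∣
  positions-≤ l u l⊆X P mem = ≤-trans (unique-⊆-length (≡-dec FinP._≟_ FinP._≟_) l (map (lookup X) (elements P)) u sub′)
      (≤-reflexive (trans (length-map (lookup X) (elements P)) (length-elements P)))
    where
    sub′ : ∀ {f} → f L.∈ l → f L.∈ map (lookup X) (elements P)
    sub′ {f} f∈ = subst (L._∈ map (lookup X) (elements P)) (sym at) (∈-map⁺ (lookup X) (∈-elements⁺ P (mem _ (subst (L._∈ l) at f∈))))
      where
      at : f ≡ lookup X (Any.index (l⊆X f∈))
      at = lookup-index (l⊆X f∈)

  module _ (t b : ℕ) (π : List (Edge n)) (π∈ : π L.∈ orderings n) (j : ℕ) (j≤N : j ≤ N) where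

    l : List (Edge n)
    l = take j π

    V : Subset N
    V = χ X l

    π↭X : π ↭ X
    π↭X = perms-↭ X π∈

    l-unique : Unique l
    l-unique = UniqueP.take⁺ j (unique-↭ (↭-sym π↭X) allEdges-unique)

    l⊆X : ∀ {f} → f L.∈ l → f L.∈ X
    l⊆X f∈ = ∈-resp-↭ π↭X (subst (_ L.∈_) (take++drop≡id j π) (∈-++⁺ˡ f∈))

    -- `V` consists of the first `j` edges. Its size being at most `t` means that this prefix is
    -- presented in time, and the bound on `inChunks` that all its wanted edges are affordable. The
    -- factors of the chunks use only edges inside chunks.
    favourable : (∀ {cs} → cs L.∈ css → FactorIn F n x₀ V cs) → ∣ V ∩ ⊤ ∣ ≤ t → ∣ V ∩ inChunks ∣ ≤ b → HasFactor F n (Bt buy t b π)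
    favourable factors time budget = finish (subst (FactorOn F B) concat-css (factor-concat F B css
        (subst Unique (sym concat-css) (UniqueP.allFin⁺ n)) λ cs∈ → on cs∈ (factors cs∈)))
      where
      B : List (Edge n)
      B = Bt buy t b π
      finish : FactorOn F B (allFin n) → HasFactor F n B
      finish (M , eq , ψ , _ , inj , edges) = M , trans eq (length-tabulate {n = n} id) , ψ , inj , edges
      j≤t : j ≤ t
      j≤t = begin
        j ≡⟨ m≤n⇒m⊓n≡m (≤-trans j≤N (≤-reflexive (sym (length-perms-∈ X π∈)))) ⟨
        j ⊓ length π ≡⟨ length-take j π ⟨
        length l ≤⟨ positions-≤ l l-unique l⊆X (V ∩ ⊤) (λ i i∈ → x∈p∩q⁺ (χ-∈⁺ X l i i∈ , ∈⊤)) ⟩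
        ∣ V ∩ ⊤ ∣ ≤⟨ time ⟩
        t ∎
        where open ≤-Reasoning
      s? : Edge n → Bool
      s? f = does (joined? f)
      room : length (filterᵇ s? l) ≤ b
      room = ≤-trans (positions-≤ (filterᵇ s? l) (UniqueP.filter⁺ (T? ∘ s?) l-unique) (λ f∈ → l⊆X (proj₁ (∈-filter⁻ (T? ∘ s?) f∈)))
          (V ∩ inChunks) λ i i∈ → let split = ∈-filter⁻ (T? ∘ s?) {xs = l} i∈ in
            x∈p∩q⁺ (χ-∈⁺ X l i (proj₁ split) , ∈-comprehend⁺ (λ i → joined? (lookup X i)) (T-does (joined? (lookup X i)) (proj₂ split)))) budget
      bought : ∀ {f cs} → cs L.∈ css → f L.∈ l → Together f cs → f L.∈ B
      bought {f} cs∈ f∈ tog = runFrom-⊇ s? b j t [] 0 π j≤t room f∈ (dec-true (joined? f) (L.lose cs∈ tog))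
      on : ∀ {cs} → cs L.∈ css → FactorIn F n x₀ V cs → FactorOn F B cs
      on {cs} cs∈ (M , eq , φ , mem , inj , edges) = M , eq , φ , mem , (λ c c′ y y′ → inj c c′ y y′) , λ c → AllP.tabulate (adj c)
        where
        adjacent : ∀ {a a′} → a L.∈ cs → a′ L.∈ cs → a ≢ a′ → idx x₀ a a′ ∈ V → Adj B a a′
        adjacent a∈ a′∈ a≢a′ i∈ with lookup-idx x₀ a≢a′
        ... | inj₁ e₁ = inj₁ (bought cs∈ (subst (L._∈ l) e₁ (χ-∈ X l i∈)) (a∈ , a′∈))
        ... | inj₂ e₁ = inj₂ (bought cs∈ (subst (L._∈ l) e₁ (χ-∈ X l i∈)) (a′∈ , a∈))
        adj : ∀ c {f} → f L.∈ E F → Adj B (φ c (proj₁ f)) (φ c (proj₂ f))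
        adj c {f} f∈ = subst (λ f → Adj B (φ c (proj₁ f)) (φ c (proj₂ f))) (sym (lookup-index f∈))
          (adjacent (mem c (src x)) (mem c (tgt x)) (λ eq → src≢tgt x (proj₂ (inj c c (src x) (tgt x) eq))) (edges c x))
          where
          x : Fin e
          x = Any.index f∈

module Transfer (F : Graph) (n : ℕ) (d Rt : ℕ) (bad : Subset (EdgeIndex.N n) → ℕ) (t b : ℕ) (s : Strategy n) where

  open EdgeIndex n
  open Indicator (≡-dec (FinP._≟_ {n}) (FinP._≟_ {n}))

  -- An ordering counts as good as soon as one of its prefixes is not bad. Any other ordering has
  -- `bad ≥ 1` at every prefix length, which is what `ordering≤product` asks; no prefix length has
  -- to be fixed in advance.
  success-probability : (∀ {π} → π L.∈ orderings n → ∀ j → j ≤ N → bad (χ X (take j π)) ≡ 0 → HasFactor F n (Bt s t b π)) →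
    ∀ mm → mm * 𝔼ᴿ d Rt bad ⊥ ≤ (suc d ^ N) ^ Rt → SuccProbAtLeast F n t b (s ∷ []) mm
  success-probability ok mm small = length ys , (ys , filter-⊆ good? outcomes , ≤-refl , AllP.tabulate sound) , bound
    where
    outcomes : List (Strategy n × List (Edge n))
    outcomes = cartesianProduct (s ∷ []) (orderings n)
    Good : List (Edge n) → Set
    Good π = Any (λ j → bad (χ X (take j π)) ≡ 0) (downFrom (suc N))
    goodπ? : ∀ π → Dec (Good π)
    goodπ? π = any? (λ j → bad (χ X (take j π)) ≟ 0) (downFrom (suc N))
    good? : ∀ o → Dec (Good (proj₂ o))
    good? o = goodπ? (proj₂ o)
    ys = filter good? outcomes
    downFrom-< : ∀ {n j} → j L.∈ downFrom n → j < n
    downFrom-< {suc n} (here refl) = ≤-refl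
    downFrom-< {suc n} (there j∈) = m≤n⇒m≤1+n (downFrom-< j∈)
    downFrom-∈ : ∀ {n j} → j < n → j L.∈ downFrom n
    downFrom-∈ {suc n} lt with m≤n⇒m<n∨m≡n (≤-pred lt)
    ... | inj₁ j<n = there (downFrom-∈ j<n)
    ... | inj₂ refl = here refl
    sound : ∀ {o} → o L.∈ ys → HasFactor F n (Bt (proj₁ o) t b (proj₂ o))
    sound {o} o∈ with ∈-filter⁻ good? {xs = outcomes} o∈
    ... | o∈out , good with ∈-cartesianProduct⁻ (s ∷ []) (orderings n) o∈out | L.find good
    ...   | here refl , π∈ | j , j∈ , zero-bad = ok π∈ j (≤-pred (downFrom-< j∈)) zero-bad
    fail : List (Edge n) → ℕ
    fail π = 𝟙 (¬? (goodπ? π))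
    total≡ : length outcomes ≡ length (orderings n)
    total≡ = trans (length-cartesianProduct (s ∷ []) (orderings n)) (*-identityˡ _)
    failures : length outcomes ∸ length ys ≡ ∑ (orderings n) fail
    failures = trans (cong₂ _∸_ (sym (∑-filter-≤ good? outcomes)) (length-filter-∑ good? outcomes)) (trans (m+n∸m≡n (∑ outcomes (λ o → 𝟙 (good? o))) (∑ outcomes (λ o → 𝟙 (¬? (good? o)))))
      (trans (∑-cartesianProduct (s ∷ []) (orderings n) (λ o → 𝟙 (¬? (good? o)))) (+-identityʳ _)))
    product = 𝔼ᴿ-product d Rt
    h = proj₁ product
    g′ = proj₁ (proj₂ product)
    ψ : List (Edge n) → ℕ
    ψ l = bad (χ X l)
    dominated : ∑ (orderings n) fail * (h + g′) ^ N ≤ length (orderings n) * 𝔼 h g′ (λ W → ψ (select X W))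
    dominated = ordering≤product h g′ X ψ (λ ys x y l → cong bad (χ-swap X ys x y l)) fail λ j j≤N {π} _ →
      𝟙-elim (¬? (goodπ? π)) λ notgood → n≢0⇒n>0 λ zero-bad → notgood (L.lose (downFrom-∈ (s≤s j≤N)) zero-bad)
    expectation : 𝔼 h g′ (λ W → ψ (select X W)) ≡ 𝔼ᴿ d Rt bad ⊥
    expectation = trans (𝔼-cong h g′ λ W → cong bad (trans (χ-select X allEdges-unique W) (sym (∪-identityˡ W))))
      (sym (proj₂ (proj₂ (proj₂ product)) bad ⊥))
    mass : (h + g′) ^ N ≡ (suc d ^ N) ^ Rt
    mass = trans (cong (_^ N) (proj₁ (proj₂ (proj₂ product)))) (trans (^-*-assoc (suc d) Rt N) (trans (cong (suc d ^_) (*-comm Rt N)) (sym (^-*-assoc (suc d) N Rt))))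
    bound : (length outcomes ∸ length ys) * mm ≤ length outcomes
    bound = *-cancelʳ-≤ _ _ ((suc d ^ N) ^ Rt) ⦃ m^n≢0 (suc d ^ N) Rt ⦃ m^n≢0 (suc d) N ⦄ ⦄ (begin
      (length outcomes ∸ length ys) * mm * Q ≡⟨ cong (λ z → z * mm * Q) failures ⟩
      Fs * mm * Q ≡⟨ lem₁ Fs mm Q ⟩
      mm * (Fs * Q) ≡⟨ cong (λ z → mm * (Fs * z)) mass ⟨
      mm * (Fs * (h + g′) ^ N) ≤⟨ *-monoʳ-≤ mm dominated ⟩
      mm * (length (orderings n) * 𝔼 h g′ (λ W → ψ (select X W))) ≡⟨ cong (λ z → mm * (length (orderings n) * z)) expectation ⟩
      mm * (length (orderings n) * 𝔼ᴿ d Rt bad ⊥) ≡⟨ lem₂ mm (length (orderings n)) (𝔼ᴿ d Rt bad ⊥) ⟩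
      length (orderings n) * (mm * 𝔼ᴿ d Rt bad ⊥) ≤⟨ *-monoʳ-≤ (length (orderings n)) small ⟩
      length (orderings n) * Q ≡⟨ cong (_* Q) total≡ ⟨
      length outcomes * Q ∎)
      where
      open ≤-Reasoning
      Q = (suc d ^ N) ^ Rt
      Fs = ∑ (orderings n) fail
      lem₁ : ∀ a b c → a * b * c ≡ b * (a * c)
      lem₁ = solve-∀
      lem₂ : ∀ a b c → a * (b * c) ≡ b * (a * c)
      lem₂ = solve-∀

-- Choice of the parameters

two-vertices : (n : ℕ) → 2 ≤ n → Fin n × Fin (EdgeIndex.N n)
two-vertices (suc (suc n)) (s≤s (s≤s z≤n)) = zero , Any.index (EdgeIndex.∈-allEdges (suc (suc n)) {zero} {suc zero} (s≤s z≤n))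

length-concat-≥ : {A : Set} (css : List (List A)) → (∀ {cs} → cs L.∈ css → 1 ≤ length cs) → length css ≤ length (concat css)
length-concat-≥ [] pos = z≤n
length-concat-≥ (cs ∷ css) pos = ≤-trans (+-mono-≤ (pos (here refl)) (length-concat-≥ css (pos ∘ there))) (≤-reflexive (sym (length-++ cs)))

module _ (d Rt : ℕ) {N : ℕ} {A : Set} (P : Subset N → A → Set) (Z B : ℕ) where

  union-bound : (xs : List A) →
    (∀ {x} → x L.∈ xs → Σ (Subset N → ℕ) λ bad → (∀ V → bad V ≡ 0 → P V x) × Z * 𝔼ᴿ d Rt bad ⊥ ≤ B) →
    Σ (Subset N → ℕ) λ bad → (∀ V → bad V ≡ 0 → ∀ {x} → x L.∈ xs → P V x) × Z * 𝔼ᴿ d Rt bad ⊥ ≤ length xs * B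
  union-bound [] each = (λ _ → 0) , (λ V _ ()) , ≤-reflexive (trans (cong (Z *_) (trans (𝔼ᴿ-const d Rt 0 ⊥) (*-zeroʳ ((suc d ^ N) ^ Rt)))) (*-zeroʳ Z))
  union-bound (x ∷ xs) each with each (here refl) | union-bound xs (each ∘ there)
  ... | bad₁ , ok₁ , le₁ | bad₂ , ok₂ , le₂ = (λ V → bad₁ V + bad₂ V) ,
      (λ { V zero-bad (here refl) → ok₁ V (≡0-+ˡ (bad₁ V) (bad₂ V) zero-bad) ; V zero-bad (there x∈) → ok₂ V (≡0-+ʳ (bad₁ V) (bad₂ V) zero-bad) x∈ }) ,
      ≤-trans (≤-reflexive (trans (cong (Z *_) (𝔼ᴿ-+ d Rt bad₁ bad₂ ⊥)) (*-distribˡ-+ Z _ _))) (+-mono-≤ le₁ le₂)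

module Finite (F : Graph) (unbalanced : ¬ VertexBalanced F) (p q : ℕ) (1≤q : 1 ≤ q) (dstar : IsDStar F p q) where

  open Structure F
  open WithDensity unbalanced p q 1≤q dstar

  private
    K = k F

  1≤K : 1 ≤ K
  1≤K = <⇒≤ 2≤k

  -- The value `4 * mm * n` leaves room for a union bound over at most `n` chunks. `y₁` and `y₂`
  -- bound the expected numbers of all edges and of edges inside chunks in one round, so that
  -- `Tail.tail` yields the time and the budget.
  module _ (n n′ m d μ₀ t A R y₁ y₂ mm : ℕ) (n≡ : n ≡ K * n′) (1≤m : 1 ≤ m) (m≤n′ : m ≤ n′) (1≤R : 1 ≤ R) (4≤μ : 4 ≤ suc μ₀)
    (dense₁ : (4 ^ K * (suc d * piece-margin F)) ^ p ≤ m ^ q) (dense₂ : (4 ^ K * (suc μ₀ * suc μ₀)) ^ (p * e) ≤ m)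
    (sizes : n * e < suc μ₀ ^ R)
    (Z≤₁ : ∀ r → m < suc r * K → 4 * mm * n ≤ 2 ^ suc r)
    (Z≤₂ : 4 * mm * n * (R * 4) ^ A ≤ suc μ₀ ^ A)
    (time : n * n ≤ y₁ * suc d) (time′ : 4 * (y₁ * suc (A * R)) ≤ t)
    (budget : 2 * (K * m) * n ≤ y₂ * suc d)
    (mm≤₁ : 4 * mm ≤ 4 ^ (y₁ * suc (A * R))) (mm≤₂ : 4 * mm ≤ 4 ^ (y₂ * suc (A * R))) where

    open EdgeIndex n

    private
      Rt Ωt b : ℕ
      Rt = suc (A * R)
      Ωt = (suc d ^ N) ^ Rt
      b = 4 * (y₂ * Rt)

    css : List (List (Fin n))
    css = chunkify n (K * m) (allFin n)

    private
      1≤n′ : 1 ≤ n′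
      1≤n′ = ≤-trans 1≤m m≤n′

      2≤n : 2 ≤ n
      2≤n = ≤-trans (*-mono-≤ 2≤k 1≤n′) (≤-reflexive (sym n≡))

      v₀ : Fin n
      v₀ = proj₁ (two-vertices n 2≤n)

      x₀ : Fin N
      x₀ = proj₂ (two-vertices n 2≤n)

      n′≤n : n′ ≤ n
      n′≤n = ≤-trans (≤-trans (≤-reflexive (sym (*-identityˡ n′))) (*-monoˡ-≤ n′ 1≤K)) (≤-reflexive (sym n≡))

      concat-css : concat css ≡ allFin n
      concat-css = concat-chunkify n (K * m) (allFin n)

      chunk-size : ∀ {cs} → cs L.∈ css → ∃ λ M → m ≤ M × length cs ≡ K * M × length cs ≤ 2 * (K * m)
      chunk-size = AllP.lookup (chunkify-sizes K m n n′ (allFin n) 1≤m 1≤K (trans (length-tabulate {n = n} id) n≡) m≤n′ n′≤n)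

      chunks-unique : Unique (concat css)
      chunks-unique = subst Unique (sym concat-css) (UniqueP.allFin⁺ n)

      opaque
       single : ∀ {cs} → cs L.∈ css → Σ (Subset N → ℕ) λ bad → (∀ V → bad V ≡ 0 → FactorIn F n x₀ V cs) × 4 * mm * n * 𝔼ᴿ d Rt bad ⊥ ≤ 2 * Ωt
       single {cs} cs∈ = on-chunk (chunk-size cs∈)
         where
         cs-unique : Unique cs
         cs-unique = chunk-unique css chunks-unique cs∈
         on-chunk : (∃ λ M → m ≤ M × length cs ≡ K * M × length cs ≤ 2 * (K * m)) →
           Σ (Subset N → ℕ) λ bad → (∀ V → bad V ≡ 0 → FactorIn F n x₀ V cs) × 4 * mm * n * 𝔼ᴿ d Rt bad ⊥ ≤ 2 * Ωt
         on-chunk (M , m≤M , len , _) = proj₁ bound , (λ V zero-bad → block⇒factor F n x₀ M cs len V (proj₁ (proj₂ bound) V zero-bad)) , proj₂ (proj₂ bound)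
           where
           M≤n : M ≤ n
           M≤n = ≤-trans (≤-trans (≤-reflexive (sym (*-identityˡ M))) (*-monoˡ-≤ M 1≤K)) (≤-trans (≤-reflexive (sym len))
             (≤-trans (unique-⊆-length FinP._≟_ cs (allFin n) cs-unique (λ {v} _ → ∈-allFin v)) (≤-reflexive (length-tabulate {n = n} id))))
           bound : Σ (Subset N → ℕ) λ bad → (∀ V → bad V ≡ 0 → BlockFactors.BlockFactor F n x₀ M cs V) × 4 * mm * n * 𝔼ᴿ d Rt bad ⊥ ≤ 2 * Ωt
           bound = block-success F unbalanced p q 1≤q dstar n x₀ v₀ M (≤-trans 1≤m m≤M) cs cs-unique len d μ₀ 4≤μ
             (≤-trans dense₁ (^-monoˡ-≤ q m≤M)) (≤-trans dense₂ m≤M) A R 1≤R (≤-<-trans (*-monoˡ-≤ e M≤n) sizes) (4 * mm * n)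
             (λ r M< → Z≤₁ r (≤-<-trans m≤M M<)) Z≤₂

       blocks : Σ (Subset N → ℕ) λ bad → (∀ V → bad V ≡ 0 → ∀ {cs} → cs L.∈ css → FactorIn F n x₀ V cs) × 4 * mm * n * 𝔼ᴿ d Rt bad ⊥ ≤ length css * (2 * Ωt)
       blocks = union-bound d Rt (FactorIn F n x₀) (4 * mm * n) (2 * Ωt) css single

      open Chunks css using (inChunks; ∣inChunks∣≤; buy)

      late costly : Subset N → ℕ
      late V = 𝟙 (¬? (∣ V ∩ ⊤ ∣ ≤? 4 * (y₁ * Rt)))
      costly V = 𝟙 (¬? (∣ V ∩ inChunks ∣ ≤? 4 * (y₂ * Rt)))

      bad : Subset N → ℕ
      bad V = proj₁ blocks V + (late V + costly V)

      few-chunks : length css ≤ n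
      few-chunks = ≤-trans (length-concat-≥ css (λ cs∈ → ≤-trans (*-mono-≤ 1≤K (≤-trans 1≤m (proj₁ (proj₂ (chunk-size cs∈))))) (≤-reflexive (sym (proj₁ (proj₂ (proj₂ (chunk-size cs∈))))))))
        (≤-reflexive (trans (cong length concat-css) (length-tabulate {n = n} id)))

      blocks-≤ : 4 * mm * 𝔼ᴿ d Rt (proj₁ blocks) ⊥ ≤ 2 * Ωt
      blocks-≤ = *-cancelˡ-≤ n ⦃ >-nonZero (<⇒≤ 2≤n) ⦄ (≤-trans (≤-reflexive (lem n (4 * mm) _)) (≤-trans (proj₂ (proj₂ blocks)) (*-monoˡ-≤ (2 * Ωt) few-chunks)))
        where
        lem : ∀ a b c → a * (b * c) ≡ b * a * c
        lem = solve-∀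

      late-≤ : 4 * mm * 𝔼ᴿ d Rt late ⊥ ≤ Ωt
      late-≤ = ≤-trans (*-monoˡ-≤ _ mm≤₁) (Tail.tail d y₁ ⊤ (≤-trans (≤-reflexive (∣⊤∣≡n N)) (≤-trans N≤ time)) Rt)
        where
        N≤ : N ≤ n * n
        N≤ = ≤-trans (length-filter <-edge? (cartesianProduct (allFin n) (allFin n)))
          (≤-reflexive (trans (length-cartesianProduct (allFin n) (allFin n)) (cong₂ _*_ (length-tabulate {n = n} id) (length-tabulate {n = n} id))))

      costly-≤ : 4 * mm * 𝔼ᴿ d Rt costly ⊥ ≤ Ωt
      costly-≤ = ≤-trans (*-monoˡ-≤ _ mm≤₂) (Tail.tail d y₂ inChunks (≤-trans (∣inChunks∣≤ (2 * (K * m)) (λ cs∈ → proj₂ (proj₂ (proj₂ (chunk-size cs∈)))))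
        (≤-trans (≤-reflexive (cong (2 * (K * m) *_) (trans (cong length concat-css) (length-tabulate {n = n} id)))) budget)) Rt)

      -- In units of `1 / (4 * mm)`, the chunks take two, exceeding the time one, and exceeding the
      -- budget one.
      total : mm * 𝔼ᴿ d Rt bad ⊥ ≤ Ωt
      total = *-cancelˡ-≤ 4 (begin
        4 * (mm * 𝔼ᴿ d Rt bad ⊥) ≡⟨ cong (λ z → 4 * (mm * z)) (trans (𝔼ᴿ-+ d Rt (proj₁ blocks) (λ V → late V + costly V) ⊥) (cong (𝔼ᴿ d Rt (proj₁ blocks) ⊥ +_) (𝔼ᴿ-+ d Rt late costly ⊥))) ⟩
        4 * (mm * (𝔼ᴿ d Rt (proj₁ blocks) ⊥ + (𝔼ᴿ d Rt late ⊥ + 𝔼ᴿ d Rt costly ⊥))) ≡⟨ lem₁ mm (𝔼ᴿ d Rt (proj₁ blocks) ⊥) (𝔼ᴿ d Rt late ⊥) (𝔼ᴿ d Rt costly ⊥) ⟩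
        4 * mm * 𝔼ᴿ d Rt (proj₁ blocks) ⊥ + (4 * mm * 𝔼ᴿ d Rt late ⊥ + 4 * mm * 𝔼ᴿ d Rt costly ⊥) ≤⟨ +-mono-≤ blocks-≤ (+-mono-≤ late-≤ costly-≤) ⟩
        2 * Ωt + (Ωt + Ωt) ≡⟨ lem₂ Ωt ⟩
        4 * Ωt ∎)
        where
        open ≤-Reasoning
        lem₁ : ∀ m a b c → 4 * (m * (a + (b + c))) ≡ 4 * m * a + (4 * m * b + 4 * m * c)
        lem₁ = solve-∀
        lem₂ : ∀ w → 2 * w + (w + w) ≡ 4 * w
        lem₂ = solve-∀

    finite-success : SuccProbAtLeast F n t b (buy ∷ []) mm
    finite-success = Transfer.success-probability F n d Rt bad t b buy (λ {π} π∈ j j≤N zero-bad →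
      let V = Indicator.χ (≡-dec (FinP._≟_ {n}) (FinP._≟_ {n})) X (take j π)
          rest = ≡0-+ʳ (proj₁ blocks V) (late V + costly V) zero-bad
      in Favourable.favourable F n x₀ css concat-css t b π π∈ j j≤N
        (proj₁ (proj₂ blocks) V (≡0-+ˡ (proj₁ blocks V) (late V + costly V) zero-bad))
        (≤-trans (𝟙¬≡0 (∣ V ∩ ⊤ ∣ ≤? 4 * (y₁ * Rt)) (≡0-+ˡ (late V) (costly V) rest)) time′)
        (𝟙¬≡0 (∣ V ∩ inChunks ∣ ≤? 4 * (y₂ * Rt)) (≡0-+ʳ (late V) (costly V) rest))) mm total

least : {P : ℕ → Set} (P? : ∀ x → Dec (P x)) (n : ℕ) → P n → Σ ℕ λ r → P r × (∀ x → P x → r ≤ x)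
least P? zero p = zero , p , λ x _ → z≤n
least {P} P? (suc n) p with P? zero
... | yes p₀ = zero , p₀ , λ x _ → z≤n
... | no ¬p₀ with least {P ∘ suc} (P? ∘ suc) n p
...   | r , pr , min = suc r , pr , λ { zero px → ⊥-elim (¬p₀ px) ; (suc x) px → s≤s (min x px) }

n≤n^m : ∀ n m → 1 ≤ n → 1 ≤ m → n ≤ n ^ m
n≤n^m n (suc m) 1≤n _ = ≤-trans (≤-reflexive (sym (*-identityʳ n))) (*-monoʳ-≤ n (>-nonZero⁻¹ (n ^ m) ⦃ m^n≢0 n m ⦃ >-nonZero 1≤n ⦄ ⦄))

1≤^ : ∀ n m → 1 ≤ n → 1 ≤ n ^ m
1≤^ n m 1≤n = >-nonZero⁻¹ (n ^ m) ⦃ m^n≢0 n m ⦃ >-nonZero 1≤n ⦄ ⦄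

n<b^n : ∀ b n → 2 ≤ b → n < b ^ n
n<b^n b zero 2≤b = s≤s z≤n
n<b^n b (suc n) 2≤b = ≤-trans (s≤s (n<b^n b n 2≤b)) (≤-trans (+-monoˡ-≤ (b ^ n) (1≤^ b n (<⇒≤ 2≤b)))
  (≤-trans (≤-reflexive (cong (b ^ n +_) (sym (+-identityʳ (b ^ n))))) (*-monoˡ-≤ (b ^ n) 2≤b)))

-- With `y = x / G` one has `x < suc y * G ≤ 2 ^ y * G`; then the `G`-th power is taken.
power≤exponential : ∀ g x → x ^ suc g ≤ suc g ^ suc g * 2 ^ x
power≤exponential g x = begin
  x ^ G ≤⟨ ^-monoˡ-≤ G (<⇒≤ (M<suc[M/k]*k x G)) ⟩
  (suc y * G) ^ G ≤⟨ ^-monoˡ-≤ G (*-monoˡ-≤ G (n<b^n 2 y ≤-refl)) ⟩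
  (2 ^ y * G) ^ G ≡⟨ ^-distribʳ-* G (2 ^ y) G ⟩
  (2 ^ y) ^ G * G ^ G ≡⟨ trans (*-comm _ (G ^ G)) (cong (G ^ G *_) (^-*-assoc 2 y G)) ⟩
  G ^ G * 2 ^ (y * G) ≤⟨ *-monoʳ-≤ (G ^ G) (^-monoʳ-≤ 2 (m/n*n≤m x G)) ⟩
  G ^ G * 2 ^ x ∎
  where
  open ≤-Reasoning
  G y : ℕ
  G = suc g
  y = x / G

module Root (q : ℕ) (1≤q : 1 ≤ q) (A : ℕ) (1≤A : 1 ≤ A) where

  private
    search : Σ ℕ λ r → A ≤ r ^ q × (∀ x → A ≤ x ^ q → r ≤ x)
    search = least (λ x → A ≤? x ^ q) A (n≤n^m A q 1≤A 1≤q)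

  root : ℕ
  root = proj₁ search

  A≤root^q : A ≤ root ^ q
  A≤root^q = proj₁ (proj₂ search)

  root-least : ∀ x → A ≤ x ^ q → root ≤ x
  root-least = proj₂ (proj₂ search)

  1≤root : 1 ≤ root
  1≤root = positive root A≤root^q
    where
    positive : ∀ r → A ≤ r ^ q → 1 ≤ r
    positive zero le = ⊥-elim (<⇒≱ 1≤A (≤-trans le (≤-reflexive (0^ q 1≤q))))
      where
      0^ : ∀ q → 1 ≤ q → 0 ^ q ≡ 0
      0^ (suc q) _ = refl
    positive (suc r) _ = s≤s z≤n

  -- The predecessor of `root` is still too small, and `root` is at most twice its predecessor once
  -- it exceeds 1: rounding up costs a factor 2.
  root^q≤ : root ^ q ≤ 2 ^ q * A
  root^q≤ = bounded root root-least
    where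
    bounded : ∀ r → (∀ x → A ≤ x ^ q → r ≤ x) → r ^ q ≤ 2 ^ q * A
    bounded zero _ = ≤-trans (^-monoˡ-≤ q (z≤n {1})) (≤-trans (≤-reflexive (^-zeroˡ q)) (*-mono-≤ (1≤^ 2 q (s≤s z≤n)) 1≤A))
    bounded (suc zero) _ = ≤-trans (≤-reflexive (^-zeroˡ q)) (*-mono-≤ (1≤^ 2 q (s≤s z≤n)) 1≤A)
    bounded (suc (suc r)) min = begin
      suc (suc r) ^ q ≤⟨ ^-monoˡ-≤ q (≤-trans (s≤s (m≤n+m (suc r) r)) (≤-reflexive (lem r))) ⟩
      (2 * suc r) ^ q ≡⟨ ^-distribʳ-* q 2 (suc r) ⟩
      2 ^ q * suc r ^ q ≤⟨ *-monoʳ-≤ (2 ^ q) (<⇒≤ (≰⇒> λ le → <-irrefl refl (min (suc r) le))) ⟩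
      2 ^ q * A ∎
      where
      open ≤-Reasoning
      lem : ∀ r → suc (r + suc r) ≡ 2 * suc r
      lem = solve-∀

module Parameters (p q K c₁ Rt : ℕ) (1≤q : 1 ≤ q) (q≤p : q ≤ p) (1≤K : 1 ≤ K) (1≤c₁ : 1 ≤ c₁) (1≤Rt : 1 ≤ Rt) (n t : ℕ) where

  -- One round has density `1 / D`, about `t / (8 * Rt * n²)`, and the chunk parameter `m` is about
  -- `(c₁ * D)^(d*)`. In `C` the 8 is the 4 of the tail bound times 2 for rounding down `y₁`.
  C d D A₀ : ℕ
  C = 8 * Rt
  d = C * (n * n) / suc t
  D = suc d
  A₀ = (c₁ * D) ^ p

  1≤A₀ : 1 ≤ A₀
  1≤A₀ = 1≤^ (c₁ * D) p (*-mono-≤ 1≤c₁ (s≤s z≤n))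

  module M = Root q 1≤q A₀ 1≤A₀

  m y₁ y₂ b : ℕ
  m = M.root
  y₁ = (t / (4 * Rt)) ⦃ >-nonZero (*-mono-≤ (s≤s (z≤n {3})) 1≤Rt) ⦄
  y₂ = suc (2 * (K * m) * n / D)
  b = 4 * (y₂ * Rt)

  1≤p : 1 ≤ p
  1≤p = ≤-trans 1≤q q≤p

  D≤m : D ≤ m
  D≤m = ^-cancelˡ-≤ q 1≤q (≤-trans (^-monoʳ-≤ D q≤p) (≤-trans (^-monoˡ-≤ p (≤-trans (≤-reflexive (sym (*-identityˡ D))) (*-monoˡ-≤ D 1≤c₁))) M.A≤root^q))

  budget : 2 * (K * m) * n ≤ y₂ * D
  budget = <⇒≤ (M<suc[M/k]*k (2 * (K * m) * n) D)

  -- Makes the tail bound for the budget, exponential in `y₂ * Rt`, beat every constant. It rests on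
  -- `D ≤ m`, that is on `d* ≥ 1`.
  n≤y₂ : n ≤ y₂
  n≤y₂ = <⇒≤ (*-cancelʳ-< D n y₂ (≤-<-trans (≤-trans (*-monoʳ-≤ n D≤m) (≤-trans (≤-reflexive (*-comm n m))
    (*-monoˡ-≤ n (≤-trans (≤-trans (≤-reflexive (sym (*-identityˡ m))) (*-monoˡ-≤ m 1≤K)) (m≤m+n (K * m) _))))) (M<suc[M/k]*k (2 * (K * m) * n) D)))

  time′ : 4 * (y₁ * Rt) ≤ t
  time′ = ≤-trans (≤-reflexive (lem y₁ Rt)) (m/n*n≤m t (4 * Rt) ⦃ nz ⦄)
    where
    nz : NonZero (4 * Rt)
    nz = >-nonZero (*-mono-≤ (s≤s (z≤n {3})) 1≤Rt)
    lem : ∀ y r → 4 * (y * r) ≡ y * (4 * r)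
    lem = solve-∀

  Cn²<D*suc-t : C * (n * n) < D * suc t
  Cn²<D*suc-t = M<suc[M/k]*k (C * (n * n)) (suc t)

  suc-t≤ : suc t ≤ suc y₁ * (4 * Rt)
  suc-t≤ = M<suc[M/k]*k t (4 * Rt) ⦃ >-nonZero (*-mono-≤ (s≤s (z≤n {3})) 1≤Rt) ⦄

  time : 1 ≤ y₁ → n * n ≤ y₁ * D
  time 1≤y₁ = *-cancelˡ-≤ C ⦃ m*n≢0 8 Rt ⦃ _ ⦄ ⦃ >-nonZero 1≤Rt ⦄ ⦄ (begin
    C * (n * n) ≤⟨ <⇒≤ Cn²<D*suc-t ⟩
    D * suc t ≤⟨ *-monoʳ-≤ D (≤-trans suc-t≤ (*-monoˡ-≤ (4 * Rt) (+-monoˡ-≤ y₁ 1≤y₁))) ⟩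
    D * ((y₁ + y₁) * (4 * Rt)) ≡⟨ lem D y₁ Rt ⟩
    8 * Rt * (y₁ * D) ∎)
    where
    open ≤-Reasoning
    lem : ∀ D y r → D * ((y + y) * (4 * r)) ≡ 8 * r * (y * D)
    lem = solve-∀

  y₁-large : ∀ x → x * (4 * Rt) ≤ t → x ≤ y₁
  y₁-large x le = ≤-pred (*-cancelʳ-< (4 * Rt) x (suc y₁) (<-≤-trans (s≤s le) suc-t≤))

  module Bounds (a c n′ : ℕ) (1≤a : 1 ≤ a) (1≤c : 1 ≤ c) (1≤n : 1 ≤ n) (n≡ : n ≡ K * n′)
    (low : (c₁ * suc C * K) ^ p * n ^ (2 * p) ≤ t ^ p * n ^ q) (high : t ^ c * n ^ a ≤ n ^ (2 * c)) where

    n≤t : n ≤ t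
    n≤t = ^-cancelˡ-≤ p 1≤p (*-cancelʳ-≤ (n ^ p) (t ^ p) (n ^ p) ⦃ m^n≢0 n p ⦃ >-nonZero 1≤n ⦄ ⦄ (begin
      n ^ p * n ^ p ≡⟨ trans (sym (^-distribˡ-+-* n p p)) (cong (n ^_) (cong (p +_) (sym (+-identityʳ p)))) ⟩
      n ^ (2 * p) ≡⟨ *-identityˡ (n ^ (2 * p)) ⟨
      1 * n ^ (2 * p) ≤⟨ *-monoˡ-≤ (n ^ (2 * p)) (1≤^ (c₁ * suc C * K) p (*-mono-≤ (*-mono-≤ 1≤c₁ (s≤s (z≤n {C}))) 1≤K)) ⟩
      (c₁ * suc C * K) ^ p * n ^ (2 * p) ≤⟨ low ⟩
      t ^ p * n ^ q ≤⟨ *-monoʳ-≤ (t ^ p) (^-monoʳ-≤ n ⦃ >-nonZero 1≤n ⦄ q≤p) ⟩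
      t ^ p * n ^ p ∎))
      where open ≤-Reasoning

    1≤t : 1 ≤ t
    1≤t = ≤-trans 1≤n n≤t

    n^2c : n ^ (2 * c) ≡ (n * n) ^ c
    n^2c = trans (sym (^-*-assoc n 2 c)) (cong (_^ c) (cong (n *_) (*-identityʳ n)))

    t≤n² : t ≤ n * n
    t≤n² = ^-cancelˡ-≤ c 1≤c (≤-trans (≤-reflexive (sym (*-identityʳ (t ^ c)))) (≤-trans (*-monoʳ-≤ (t ^ c) (1≤^ n a 1≤n)) (≤-trans high (≤-reflexive n^2c))))

    Dt≤ : D * t ≤ suc C * (n * n)
    Dt≤ = begin
      D * t ≡⟨ +-comm t (d * t) ⟩
      d * t + t ≤⟨ +-mono-≤ (≤-trans (*-monoʳ-≤ d (n≤1+n t)) (m/n*n≤m (C * (n * n)) (suc t))) t≤n² ⟩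
      C * (n * n) + n * n ≡⟨ +-comm (C * (n * n)) (n * n) ⟩
      suc C * (n * n) ∎
      where open ≤-Reasoning

    -- Here the upper bound on `t` enters: `D` is at least `n² / t`, hence at least `n^(a/c)`, so
    -- chunks are polynomially large in `n`.
    n≤D^c : n ≤ D ^ c
    n≤D^c = *-cancelˡ-≤ (t ^ c) ⦃ m^n≢0 t c ⦃ >-nonZero 1≤t ⦄ ⦄ (begin
      t ^ c * n ≤⟨ *-monoʳ-≤ (t ^ c) (n≤n^m n a 1≤n 1≤a) ⟩
      t ^ c * n ^ a ≤⟨ high ⟩
      n ^ (2 * c) ≡⟨ n^2c ⟩
      (n * n) ^ c ≤⟨ ^-monoˡ-≤ c (*-cancelˡ-≤ 2 doubled) ⟩
      (t * D) ^ c ≡⟨ ^-distribʳ-* c t D ⟩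
      t ^ c * D ^ c ∎)
      where
      open ≤-Reasoning
      lem : ∀ D t → D * (t + t) ≡ 2 * (t * D)
      lem = solve-∀
      doubled : 2 * (n * n) ≤ 2 * (t * D)
      doubled = ≤-trans (*-monoˡ-≤ (n * n) (≤-trans (s≤s (s≤s (z≤n {6}))) (≤-trans (≤-reflexive (sym (*-identityʳ 8))) (*-monoʳ-≤ 8 1≤Rt))))
        (≤-trans (<⇒≤ Cn²<D*suc-t) (≤-trans (*-monoʳ-≤ D (+-monoˡ-≤ t 1≤t)) (≤-reflexive (lem D t))))

    n≤m^c : n ≤ m ^ c
    n≤m^c = ≤-trans n≤D^c (^-monoˡ-≤ c D≤m)

    -- Here the lower bound on `t` enters: it gives `(c₁ * D) ^ p ≤ n′ ^ q`, so that the `K * n′`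
    -- vertices suffice for at least one chunk.
    m≤n′ : m ≤ n′
    m≤n′ = M.root-least n′ (*-cancelˡ-≤ (t ^ p * K ^ q) ⦃ m*n≢0 (t ^ p) (K ^ q) ⦃ m^n≢0 t p ⦃ >-nonZero 1≤t ⦄ ⦄ ⦃ m^n≢0 K q ⦃ >-nonZero 1≤K ⦄ ⦄ ⦄ (begin
      t ^ p * K ^ q * (c₁ * D) ^ p ≡⟨ lem₁ (t ^ p) (K ^ q) ((c₁ * D) ^ p) ⟩
      K ^ q * ((c₁ * D) ^ p * t ^ p) ≡⟨ cong (K ^ q *_) (^-distribʳ-* p (c₁ * D) t) ⟨
      K ^ q * (c₁ * D * t) ^ p ≤⟨ *-mono-≤ (^-monoʳ-≤ K ⦃ >-nonZero 1≤K ⦄ q≤p) (^-monoˡ-≤ p (≤-trans (≤-reflexive (*-assoc c₁ D t)) (*-monoʳ-≤ c₁ Dt≤))) ⟩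
      K ^ p * (c₁ * (suc C * (n * n))) ^ p ≡⟨ ^-distribʳ-* p K _ ⟨
      (K * (c₁ * (suc C * (n * n)))) ^ p ≡⟨ cong (_^ p) (lem₂ K c₁ (suc C) (n * n)) ⟩
      (c₁ * suc C * K * (n * n)) ^ p ≡⟨ ^-distribʳ-* p (c₁ * suc C * K) (n * n) ⟩
      (c₁ * suc C * K) ^ p * (n * n) ^ p ≡⟨ cong ((c₁ * suc C * K) ^ p *_) (trans (cong (_^ p) (cong (n *_) (sym (*-identityʳ n)))) (^-*-assoc n 2 p)) ⟩
      (c₁ * suc C * K) ^ p * n ^ (2 * p) ≤⟨ low ⟩
      t ^ p * n ^ q ≡⟨ cong (t ^ p *_) (trans (cong (_^ q) n≡) (^-distribʳ-* q K n′)) ⟩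
      t ^ p * (K ^ q * n′ ^ q) ≡⟨ *-assoc (t ^ p) (K ^ q) _ ⟨
      t ^ p * K ^ q * n′ ^ q ∎))
      where
      open ≤-Reasoning
      lem₁ : ∀ a b c → a * b * c ≡ b * (c * a)
      lem₁ = solve-∀
      lem₂ : ∀ k c s x → k * (c * (s * x)) ≡ c * s * k * x
      lem₂ = solve-∀

    -- In 24, a factor 12 comes from `bD≤` and 2 from rounding the root `m`. The last factor
    -- collects the constants in `m ^ q ≈ (c₁ * D) ^ p` and in `D * t ≤ suc C * n²`.
    k₂ : ℕ
    k₂ = 24 * Rt * K * (c₁ ^ p * suc C ^ p)

    bD≤ : b * D ≤ 12 * Rt * K * m * n
    bD≤ = begin
      4 * (y₂ * Rt) * D ≡⟨ lem₁ y₂ Rt D ⟩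
      4 * Rt * (y₂ * D) ≤⟨ *-monoʳ-≤ (4 * Rt) (+-mono-≤ D≤Kmn (m/n*n≤m (2 * (K * m) * n) D)) ⟩
      4 * Rt * (K * m * n + 2 * (K * m) * n) ≡⟨ lem₂ Rt K m n ⟩
      12 * Rt * K * m * n ∎
      where
      open ≤-Reasoning
      D≤Kmn : D ≤ K * m * n
      D≤Kmn = ≤-trans D≤m (≤-trans (≤-reflexive (lem m)) (*-mono-≤ (*-monoˡ-≤ m 1≤K) 1≤n))
        where
        lem : ∀ m → m ≡ 1 * m * 1
        lem = solve-∀
      lem₁ : ∀ y r D → 4 * (y * r) * D ≡ 4 * r * (y * D)
      lem₁ = solve-∀
      lem₂ : ∀ r k m n → 4 * r * (k * m * n + 2 * (k * m) * n) ≡ 12 * r * k * m * n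
      lem₂ = solve-∀

    -- Up to constants `b` is `m * n / D` and `m ^ q` is `D ^ p`, so `b ^ q` is
    -- `D ^ (p ∸ q) * n ^ q`. Since `q ≤ p`, the bound of `D * t` by a multiple of `n²` may be
    -- raised to the power `p ∸ q`.
    budget-bound : b ^ q * (t ^ p * n ^ q) ≤ k₂ ^ q * (t ^ q * n ^ (2 * p))
    budget-bound = *-cancelˡ-≤ (D ^ q) ⦃ m^n≢0 D q ⦄ (begin
      D ^ q * (b ^ q * (t ^ p * n ^ q)) ≡⟨ lem₁ (D ^ q) (b ^ q) (t ^ p) (n ^ q) ⟩
      b ^ q * D ^ q * (t ^ p * n ^ q) ≡⟨ cong (_* (t ^ p * n ^ q)) (^-distribʳ-* q b D) ⟨
      (b * D) ^ q * (t ^ p * n ^ q) ≤⟨ *-monoˡ-≤ (t ^ p * n ^ q) (^-monoˡ-≤ q bD≤) ⟩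
      (12 * Rt * K * m * n) ^ q * (t ^ p * n ^ q)
        ≡⟨ cong (_* (t ^ p * n ^ q)) (trans (^-distribʳ-* q (12 * Rt * K * m) n) (cong (_* n ^ q) (^-distribʳ-* q (12 * Rt * K) m))) ⟩
      (12 * Rt * K) ^ q * m ^ q * n ^ q * (t ^ p * n ^ q)
        ≤⟨ *-monoˡ-≤ (t ^ p * n ^ q) (*-monoˡ-≤ (n ^ q) (*-monoʳ-≤ ((12 * Rt * K) ^ q) M.root^q≤)) ⟩
      (12 * Rt * K) ^ q * (2 ^ q * (c₁ * D) ^ p) * n ^ q * (t ^ p * n ^ q)
        ≡⟨ cong (λ z → (12 * Rt * K) ^ q * (2 ^ q * z) * n ^ q * (t ^ p * n ^ q)) (^-distribʳ-* p c₁ D) ⟩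
      (12 * Rt * K) ^ q * (2 ^ q * (c₁ ^ p * D ^ p)) * n ^ q * (t ^ p * n ^ q)
        ≡⟨ lem₂ ((12 * Rt * K) ^ q) (2 ^ q) (c₁ ^ p) (D ^ p) (n ^ q) (t ^ p) ⟩
      (12 * Rt * K) ^ q * 2 ^ q * c₁ ^ p * (n ^ q * n ^ q) * (D ^ p * t ^ p)
        ≤⟨ *-mono-≤ (*-monoˡ-≤ (n ^ q * n ^ q) (*-monoˡ-≤ (c₁ ^ p) (≤-reflexive (sym (^-distribʳ-* q (12 * Rt * K) 2))))) Dtp ⟩
      (12 * Rt * K * 2) ^ q * c₁ ^ p * (n ^ q * n ^ q) * (D ^ q * t ^ q * (suc C ^ p * (n ^ (p ∸ q) * n ^ (p ∸ q))))
        ≡⟨ lem₃ ((12 * Rt * K * 2) ^ q) (c₁ ^ p) (n ^ q) (D ^ q) (t ^ q) (suc C ^ p) (n ^ (p ∸ q)) ⟩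
      D ^ q * ((12 * Rt * K * 2) ^ q * (c₁ ^ p * suc C ^ p) * (t ^ q * ((n ^ q * n ^ (p ∸ q)) * (n ^ q * n ^ (p ∸ q)))))
        ≤⟨ *-monoʳ-≤ (D ^ q) (*-mono-≤ const (≤-reflexive (cong (t ^ q *_) powers))) ⟩
      D ^ q * (k₂ ^ q * (t ^ q * n ^ (2 * p))) ∎)
      where
      open ≤-Reasoning
      lem₁ : ∀ d b t n → d * (b * (t * n)) ≡ b * d * (t * n)
      lem₁ = solve-∀
      lem₂ : ∀ r w c D n t → r * (w * (c * D)) * n * (t * n) ≡ r * w * c * (n * n) * (D * t)
      lem₂ = solve-∀
      lem₃ : ∀ r c n D t s x → r * c * (n * n) * (D * t * (s * (x * x))) ≡ D * (r * (c * s) * (t * ((n * x) * (n * x))))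
      lem₃ = solve-∀
      split : ∀ x → x ^ p ≡ x ^ q * x ^ (p ∸ q)
      split x = trans (cong (x ^_) (sym (m+[n∸m]≡n q≤p))) (^-distribˡ-+-* x q (p ∸ q))
      Dtp : D ^ p * t ^ p ≤ D ^ q * t ^ q * (suc C ^ p * (n ^ (p ∸ q) * n ^ (p ∸ q)))
      Dtp = begin
        D ^ p * t ^ p ≡⟨ trans (sym (^-distribʳ-* p D t)) (split (D * t)) ⟩
        (D * t) ^ q * (D * t) ^ (p ∸ q) ≤⟨ *-mono-≤ (≤-reflexive (^-distribʳ-* q D t)) (^-monoˡ-≤ (p ∸ q) Dt≤) ⟩
        D ^ q * t ^ q * (suc C * (n * n)) ^ (p ∸ q)
          ≡⟨ cong (D ^ q * t ^ q *_) (trans (^-distribʳ-* (p ∸ q) (suc C) (n * n)) (cong (suc C ^ (p ∸ q) *_) (^-distribʳ-* (p ∸ q) n n))) ⟩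
        D ^ q * t ^ q * (suc C ^ (p ∸ q) * (n ^ (p ∸ q) * n ^ (p ∸ q)))
          ≤⟨ *-monoʳ-≤ (D ^ q * t ^ q) (*-monoˡ-≤ (n ^ (p ∸ q) * n ^ (p ∸ q)) (^-monoʳ-≤ (suc C) (m∸n≤m p q))) ⟩
        D ^ q * t ^ q * (suc C ^ p * (n ^ (p ∸ q) * n ^ (p ∸ q))) ∎
      const : (12 * Rt * K * 2) ^ q * (c₁ ^ p * suc C ^ p) ≤ k₂ ^ q
      const = ≤-trans (*-mono-≤ (≤-reflexive (cong (_^ q) (lem Rt K))) (n≤n^m (c₁ ^ p * suc C ^ p) q (*-mono-≤ (1≤^ c₁ p 1≤c₁) (1≤^ (suc C) p (s≤s z≤n))) 1≤q))
        (≤-reflexive (sym (^-distribʳ-* q (24 * Rt * K) (c₁ ^ p * suc C ^ p))))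
        where
        lem : ∀ r k → 12 * r * k * 2 ≡ 24 * r * k
        lem = solve-∀
      powers : (n ^ q * n ^ (p ∸ q)) * (n ^ q * n ^ (p ∸ q)) ≡ n ^ (2 * p)
      powers = trans (cong₂ _*_ (sym (split n)) (sym (split n))) (trans (sym (^-distribˡ-+-* n p p)) (cong (n ^_) (cong (p +_) (sym (+-identityʳ p)))))

last : {P : ℕ → Set} (P? : ∀ x → Dec (P x)) (B : ℕ) → (∀ x → P x → x ≤ B) → ∀ U → P U → ∃ λ μ → U ≤ μ × P μ × ¬ P (suc μ)
last {P} P? B bounded U pU = climb (suc B) U pU (m≤m+n (suc B) U)
  where
  climb : ∀ fuel U → P U → B < fuel + U → ∃ λ μ → U ≤ μ × P μ × ¬ P (suc μ)
  climb zero U pU lt = ⊥-elim (<⇒≱ lt (bounded U pU))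
  climb (suc fuel) U pU lt with P? (suc U)
  ... | no ¬p = U , ≤-refl , pU , ¬p
  ... | yes p′ with climb fuel (suc U) p′ (<-≤-trans lt (≤-reflexive (sym (+-suc fuel U))))
  ...   | μ , le , pμ , ¬p = μ , <⇒≤ le , pμ , ¬p

-- The largest admissible `μ₀` is taken. Failure of its successor bounds `m`, and with it
-- `n ≤ m ^ c`, by a fixed power of `suc μ₀`; hence boundedly many divisions reduce every fragment
-- size to 0.
margin-exists : ∀ c₂ PE c m n U → 1 ≤ c₂ → 1 ≤ PE → n ≤ m ^ c → (c₂ * (suc U * suc U)) ^ PE ≤ m →
  ∃ λ μ₀ → U ≤ μ₀ × (c₂ * (suc μ₀ * suc μ₀)) ^ PE ≤ m × n ≤ (4 * c₂) ^ (PE * c) * suc μ₀ ^ (2 * (PE * c))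
margin-exists c₂ PE c m n U 1≤c₂ 1≤PE n≤ start = climbed
  where
  P : ℕ → Set
  P x = (c₂ * (suc x * suc x)) ^ PE ≤ m
  bounded : ∀ x → P x → x ≤ m
  bounded x px = ≤-trans (n≤1+n x) (≤-trans (≤-trans (≤-reflexive (lem (suc x))) (*-mono-≤ 1≤c₂ (*-monoʳ-≤ (suc x) (s≤s (z≤n {x})))))
    (≤-trans (n≤n^m (c₂ * (suc x * suc x)) PE (*-mono-≤ 1≤c₂ (s≤s z≤n)) 1≤PE) px))
    where
    lem : ∀ x → x ≡ 1 * (x * 1)
    lem = solve-∀
  climbed : ∃ λ μ₀ → U ≤ μ₀ × P μ₀ × n ≤ (4 * c₂) ^ (PE * c) * suc μ₀ ^ (2 * (PE * c))
  climbed with last (λ x → (c₂ * (suc x * suc x)) ^ PE ≤? m) m bounded U start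
  ... | μ₀ , U≤ , pμ , ¬p = μ₀ , U≤ , pμ , (begin
      n ≤⟨ n≤ ⟩
      m ^ c ≤⟨ ^-monoˡ-≤ c (<⇒≤ (≰⇒> ¬p)) ⟩
      ((c₂ * (suc (suc μ₀) * suc (suc μ₀))) ^ PE) ^ c ≡⟨ ^-*-assoc _ PE c ⟩
      (c₂ * (suc (suc μ₀) * suc (suc μ₀))) ^ (PE * c) ≤⟨ ^-monoˡ-≤ (PE * c) (*-monoʳ-≤ c₂ (*-mono-≤ double double)) ⟩
      (c₂ * ((2 * μ) * (2 * μ))) ^ (PE * c) ≡⟨ cong (_^ (PE * c)) (lem c₂ μ) ⟩
      (4 * c₂ * (μ * (μ * 1))) ^ (PE * c) ≡⟨ ^-distribʳ-* (PE * c) (4 * c₂) (μ ^ 2) ⟩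
      (4 * c₂) ^ (PE * c) * (μ ^ 2) ^ (PE * c) ≡⟨ cong ((4 * c₂) ^ (PE * c) *_) (^-*-assoc μ 2 (PE * c)) ⟩
      (4 * c₂) ^ (PE * c) * μ ^ (2 * (PE * c)) ∎)
    where
    open ≤-Reasoning
    μ : ℕ
    μ = suc μ₀
    double : suc μ ≤ 2 * μ
    double = ≤-trans (+-monoˡ-≤ μ (s≤s (z≤n {μ₀}))) (≤-reflexive (cong (μ +_) (sym (+-identityʳ μ))))
    lem : ∀ c x → c * ((2 * x) * (2 * x)) ≡ 4 * c * (x * (x * 1))
    lem = solve-∀

module Final (F : Graph) (unbalanced : ¬ VertexBalanced F) (p q : ℕ) (1≤q : 1 ≤ q) (dstar : IsDStar F p q)
  (a c : ℕ) (1≤a : 1 ≤ a) (1≤c : 1 ≤ c) where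

  open Structure.WithDensity F unbalanced p q 1≤q dstar using (2≤k; q≤p; 1≤p)

  -- `G` is the exponent in `n ≤ c₃ * μ ^ G`. One more factor `μ` beats every constant, so
  -- `R = suc G` serves both as the number of rounds in an attempt and as the number of attempts;
  -- `Rt` adds the round for the inner packing.
  K e c₁ c₂ PE G R Rt c₃ : ℕ
  K = k F
  e = length (E F)
  c₂ = 4 ^ K
  c₁ = c₂ * piece-margin F
  PE = p * suc e
  G = 2 * (PE * c)
  R = suc G
  Rt = suc (R * R)
  c₃ = (4 * c₂) ^ (PE * c)

  1≤K : 1 ≤ K
  1≤K = <⇒≤ 2≤k

  1≤c₂ : 1 ≤ c₂
  1≤c₂ = 1≤^ 4 K (s≤s z≤n)

  1≤c₁ : 1 ≤ c₁
  1≤c₁ = *-mono-≤ 1≤c₂ (1≤^ 2 (2 * (K * e) + 1) (s≤s z≤n))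

  1≤PE : 1 ≤ PE
  1≤PE = *-mono-≤ 1≤p (s≤s (z≤n {e}))

  1≤Rt : 1 ≤ Rt
  1≤Rt = s≤s z≤n

  k₁ k₂ : ℕ
  k₁ = c₁ * suc (8 * Rt) * K
  k₂ = 24 * Rt * K * (c₁ ^ p * suc (8 * Rt) ^ p)

  1≤k₁ : 1 ≤ k₁
  1≤k₁ = *-mono-≤ (*-mono-≤ 1≤c₁ (s≤s (z≤n {8 * Rt}))) 1≤K

  1≤k₂ : 1 ≤ k₂
  1≤k₂ = *-mono-≤ (*-mono-≤ (*-mono-≤ (s≤s (z≤n {23})) 1≤Rt) 1≤K) (*-mono-≤ (1≤^ c₁ p 1≤c₁) (1≤^ (suc (8 * Rt)) p (s≤s z≤n)))

  module Par (n t : ℕ) = Parameters p q K c₁ Rt 1≤q q≤p 1≤K 1≤c₁ 1≤Rt n t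

  strategy : (n t : ℕ) → Strategy n
  strategy n t = Chunks.buy (chunkify n (K * Par.m n t) (allFin n))

  InRange : (n t : ℕ) → Set
  InRange n t = (k₁ ^ p * n ^ (2 * p) ≤ t ^ p * n ^ q) × (t ^ c * n ^ a ≤ n ^ (2 * c))

  within-budget : ∀ n t n′ → 1 ≤ n → n ≡ K * n′ → InRange n t → Par.b n t ^ q * (t ^ p * n ^ q) ≤ k₂ ^ q * (t ^ q * n ^ (2 * p))
  within-budget n t n′ 1≤n n≡ (low , high) = Par.Bounds.budget-bound n t a c n′ 1≤a 1≤c 1≤n n≡ low high

  module Threshold (mm : ℕ) where

    -- The summands of `U` give `4 ≤ suc μ₀`, the size bound and the failure bound for the attempts.
    -- Those of `T₀` make `U ≤ μ₀` possible, let an exponential beat a power in `Z≤₁`, and make `y₁`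
    -- and `y₂` exceed `4 * mm`.
    U U₂ T₀ : ℕ
    U = 3 + (c₃ * e + 4 * mm * c₃ * (R * 4) ^ R)
    U₂ = 4 * mm * (K ^ c * suc c ^ suc c)
    T₀ = ((c₂ * (suc U * suc U)) ^ PE) ^ c + (U₂ * K) ^ c + suc (4 * mm) * (4 * Rt)

    succeeds : ∀ n t n′ → 1 ≤ n → T₀ ≤ n → n ≡ K * n′ → InRange n t → SuccProbAtLeast F n t (Par.b n t) (strategy n t ∷ []) mm
    succeeds n t n′ 1≤n T₀≤n n≡ (low , high) = Finite.finite-success F unbalanced p q 1≤q dstar n n′ m (Par.d n t) μ₀ t R R (Par.y₁ n t) (Par.y₂ n t) mm
        n≡ (Par.M.1≤root n t) B.m≤n′ (s≤s z≤n) (s≤s (≤-trans (m≤m+n 3 _) U≤μ₀)) dense₁ dense₂ sizes Z≤₁ Z≤₂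
        (Par.time n t (≤-trans (s≤s (z≤n {4 * mm})) mm<y₁)) (Par.time′ n t) (Par.budget n t)
        (≤-trans (<⇒≤ mm<y₁) (exponential (Par.y₁ n t))) (≤-trans (≤-trans (n≤1+n _) (≤-trans (≤-trans (≤-reflexive (sym (*-identityʳ _))) (*-monoʳ-≤ (suc (4 * mm)) (s≤s (z≤n {_})))) (≤-trans T₃≤n (Par.n≤y₂ n t)))) (exponential (Par.y₂ n t)))
      where
      module B = Par.Bounds n t a c n′ 1≤a 1≤c 1≤n n≡ low high
      m : ℕ
      m = Par.m n t
      T₁≤n : ((c₂ * (suc U * suc U)) ^ PE) ^ c ≤ n
      T₁≤n = ≤-trans (≤-trans (m≤m+n _ ((U₂ * K) ^ c)) (m≤m+n _ _)) T₀≤n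
      T₂≤n : (U₂ * K) ^ c ≤ n
      T₂≤n = ≤-trans (≤-trans (m≤n+m ((U₂ * K) ^ c) (((c₂ * (suc U * suc U)) ^ PE) ^ c)) (m≤m+n _ _)) T₀≤n
      T₃≤n : suc (4 * mm) * (4 * Rt) ≤ n
      T₃≤n = ≤-trans (m≤n+m _ (((c₂ * (suc U * suc U)) ^ PE) ^ c + (U₂ * K) ^ c)) T₀≤n
      margin : ∃ λ μ₀ → U ≤ μ₀ × (c₂ * (suc μ₀ * suc μ₀)) ^ PE ≤ m × n ≤ c₃ * suc μ₀ ^ G
      margin = margin-exists c₂ PE c m n U 1≤c₂ 1≤PE B.n≤m^c (^-cancelˡ-≤ c 1≤c (≤-trans T₁≤n B.n≤m^c))
      μ₀ : ℕ
      μ₀ = proj₁ margin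
      U≤μ₀ : U ≤ μ₀
      U≤μ₀ = proj₁ (proj₂ margin)
      n≤μ^G : n ≤ c₃ * suc μ₀ ^ G
      n≤μ^G = proj₂ (proj₂ (proj₂ margin))
      mm<y₁ : suc (4 * mm) ≤ Par.y₁ n t
      mm<y₁ = Par.y₁-large n t (suc (4 * mm)) (≤-trans T₃≤n B.n≤t)
      exponential : ∀ y → y ≤ 4 ^ (y * Rt)
      exponential y = ≤-trans (≤-trans (≤-reflexive (sym (*-identityʳ y))) (*-monoʳ-≤ y 1≤Rt)) (<⇒≤ (n<b^n 4 (y * Rt) (s≤s (s≤s z≤n))))
      dense₁ : (4 ^ K * (suc (Par.d n t) * piece-margin F)) ^ p ≤ m ^ q
      dense₁ = ≤-trans (≤-reflexive (cong (_^ p) (lem c₂ (suc (Par.d n t)) (piece-margin F)))) (Par.M.A≤root^q n t)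
        where
        lem : ∀ a b c → a * (b * c) ≡ a * c * b
        lem = solve-∀
      dense₂ : (4 ^ K * (suc μ₀ * suc μ₀)) ^ (p * e) ≤ m
      dense₂ = ≤-trans (^-monoʳ-≤ (c₂ * (suc μ₀ * suc μ₀)) ⦃ >-nonZero (*-mono-≤ 1≤c₂ (s≤s (z≤n {μ₀ + μ₀ * suc μ₀}))) ⦄ (*-monoʳ-≤ p (n≤1+n e))) (proj₁ (proj₂ (proj₂ margin)))
      sizes : n * e < suc μ₀ ^ R
      sizes = begin-strict
        n * e ≤⟨ *-monoˡ-≤ e n≤μ^G ⟩
        c₃ * suc μ₀ ^ G * e ≡⟨ lem c₃ (suc μ₀ ^ G) e ⟩
        c₃ * e * suc μ₀ ^ G <⟨ *-monoˡ-< (suc μ₀ ^ G) ⦃ m^n≢0 (suc μ₀) G ⦄ (s≤s (≤-trans (≤-trans (m≤m+n (c₃ * e) _) (m≤n+m _ 3)) U≤μ₀)) ⟩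
        suc μ₀ * suc μ₀ ^ G ∎
        where
        open ≤-Reasoning
        lem : ∀ a b c → a * b * c ≡ a * c * b
        lem = solve-∀
      Z≤₂ : 4 * mm * n * (R * 4) ^ R ≤ suc μ₀ ^ R
      Z≤₂ = begin
        4 * mm * n * (R * 4) ^ R ≤⟨ *-monoˡ-≤ ((R * 4) ^ R) (*-monoʳ-≤ (4 * mm) n≤μ^G) ⟩
        4 * mm * (c₃ * suc μ₀ ^ G) * (R * 4) ^ R ≡⟨ lem (4 * mm) c₃ (suc μ₀ ^ G) ((R * 4) ^ R) ⟩
        4 * mm * c₃ * (R * 4) ^ R * suc μ₀ ^ G
          ≤⟨ *-monoˡ-≤ (suc μ₀ ^ G) (≤-trans (≤-trans (≤-trans (m≤n+m (4 * mm * c₃ * (R * 4) ^ R) (c₃ * e)) (m≤n+m _ 3)) U≤μ₀) (n≤1+n μ₀)) ⟩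
        suc μ₀ * suc μ₀ ^ G ∎
        where
        open ≤-Reasoning
        lem : ∀ a b c d → a * (b * c) * d ≡ a * b * d * c
        lem = solve-∀
      -- The failure bound for the near packing is exponentially small in the chunk size, whereas
      -- `n` is only polynomial in it.
      Z≤₁ : ∀ r → m < suc r * K → 4 * mm * n ≤ 2 ^ suc r
      Z≤₁ r m< = *-cancelʳ-≤ _ _ x (begin
        4 * mm * n * x ≤⟨ *-monoˡ-≤ x (*-monoʳ-≤ (4 * mm) (≤-trans B.n≤m^c (^-monoˡ-≤ c (<⇒≤ m<)))) ⟩
        4 * mm * (x * K) ^ c * x ≡⟨ cong (λ z → 4 * mm * z * x) (^-distribʳ-* c x K) ⟩
        4 * mm * (x ^ c * K ^ c) * x ≡⟨ lem₁ (4 * mm) (x ^ c) (K ^ c) x ⟩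
        4 * mm * K ^ c * (x * x ^ c) ≤⟨ *-monoʳ-≤ (4 * mm * K ^ c) (power≤exponential c x) ⟩
        4 * mm * K ^ c * (suc c ^ suc c * 2 ^ x) ≡⟨ lem₂ (4 * mm) (K ^ c) (suc c ^ suc c) (2 ^ x) ⟩
        2 ^ x * U₂ ≤⟨ *-monoʳ-≤ (2 ^ x) (*-cancelʳ-≤ U₂ x K ⦃ >-nonZero 1≤K ⦄ (≤-trans (^-cancelˡ-≤ c 1≤c (≤-trans T₂≤n B.n≤m^c)) (<⇒≤ m<))) ⟩
        2 ^ x * x ∎)
        where
        open ≤-Reasoning
        x : ℕ
        x = suc r
        lem₁ : ∀ a b c x → a * (b * c) * x ≡ a * c * (x * b)
        lem₁ = solve-∀
        lem₂ : ∀ a b c d → a * b * (c * d) ≡ d * (a * (b * c))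
        lem₂ = solve-∀

-- Here `d* = p / q`, `δ = a / c`, `K₁ = k₁ / l₁` and `K₂ = k₂ / l₂`. The two bounds on `t` are
-- raised to the powers `p` and `c`, the bound on the budget to the power `q`. The constants found
-- are integers, so `l₁` and `l₂` are 1, and the strategy is deterministic.
theorem5p7 : (F : Graph) → ¬ VertexBalanced F →
    (p q : ℕ) → 1 ≤ q → IsDStar F p q →
    (a c : ℕ) → 1 ≤ a → 1 ≤ c →
    Σ ℕ λ k₁ → Σ ℕ λ l₁ → Σ ℕ λ k₂ → Σ ℕ λ l₂ →
    (1 ≤ k₁) × (1 ≤ l₁) × (1 ≤ k₂) × (1 ≤ l₂) ×
    ((t : ℕ → ℕ) →
    (Σ ℕ λ N → (n : ℕ) → n ≥ N → k F ∣ n →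
    ((k₁ ^ p) * (n ^ (2 * p)) ≤ (l₁ ^ p) * ((t n ^ p) * (n ^ q))) ×
    ((t n ^ c) * (n ^ a) ≤ n ^ (2 * c))) →
    Σ (ℕ → ℕ) λ b → Σ ((n : ℕ) → List (Strategy n)) λ L →
    ((n : ℕ) → 1 ≤ length (L n)) ×
    (Σ ℕ λ N → (n : ℕ) → n ≥ N → k F ∣ n →
    (b n ^ q) * ((l₂ ^ q) * ((t n ^ p) * (n ^ q)))
    ≤ (k₂ ^ q) * ((t n ^ q) * (n ^ (2 * p)))) ×
    ((m : ℕ) → 1 ≤ m → Σ ℕ λ N → (n : ℕ) → n ≥ N → k F ∣ n →
    SuccProbAtLeast F n (t n) (b n) (L n) m))
theorem5p7 F unbalanced p q 1≤q dstar a c 1≤a 1≤c =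
  k₁ , 1 , k₂ , 1 , 1≤k₁ , ≤-refl , 1≤k₂ , ≤-refl , λ t (N₀ , range) →
    let inRange : ∀ n → n ≥ N₀ → k F ∣ n → InRange n (t n)
        inRange n n≥ dvd = ≤-trans (proj₁ (range n n≥ dvd)) (≤-reflexive (one-power p _)) , proj₂ (range n n≥ dvd)
    in (λ n → Par.b n (t n)) , (λ n → strategy n (t n) ∷ []) , (λ n → ≤-refl) ,
       (suc N₀ , λ n n> dvd → ≤-trans (≤-reflexive (cong (Par.b n (t n) ^ q *_) (one-power q _)))
         (within-budget n (t n) (quotient dvd) (≤-trans (s≤s z≤n) n>) (trans (_∣_.equality dvd) (*-comm (quotient dvd) (k F))) (inRange n (<⇒≤ n>) dvd))) ,
       λ mm _ → suc N₀ + Threshold.T₀ mm , λ n n≥ dvd → Threshold.succeeds mm n (t n) (quotient dvd)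
         (≤-trans (s≤s z≤n) n≥) (≤-trans (m≤n+m (Threshold.T₀ mm) (suc N₀)) n≥) (trans (_∣_.equality dvd) (*-comm (quotient dvd) (k F)))
         (inRange n (≤-trans (≤-trans (n≤1+n N₀) (m≤m+n (suc N₀) (Threshold.T₀ mm))) n≥) dvd)
  where
  open Final F unbalanced p q 1≤q dstar a c 1≤a 1≤c
  one-power : ∀ r x → 1 ^ r * x ≡ x
  one-power r x = trans (cong (_* x) (^-zeroˡ r)) (*-identityˡ x)
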